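{- Let $\Gamma$ be a connected graph with $n$ vertices. Then for all $i,j$ there is an isomorphism of vector spaces $$\varphi\colon H^{i,\le j}_{\Phi+d}(\Gamma)/H^{i,\le j-1}_{\Phi+d}(\Gamma)\;\cong\;\frac{\operatorname{Ker}\big(\Phi\colon H^{i,j}(\Gamma)\to H^{i+1,j-2}(\Gamma)\big)}{\operatorname{Im}\big(\Phi\colon H^{i-1,j+2}(\Gamma)\to H^{i,j}(\Gamma)\big)}.$$
   Context: Let $\Gamma$ be a finite graph with totally ordered edges. States. A state is a spanning subgraph $s$ (all vertices, a subset of the edges). Its dimension is its number of edges. An enhanced state labels each connected component of $s$ by $1$ or $x$. Its degree is the number of $x$-labels. Cochain groups. $C^{i,j}(\Gamma)$ is the $\mathbb{Q}$-space with basis the enhanced states of dimension $i$ and degree $j$. Sign. Let $n(s,e)$ be the number of edges of $s$ smaller than $e$. Chromatic differential $d\colon C^{i,j}\to C^{i+1,j}$. Set $d(S)=\sum_{e\notin s}(-1)^{n(s,e)}T_e$, where: - $T_e$ is the enhanced state on $s\cup\{e\}$ with the same labels if $e$ joins a component to itself; - if $e$ joins components labelled $a,b$, the merged component gets label $ab$ in $\mathbb{Q}[x]/(x^2)$ ($1\cdot 1=1$, $1\cdot x=x\cdot 1=x$, $x\cdot x=0$, zero term if $ab=0$). The chromatic cohomology is $H^{i,j}(\Gamma)=\ker(d|_{C^{i,j}})/\operatorname{im}(d|_{C^{i-1,j}})$. The map $\Phi\colon C^{i,j}\to C^{i+1,j-2}$. Set $\Phi(S)=\sum(-1)^{n(s,e)}U_e$,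 summed over the edges $e\notin s$ joining two distinct $x$-labelled components of $s$. Here $U_e$ is the enhanced state on $s\cup\{e\}$ with the merged component labelled $1$. Properties used in the statement. $\Phi^2=0$ and $\Phi d+d\Phi=0$, so $\Phi$ induces maps $\Phi\colon H^{i,j}(\Gamma)\to H^{i+1,j-2}(\Gamma)$. The sum $\Phi+d$ is a differential. Filtration. Let $C^{i,\le j}=\bigoplus_{k\le j}C^{i,k}$, which is preserved by $\Phi+d$. Define $H^{i,\le j}_{\Phi+d}(\Gamma)$ as the image of $H^i(C^{*,\le j},\Phi+d)\to H^i(C^*,\Phi+d)$ induced by inclusion. -}

module Defs where

open import Data.Bool using (Bool; true; false; _∧_; _∨_; not; if_then_else_)
open import Data.Nat as N using (ℕ; zero; suc)
open import Data.Fin using (Fin; toℕ)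
open import Data.Fin.Properties using () renaming (_≟_ to _≟ᶠ_)
open import Data.Vec using (Vec; []; _∷_; lookup; _[_]≔_)
open import Data.Vec.Properties using (≡-dec)
open import Data.Bool.Properties using () renaming (_≟_ to _≟ᵇ_)
open import Data.List as L using (List; []; _∷_; _++_; concatMap; allFin)
open import Data.Product using (Σ; _×_; _,_; ∃; ∃-syntax)
open import Data.Sum using (_⊎_)
open import Data.Integer as Z using (ℤ; +_)
import Data.Rational as Q
open Q using (ℚ; 0ℚ; 1ℚ)
open import Relation.Nullary using (yes; no)
open import Relation.Nullary.Decidable using (⌊_⌋)
open import Relation.Binary.PropositionalEquality using (_≡_)

-- Finite graphs with totally ordered edges.
-- Vertices are Fin n, edges are Fin m (ordered as in Fin m); edge e has
-- endpoints  ends e  (loops and multiple edges are allowed).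

record Graph : Set where
  field
    n    : ℕ
    m    : ℕ
    ends : Fin m → Fin n × Fin n

anyL : {A : Set} → (A → Bool) → List A → Bool
anyL p []       = false
anyL p (x ∷ xs) = p x ∨ anyL p xs

allL : {A : Set} → (A → Bool) → List A → Bool
allL p []       = true
allL p (x ∷ xs) = p x ∧ allL p xs

countL : {A : Set} → (A → Bool) → List A → ℕ
countL p []       = 0
countL p (x ∷ xs) = (if p x then 1 else 0) N.+ countL p xs

countTrue : {k : ℕ} → Vec Bool k → ℕ
countTrue []           = 0
countTrue (true  ∷ bs) = suc (countTrue bs)
countTrue (false ∷ bs) = countTrue bs

allVecs : (k : ℕ) → List (Vec Bool k)
allVecs zero    = [] ∷ []
allVecs (suc k) = L.map (true ∷_) (allVecs k) ++ L.map (false ∷_) (allVecs k)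

sumℚ : List ℚ → ℚ
sumℚ []       = 0ℚ
sumℚ (q ∷ qs) = q Q.+ sumℚ qs

eqℕ : ℕ → ℕ → Bool
eqℕ a b = ⌊ a N.≟ b ⌋

-- Linear isomorphisms between subquotients of a common ambient Q-space.
-- A subquotient is given by a membership predicate (a subspace Z of the
-- ambient space) and the relation "x - y lies in the subspace B" (B ⊆ Z).
-- A linear isomorphism Z₁/B₁ ≅ Z₂/B₂ is given on representatives.

record SubQuot (V : Set) : Set₁ where
  field
    Mem : V → Set
    Rel : V → V → Set

record LinIso {V : Set} (_+ᵥ_ : V → V → V) (_·ᵥ_ : ℚ → V → V)
              (A B : SubQuot V) : Set where
  open SubQuot
  field
    φ    : (x : V) → Mem A x → V
    into : ∀ x (p : Mem A x) → Mem B (φ x p)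
    resp : ∀ x y (p : Mem A x) (q : Mem A y) → Rel A x y → Rel B (φ x p) (φ y q)
    add  : ∀ x y (p : Mem A x) (q : Mem A y) (r : Mem A (x +ᵥ y)) →
           Rel B (φ (x +ᵥ y) r) (φ x p +ᵥ φ y q)
    scal : ∀ (c : ℚ) x (p : Mem A x) (q : Mem A (c ·ᵥ x)) →
           Rel B (φ (c ·ᵥ x) q) (c ·ᵥ φ x p)
    inj  : ∀ x y (p : Mem A x) (q : Mem A y) → Rel B (φ x p) (φ y q) → Rel A x y
    surj : ∀ y → Mem B y → Σ V λ x → Σ (Mem A x) λ p → Rel B (φ x p) y

module Chromatic (Γ : Graph) where
  open Graph Γ

  -- a state: subset of edges;  a vertex labelling: x ↦ true, 1 ↦ false
  StateE : Set
  StateE = Vec Bool m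

  reach : ℕ → StateE → Fin n → Fin n → Bool
  reach zero    s u v = ⌊ u ≟ᶠ v ⌋
  reach (suc k) s u v = reach k s u v ∨
    anyL (λ e → lookup s e ∧ stepOK e) (allFin m)
    where
    stepOK : Fin m → Bool
    stepOK e with ends e
    ... | (a , b) = (reach k s u a ∧ ⌊ b ≟ᶠ v ⌋) ∨ (reach k s u b ∧ ⌊ a ≟ᶠ v ⌋)

  -- u and v lie in the same connected component of s (walks of length ≤ n suffice)
  conn : StateE → Fin n → Fin n → Bool
  conn s u v = reach n s u v

  allEdges : StateE
  allEdges = Data.Vec.replicate m true

  Connected : Set
  Connected = ∀ u v → conn allEdges u v ≡ true

  isRep : StateE → Fin n → Bool
  isRep s v = allL (λ w → not (⌊ toℕ w N.<? toℕ v ⌋ ∧ conn s v w)) (allFin n)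

  rep : StateE → Fin n → Fin n
  rep s v = go (allFin n)
    where
    go : List (Fin n) → Fin n
    go []       = v
    go (w ∷ ws) = if conn s v w then w else go ws

  -- an enhanced state is encoded as (s , ℓ) where ℓ labels vertices, and only
  -- representatives of components may carry the label x (= true); the label of
  -- a component is the label of its representative.
  State : Set
  State = StateE × Vec Bool n

  Valid : State → Set
  Valid (s , ℓ) = ∀ v → lookup ℓ v ≡ true → isRep s v ≡ true

  dimS : State → ℕ
  dimS (s , ℓ) = countTrue s

  degS : State → ℕ
  degS (s , ℓ) = countTrue ℓ

  allStates : List State
  allStates = concatMap (λ s → L.map (s ,_) (allVecs n)) (allVecs m)

  nSign : StateE → Fin m → ℕ
  nSign s e = countL (λ f → lookup s f ∧ ⌊ toℕ f N.<? toℕ e ⌋) (allFin m)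

  signQ : ℕ → ℚ
  signQ zero    = 1ℚ
  signQ (suc k) = Q.- signQ k

  xlab : State → Fin n → Bool
  xlab (s , ℓ) v = lookup ℓ (rep s v)

  joinsXX : State → Fin m → Bool
  joinsXX (s , ℓ) e with ends e
  ... | (a , b) = not (conn s a b) ∧ xlab (s , ℓ) a ∧ xlab (s , ℓ) b

  -- labels on s ∪ {e}: a new component (rep v) gets label x iff it contains
  -- exactly one x-labelled old component.  In the cases where it is used
  -- below this is exactly: unchanged labels for non-merged components, the
  -- product label ab for a merge in d (with ab ≠ 0), and label 1 for the
  -- merged component in Φ.
  newLab : State → Fin m → Vec Bool n
  newLab (s , ℓ) e = Data.Vec.tabulate λ v →
    isRep t v ∧ eqℕ (countL (λ w → lookup ℓ w ∧ conn t v w) (allFin n)) 1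
    where t = s [ e ]≔ true

  dImg : State → List (ℚ × State)
  dImg (s , ℓ) = concatMap term (allFin m)
    where
    term : Fin m → List (ℚ × State)
    term e = if lookup s e then []
             else if joinsXX (s , ℓ) e then []   -- label product x·x = 0
             else (signQ (nSign s e) , ((s [ e ]≔ true) , newLab (s , ℓ) e)) ∷ []

  ΦImg : State → List (ℚ × State)
  ΦImg (s , ℓ) = concatMap term (allFin m)
    where
    term : Fin m → List (ℚ × State)
    term e = if lookup s e then []
             else if joinsXX (s , ℓ) e
                  then (signQ (nSign s e) , ((s [ e ]≔ true) , newLab (s , ℓ) e)) ∷ []
                  else []

  Cochain : Set
  Cochain = State → ℚ

  eqState : State → State → Bool
  eqState (s , ℓ) (t , κ) = ⌊ ≡-dec _≟ᵇ_ s t ⌋ ∧ ⌊ ≡-dec _≟ᵇ_ ℓ κ ⌋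

  coeffIn : List (ℚ × State) → State → ℚ
  coeffIn []             T = 0ℚ
  coeffIn ((c , S) ∷ xs) T = (if eqState S T then c else 0ℚ) Q.+ coeffIn xs T

  extend : (State → List (ℚ × State)) → Cochain → Cochain
  extend img f T = sumℚ (L.map (λ S → f S Q.* coeffIn (img S) T) allStates)

  _⊕_ : Cochain → Cochain → Cochain
  (f ⊕ g) S = f S Q.+ g S

  _⊖_ : Cochain → Cochain → Cochain
  (f ⊖ g) S = f S Q.- g S

  _⊙_ : ℚ → Cochain → Cochain
  (c ⊙ f) S = c Q.* f S

  _≐_ : Cochain → Cochain → Set
  f ≐ g = ∀ S → f S ≡ g S

  zeroC : Cochain
  zeroC S = 0ℚ

  d : Cochain → Cochain
  d = extend dImg

  Φ : Cochain → Cochain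
  Φ = extend ΦImg

  D : Cochain → Cochain
  D f = Φ f ⊕ d f

  InC : ℤ → ℤ → Cochain → Set
  InC i j f = ∀ S → f S ≡ 0ℚ ⊎ (Valid S × (+ dimS S ≡ i) × (+ degS S ≡ j))

  InCtot : ℤ → Cochain → Set
  InCtot i f = ∀ S → f S ≡ 0ℚ ⊎ (Valid S × (+ dimS S ≡ i))

  InCle : ℤ → ℤ → Cochain → Set
  InCle i j f = ∀ S → f S ≡ 0ℚ ⊎ (Valid S × (+ dimS S ≡ i) × (+ degS S Z.≤ j))

  -- Left side:  H^{i,≤j}_{Φ+d} / H^{i,≤j-1}_{Φ+d}, subquotient of C^i.
  -- H^{i,≤j}_{Φ+d} ⊆ H^i(C,Φ+d) = classes [z] of (Φ+d)-cocycles z ∈ C^i which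
  -- equal the class of some (Φ+d)-cocycle z' ∈ C^{i,≤j}.

  InHle : ℤ → ℤ → Cochain → Set
  InHle i j z = InCtot i z × D z ≐ zeroC ×
    (∃[ z' ] ∃[ y ] (InCle i j z' × D z' ≐ zeroC × InCtot (i Z.- Z.1ℤ) y ×
                    (z ⊖ z') ≐ D y))

  LHS : ℤ → ℤ → SubQuot Cochain
  LHS i j = record
    { Mem = InHle i j
    ; Rel = λ z z' → InHle i (j Z.- Z.1ℤ) (z ⊖ z')
    }

  -- Right side:  Ker(Φ : H^{i,j} → H^{i+1,j-2}) / Im(Φ : H^{i-1,j+2} → H^{i,j}),
  -- subquotient of C^{i,j}.  Elements: d-cocycles z ∈ C^{i,j} whose class
  -- [Φ z] vanishes in H^{i+1,j-2}, i.e. Φ z = d y for some y ∈ C^{i,j-2}.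
  -- [z] ~ [z'] iff [z - z'] = [Φ w] in H^{i,j} for some d-cocycle
  -- w ∈ C^{i-1,j+2}, i.e. Φ w - (z - z') = d y for some y ∈ C^{i-1,j}.

  InKerΦ : ℤ → ℤ → Cochain → Set
  InKerΦ i j z = InC i j z × d z ≐ zeroC ×
    (∃[ y ] (InC i (j Z.- + 2) y × Φ z ≐ d y))

  InImΦ : ℤ → ℤ → Cochain → Set
  InImΦ i j z = ∃[ w ] ∃[ y ] (InC (i Z.- Z.1ℤ) (j Z.+ + 2) w × d w ≐ zeroC ×
                               InC (i Z.- Z.1ℤ) j y × (Φ w ⊖ z) ≐ d y)

  RHS : ℤ → ℤ → SubQuot Cochain
  RHS i j = record
    { Mem = InKerΦ i j
    ; Rel = λ z z' → InImΦ i j (z ⊖ z')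
    }

  _≅_ : SubQuot Cochain → SubQuot Cochain → Set
  A ≅ B = LinIso _⊕_ _⊙_ A B

{-# OPTIONS --safe #-}
module Submission where

-- Filter (C , Φ + d) by the degree. As d preserves the degree and Φ lowers it by
-- 2, the theorem says that the spectral sequence of the filtration has no
-- differentials beyond d and Φ. They would go from H^{i,j} to H^{i+1,j-2r} with
-- r ≥ 2 and lower i + j by at least 3, but H^{i,j} = 0 unless n-1 ≤ i+j ≤ n.
--
-- This vanishing is proved by deletion and contraction; adding a loop makes the
-- complex acyclic. Above i + j = n the edges may be treated in any order. Below
-- i + j = n-1 one passes to the subcomplex x·C in which the component of vertex
-- 0 is labelled x, the quotient C/x·C being isomorphic to it up to a shift of
-- the degree, and contracts only edges e leaving that component. If e is a
-- bridge, the deletion is disconnected and not covered by induction, but the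
-- kernel of its merging map is isomorphic to the complex of the contraction.
--
-- The identities between edge operators are checked on basis states, with labels
-- multiplied in ℚ[x]/(x² = 1), where only parities matter; d is recovered from
-- Φ + d as the part which preserves the degree.
open import Defs
open import Algebra.Bundles using (CommutativeRing)
import Algebra.Properties.Semiring.Sum as SemiringSum
open import Data.Bool using (Bool; true; false; _∧_; _∨_; _xor_; not; if_then_else_)
open import Data.Bool.Properties
  using (xor-∧-commutativeRing; ∧-comm; ∧-zeroʳ; ∧-identityʳ) renaming (_≟_ to _≟ᵇ_)
open import Data.Empty using (⊥; ⊥-elim)
open import Data.Fin using (Fin; zero; suc; toℕ)
open import Data.Fin.Properties using (any?; toℕ-injective) renaming (_≟_ to _≟ᶠ_)
open import Data.Integer as ℤ using (ℤ)
import Data.Integer.Properties as ℤ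
import Data.Integer.Solver as ℤSolver
open import Data.List using (List; []; _∷_; _++_; map; concatMap; allFin; tabulate; length)
open import Data.List.Membership.Propositional using (_∈_; _∉_)
open import Data.List.Membership.Propositional.Properties using (∈-allFin)
open import Data.List.Properties using (concatMap-cong)
open import Data.List.Relation.Binary.Permutation.Propositional as Perm using (_↭_; ↭-sym; ↭⇒↭ₛ)
open import Data.List.Relation.Binary.Permutation.Propositional.Properties using (∈-resp-↭; ↭-length)
open import Data.List.Relation.Unary.All as All using (All; []; _∷_)
open import Data.List.Relation.Unary.All.Properties using (++⁺)
open import Data.List.Relation.Unary.AllPairs using ([]; _∷_)
open import Data.List.Relation.Unary.Any using (here; there)
open import Data.List.Relation.Unary.Unique.Propositional using (Unique)
open import Data.List.Relation.Unary.Unique.Propositional.Properties using (allFin⁺)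
open import Data.Nat as ℕ using (ℕ; zero; suc; z≤n; s≤s)
import Data.Nat.Properties as ℕ
open import Data.Product using (Σ; ∃; ∃₂; _×_; _,_; proj₁; proj₂; map₁)
open import Data.Rational as ℚ using (ℚ; 0ℚ; 1ℚ; _+_; _*_; -_; _-_)
import Data.Rational.Properties as ℚ
open import Data.Rational.Solver using (module +-*-Solver)
open import Data.Sum as Sum using (_⊎_; inj₁; inj₂)
open import Data.Unit using (⊤; tt)
open import Data.Vec as Vec using (Vec; []; _∷_; lookup; _[_]≔_)
open import Data.Vec.Properties
  using (≡-dec; lookup-replicate; lookup∘tabulate; lookup∘updateAt; lookup∘updateAt′;
         tabulate∘lookup; tabulate-cong; []≔-commutes; []≔-idempotent)
open import Function using (_∘_; id)
open import Relation.Binary.Definitions using (tri<; tri≈; tri>)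
open import Relation.Binary.PropositionalEquality
open import Relation.Nullary using (¬_; Dec; yes; no)
open import Relation.Nullary.Decidable using (⌊_⌋)
open +-*-Solver using (solve; _:=_; _:+_; _:*_; :-_; _:-_; con)
open ℤSolver.+-*-Solver using ()
  renaming (solve to solveℤ; _:=_ to _≔ℤ_; _:+_ to _+ℤ_; _:-_ to _-ℤ_; con to conℤ)

-- Minors of the graph are never built. Deletion and contraction happen inside the states of `Γ`: a
-- list `U` of free edges and a state `C` of contracted ones cut out a family of states. Contracted
-- edges still count in the dimension, so signs and bidegrees need no shift. The engine is that the
-- merging map `∂ e` from the deletion of `e` to the contraction is onto, since a component may be
-- split off with label 1. Hence only its kernel matters: it is zero for a loop, and for a bridge at
-- a root labelled `x` it is spanned by the states with `x` on both sides. Edges are contracted only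
-- at the root so that the contracted ones form a tree there. When no edge leaves it, the tree
-- spans, so `i` is at least n-1, and the label at the root makes `j` at least 1. The width of the
-- strip n-1 ≤ i+j ≤ n is what the isomorphism needs. The obstruction to lifting a class at (i,j)
-- lies in bidegrees (i+1,k) with k ≤ j-4, where the sum is at most n-3. The primitives that could
-- identify more than Φ does lie in (i-1,k) with k ≥ j+3, where the sum is at least n+1.

true≢false : true ≢ false
true≢false ()

bool-cases : ∀ b → b ≡ true ⊎ b ≡ false
bool-cases true  = inj₁ refl
bool-cases false = inj₂ refl

not-true⇒false : ∀ {b} → b ≢ true → b ≡ false
not-true⇒false {true}  h = ⊥-elim (h refl)
not-true⇒false {false} h = refl

false⇒not-true : ∀ {b} → b ≡ false → b ≢ true
false⇒not-true refl ()

≡true-ext : ∀ {a b} → (a ≡ true → b ≡ true) → (b ≡ true → a ≡ true) → a ≡ b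
≡true-ext {true}          f g = sym (f refl)
≡true-ext {false} {true}  f g = g refl
≡true-ext {false} {false} f g = refl

∧-true⁻ : ∀ {a b} → a ∧ b ≡ true → a ≡ true × b ≡ true
∧-true⁻ {true} e = refl , e

∧-true⁺ : ∀ {a b} → a ≡ true → b ≡ true → a ∧ b ≡ true
∧-true⁺ refl refl = refl

∨-true⁻ : ∀ {a b} → a ∨ b ≡ true → a ≡ true ⊎ b ≡ true
∨-true⁻ {true}  e = inj₁ refl
∨-true⁻ {false} e = inj₂ e

∨-trueˡ : ∀ {a b} → a ≡ true → a ∨ b ≡ true
∨-trueˡ refl = refl

∨-trueʳ : ∀ {a b} → b ≡ true → a ∨ b ≡ true
∨-trueʳ {true}  e = refl
∨-trueʳ {false} e = e

module _ {P : Set} where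
  dec-true⁻ : (d : Dec P) → ⌊ d ⌋ ≡ true → P
  dec-true⁻ (yes p) _ = p

  dec-true⁺ : (d : Dec P) → P → ⌊ d ⌋ ≡ true
  dec-true⁺ (yes _) _ = refl
  dec-true⁺ (no ¬p) p = ⊥-elim (¬p p)

  dec-false⁺ : (d : Dec P) → ¬ P → ⌊ d ⌋ ≡ false
  dec-false⁺ (yes p) ¬p = ⊥-elim (¬p p)
  dec-false⁺ (no _)  _  = refl

module _ {A : Set} where
  anyL⁺ : ∀ (p : A → Bool) {x xs} → x ∈ xs → p x ≡ true → anyL p xs ≡ true
  anyL⁺ p (here refl) e = ∨-trueˡ e
  anyL⁺ p (there i)   e = ∨-trueʳ (anyL⁺ p i e)

  anyL⁻ : ∀ (p : A → Bool) xs → anyL p xs ≡ true → ∃ λ x → p x ≡ true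
  anyL⁻ p (x ∷ xs) e with ∨-true⁻ {p x} e
  ... | inj₁ h = x , h
  ... | inj₂ h = anyL⁻ p xs h

  allL⁺ : ∀ (p : A → Bool) xs → (∀ x → p x ≡ true) → allL p xs ≡ true
  allL⁺ p []       h = refl
  allL⁺ p (x ∷ xs) h = ∧-true⁺ (h x) (allL⁺ p xs h)

  allL⁻ : ∀ (p : A → Bool) {x xs} → x ∈ xs → allL p xs ≡ true → p x ≡ true
  allL⁻ p (here refl) e = proj₁ (∧-true⁻ e)
  allL⁻ p (there i)   e = allL⁻ p i (proj₂ (∧-true⁻ {p _} e))

-- Counting over Fin k

toNat : Bool → ℕ
toNat b = if b then 1 else 0

count : ∀ {k} → (Fin k → Bool) → ℕ
count {zero}  p = 0
count {suc k} p = toNat (p zero) ℕ.+ count (p ∘ suc)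

countL-tabulate : ∀ {A : Set} {k} (p : A → Bool) (f : Fin k → A) →
                  countL p (tabulate f) ≡ count (p ∘ f)
countL-tabulate {k = zero}  p f = refl
countL-tabulate {k = suc k} p f = cong (toNat (p (f zero)) ℕ.+_) (countL-tabulate p (f ∘ suc))

countL-allFin : ∀ {k} (p : Fin k → Bool) → countL p (allFin k) ≡ count p
countL-allFin p = countL-tabulate p id

countTrue-count : ∀ {k} (v : Vec Bool k) → countTrue v ≡ count (lookup v)
countTrue-count []          = refl
countTrue-count (true ∷ v)  = cong suc (countTrue-count v)
countTrue-count (false ∷ v) = countTrue-count v

count-cong : ∀ {k} {p q : Fin k → Bool} → (∀ i → p i ≡ q i) → count p ≡ count q
count-cong {zero}  h = refl
count-cong {suc k} h = cong₂ ℕ._+_ (cong toNat (h zero)) (count-cong (h ∘ suc))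

count-≤ : ∀ {k} (p : Fin k → Bool) → count p ℕ.≤ k
count-≤ {zero}  p = z≤n
count-≤ {suc k} p with p zero
... | true  = s≤s (count-≤ (p ∘ suc))
... | false = ℕ.m≤n⇒m≤1+n (count-≤ (p ∘ suc))

count-all : ∀ {k} (p : Fin k → Bool) → (∀ i → p i ≡ true) → count p ≡ k
count-all {zero}  p h = refl
count-all {suc k} p h rewrite h zero = cong suc (count-all (p ∘ suc) (h ∘ suc))

count-none : ∀ {k} (p : Fin k → Bool) → (∀ i → p i ≡ false) → count p ≡ 0
count-none {zero}  p h = refl
count-none {suc k} p h rewrite h zero = count-none (p ∘ suc) (h ∘ suc)

count-mono : ∀ {k} {p q : Fin k → Bool} → (∀ i → p i ≡ true → q i ≡ true) → count p ℕ.≤ count q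
count-mono {zero}  h = z≤n
count-mono {suc k} {p} {q} h with p zero | q zero | h zero
... | true  | true  | _ = s≤s (count-mono (h ∘ suc))
... | true  | false | f = ⊥-elim (true≢false (sym (f refl)))
... | false | true  | _ = ℕ.m≤n⇒m≤1+n (count-mono (h ∘ suc))
... | false | false | _ = count-mono (h ∘ suc)

count-remove : ∀ {k} (p : Fin k → Bool) i → count p ≡ toNat (p i) ℕ.+ count (λ j → p j ∧ not ⌊ j ≟ᶠ i ⌋)
count-remove {suc k} p zero rewrite ∧-zeroʳ (p zero) =
  cong (toNat (p zero) ℕ.+_) (count-cong (λ j → sym (∧-identityʳ (p (suc j)))))
count-remove {suc k} p (suc i) rewrite ∧-identityʳ (p zero) = begin
  a ℕ.+ count (p ∘ suc)     ≡⟨ cong (a ℕ.+_) (count-remove (p ∘ suc) i) ⟩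
  a ℕ.+ (b ℕ.+ c)           ≡⟨ ℕ.+-assoc a b c ⟨
  (a ℕ.+ b) ℕ.+ c           ≡⟨ cong (ℕ._+ c) (ℕ.+-comm a b) ⟩
  (b ℕ.+ a) ℕ.+ c           ≡⟨ ℕ.+-assoc b a c ⟩
  b ℕ.+ (a ℕ.+ c)           ≡⟨ cong (λ x → b ℕ.+ (a ℕ.+ x)) (count-cong shift) ⟩
  b ℕ.+ (a ℕ.+ count (λ j → p (suc j) ∧ not ⌊ suc j ≟ᶠ suc i ⌋)) ∎
  where
  open ≡-Reasoning
  a = toNat (p zero)
  b = toNat (p (suc i))
  c = count (λ j → p (suc j) ∧ not ⌊ j ≟ᶠ i ⌋)
  shift : ∀ j → p (suc j) ∧ not ⌊ j ≟ᶠ i ⌋ ≡ p (suc j) ∧ not ⌊ suc j ≟ᶠ suc i ⌋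
  shift j with j ≟ᶠ i
  ... | yes _ = refl
  ... | no  _ = refl

count-one : ∀ {k} (p : Fin k → Bool) i → (∀ j → p j ≡ true → j ≡ i) → count p ≡ toNat (p i)
count-one p i h = begin
  count p                                              ≡⟨ count-remove p i ⟩
  toNat (p i) ℕ.+ count (λ j → p j ∧ not ⌊ j ≟ᶠ i ⌋)    ≡⟨ cong (toNat (p i) ℕ.+_) (count-none _ none) ⟩
  toNat (p i) ℕ.+ 0                                    ≡⟨ ℕ.+-identityʳ _ ⟩
  toNat (p i) ∎
  where
  open ≡-Reasoning
  none : ∀ j → p j ∧ not ⌊ j ≟ᶠ i ⌋ ≡ false
  none j with j ≟ᶠ i
  ... | yes _ = ∧-zeroʳ _
  ... | no ne = not-true⇒false (λ e → ne (h j (proj₁ (∧-true⁻ e))))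

count-two : ∀ {k} (p : Fin k → Bool) i i' → i ≢ i' → (∀ j → p j ≡ true → j ≡ i ⊎ j ≡ i') →
            count p ≡ toNat (p i) ℕ.+ toNat (p i')
count-two p i i' ne h = trans (count-remove p i) (cong (toNat (p i) ℕ.+_)
  (trans (count-one _ i' only) (cong toNat at)))
  where
  only : ∀ j → p j ∧ not ⌊ j ≟ᶠ i ⌋ ≡ true → j ≡ i'
  only j e with j ≟ᶠ i
  only j e | yes _ = ⊥-elim (true≢false (sym (trans (sym (∧-zeroʳ (p j))) e)))
  only j e | no ni with h j (proj₁ (∧-true⁻ e))
  ... | inj₁ x = ⊥-elim (ni x)
  ... | inj₂ x = x
  at : p i' ∧ not ⌊ i' ≟ᶠ i ⌋ ≡ p i'
  at with i' ≟ᶠ i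
  ... | yes x = ⊥-elim (ne (sym x))
  ... | no  _ = ∧-identityʳ _

count-strict : ∀ {k} {p q : Fin k → Bool} → (∀ i → p i ≡ true → q i ≡ true) →
               ∀ i → p i ≡ false → q i ≡ true → suc (count p) ℕ.≤ count q
count-strict {p = p} {q} h i pi qi = begin
  suc (count p)                                             ≤⟨ s≤s (count-mono sub) ⟩
  suc (count (λ j → q j ∧ not ⌊ j ≟ᶠ i ⌋))                   ≡⟨ cong (λ b → toNat b ℕ.+ count (λ j → q j ∧ not ⌊ j ≟ᶠ i ⌋)) qi ⟨
  toNat (q i) ℕ.+ count (λ j → q j ∧ not ⌊ j ≟ᶠ i ⌋)         ≡⟨ count-remove q i ⟨
  count q ∎
  where
  open ℕ.≤-Reasoning
  sub : ∀ j → p j ≡ true → q j ∧ not ⌊ j ≟ᶠ i ⌋ ≡ true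
  sub j e with j ≟ᶠ i
  ... | yes refl = ⊥-elim (true≢false (trans (sym e) pi))
  ... | no _     = ∧-true⁺ (h j e) refl

count-insert : ∀ {k} {p q : Fin k → Bool} i → (∀ j → q j ≡ true → p j ≡ true ⊎ j ≡ i) →
               count q ℕ.≤ suc (count p)
count-insert {p = p} {q} i h = begin
  count q                                             ≡⟨ count-remove q i ⟩
  toNat (q i) ℕ.+ count (λ j → q j ∧ not ⌊ j ≟ᶠ i ⌋)   ≤⟨ ℕ.+-mono-≤ (toNat≤1 (q i)) (count-mono sub) ⟩
  suc (count p) ∎
  where
  open ℕ.≤-Reasoning
  toNat≤1 : ∀ b → toNat b ℕ.≤ 1
  toNat≤1 true  = s≤s z≤n
  toNat≤1 false = z≤n
  sub : ∀ j → q j ∧ not ⌊ j ≟ᶠ i ⌋ ≡ true → p j ≡ true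
  sub j e with j ≟ᶠ i
  sub j e | yes _ = ⊥-elim (true≢false (sym (trans (sym (∧-zeroʳ (q j))) e)))
  sub j e | no ni with h j (proj₁ (∧-true⁻ e))
  ... | inj₁ x = x
  ... | inj₂ x = ⊥-elim (ni x)

-- Sums in the field with two elements

open CommutativeRing xor-∧-commutativeRing using () renaming (semiring to 𝔽₂)
open SemiringSum 𝔽₂ public
  using (sum; sum-cong-≗; ∑-distrib-+; ∑-comm; *-distribʳ-sum; *-distribˡ-sum)

odd : ℕ → Bool
odd zero    = false
odd (suc k) = not (odd k)

odd-toNat+ : ∀ b k → odd (toNat b ℕ.+ k) ≡ b xor odd k
odd-toNat+ true  k = refl
odd-toNat+ false k = refl

odd-toNat : ∀ b → odd (toNat b) ≡ b
odd-toNat true  = refl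
odd-toNat false = refl

odd-count : ∀ {k} (p : Fin k → Bool) → odd (count p) ≡ sum p
odd-count {zero}  p = refl
odd-count {suc k} p = trans (odd-toNat+ (p zero) _) (cong (p zero xor_) (odd-count (p ∘ suc)))

sum-one : ∀ {k} (p : Fin k → Bool) i → (∀ j → p j ≡ true → j ≡ i) → sum p ≡ p i
sum-one p i h = trans (sym (odd-count p)) (trans (cong odd (count-one p i h)) (odd-toNat (p i)))

eqℕ-1-toNat : ∀ b → eqℕ (toNat b) 1 ≡ b
eqℕ-1-toNat true  = refl
eqℕ-1-toNat false = refl

eqℕ-1-toNat₂ : ∀ b b' → eqℕ (toNat b ℕ.+ toNat b') 1 ≡ b xor b'
eqℕ-1-toNat₂ true  true  = refl
eqℕ-1-toNat₂ true  false = refl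
eqℕ-1-toNat₂ false true  = refl
eqℕ-1-toNat₂ false false = refl

module _ {A : Set} where
  lookup-ext : ∀ {k} {u v : Vec A k} → (∀ i → lookup u i ≡ lookup v i) → u ≡ v
  lookup-ext {u = u} {v} h = trans (sym (tabulate∘lookup u)) (trans (tabulate-cong h) (tabulate∘lookup v))

  lookup-≔ : ∀ {k} (v : Vec A k) i {x} → lookup (v [ i ]≔ x) i ≡ x
  lookup-≔ v i = lookup∘updateAt i v

  lookup-≔′ : ∀ {k} (v : Vec A k) {i j} {x} → i ≢ j → lookup (v [ j ]≔ x) i ≡ lookup v i
  lookup-≔′ v {i} {j} ne = lookup∘updateAt′ i j ne v

  ≔-same : ∀ {k} (v : Vec A k) i {x} → lookup v i ≡ x → v [ i ]≔ x ≡ v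
  ≔-same v i {x} e = lookup-ext go
    where
    go : ∀ j → lookup (v [ i ]≔ x) j ≡ lookup v j
    go j with j ≟ᶠ i
    ... | yes refl = trans (lookup-≔ v i) (sym e)
    ... | no ne    = lookup-≔′ v ne

countTrue-≔ : ∀ {k} (v : Vec Bool k) i b →
              toNat (lookup v i) ℕ.+ countTrue (v [ i ]≔ b) ≡ toNat b ℕ.+ countTrue v
countTrue-≔ (true ∷ v)  zero    true  = refl
countTrue-≔ (true ∷ v)  zero    false = refl
countTrue-≔ (false ∷ v) zero    true  = refl
countTrue-≔ (false ∷ v) zero    false = refl
countTrue-≔ (true ∷ v)  (suc i) b = trans (ℕ.+-suc _ _) (trans (cong suc (countTrue-≔ v i b)) (sym (ℕ.+-suc _ _)))
countTrue-≔ (false ∷ v) (suc i) b = countTrue-≔ v i b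

countTrue-set : ∀ {k} (v : Vec Bool k) i → lookup v i ≡ false → countTrue (v [ i ]≔ true) ≡ suc (countTrue v)
countTrue-set v i e = trans (cong (λ b → toNat b ℕ.+ countTrue (v [ i ]≔ true)) (sym e)) (countTrue-≔ v i true)

countTrue-unset : ∀ {k} (v : Vec Bool k) i → lookup v i ≡ true → suc (countTrue (v [ i ]≔ false)) ≡ countTrue v
countTrue-unset v i e = trans (cong (λ b → toNat b ℕ.+ countTrue (v [ i ]≔ false)) (sym e)) (countTrue-≔ v i false)

-- Sums over lists

∑ : {A : Set} → List A → (A → ℚ) → ℚ
∑ xs g = sumℚ (map g xs)

module _ {A : Set} where
  ∑-cong : ∀ xs {g h : A → ℚ} → (∀ x → g x ≡ h x) → ∑ xs g ≡ ∑ xs h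
  ∑-cong []       e = refl
  ∑-cong (x ∷ xs) e = cong₂ _+_ (e x) (∑-cong xs e)

  ∑-zero : ∀ xs {g : A → ℚ} → (∀ x → g x ≡ 0ℚ) → ∑ xs g ≡ 0ℚ
  ∑-zero []       e = refl
  ∑-zero (x ∷ xs) e = cong₂ _+_ (e x) (∑-zero xs e)

  ∑-+ : ∀ xs (g h : A → ℚ) → ∑ xs (λ x → g x + h x) ≡ ∑ xs g + ∑ xs h
  ∑-+ []       g h = refl
  ∑-+ (x ∷ xs) g h = trans (cong ((g x + h x) +_) (∑-+ xs g h))
    (solve 4 (λ a b c d → (a :+ b) :+ (c :+ d) := (a :+ c) :+ (b :+ d)) refl (g x) (h x) (∑ xs g) (∑ xs h))

  ∑-*ˡ : ∀ xs c (g : A → ℚ) → ∑ xs (λ x → c * g x) ≡ c * ∑ xs g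
  ∑-*ˡ []       c g = sym (ℚ.*-zeroʳ c)
  ∑-*ˡ (x ∷ xs) c g = trans (cong (c * g x +_) (∑-*ˡ xs c g)) (sym (ℚ.*-distribˡ-+ c (g x) (∑ xs g)))

  ∑-*ʳ : ∀ xs c (g : A → ℚ) → ∑ xs (λ x → g x * c) ≡ ∑ xs g * c
  ∑-*ʳ xs c g = trans (∑-cong xs (λ x → ℚ.*-comm (g x) c)) (trans (∑-*ˡ xs c g) (ℚ.*-comm c _))

  ∑-++ : ∀ xs ys (g : A → ℚ) → ∑ (xs ++ ys) g ≡ ∑ xs g + ∑ ys g
  ∑-++ []       ys g = sym (ℚ.+-identityˡ _)
  ∑-++ (x ∷ xs) ys g = trans (cong (g x +_) (∑-++ xs ys g)) (sym (ℚ.+-assoc (g x) _ _))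

  ∑-map : ∀ {B : Set} (f : B → A) xs (g : A → ℚ) → ∑ (map f xs) g ≡ ∑ xs (g ∘ f)
  ∑-map f []       g = refl
  ∑-map f (x ∷ xs) g = cong (g (f x) +_) (∑-map f xs g)

  ∑-concatMap : ∀ {B : Set} (f : B → List A) xs (g : A → ℚ) →
                ∑ (concatMap f xs) g ≡ ∑ xs (λ x → ∑ (f x) g)
  ∑-concatMap f []       g = refl
  ∑-concatMap f (x ∷ xs) g = trans (∑-++ (f x) (concatMap f xs) g) (cong (∑ (f x) g +_) (∑-concatMap f xs g))

∑-swap : ∀ {A B : Set} (xs : List A) (ys : List B) (g : A → B → ℚ) →
         ∑ xs (λ x → ∑ ys (g x)) ≡ ∑ ys (λ y → ∑ xs (λ x → g x y))
∑-swap []       ys g = sym (∑-zero ys (λ _ → refl))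
∑-swap (x ∷ xs) ys g = trans (cong (∑ ys (g x) +_) (∑-swap xs ys g)) (sym (∑-+ ys (g x) _))

δ : Bool → ℚ → ℚ
δ b x = if b then x else 0ℚ

δ-zero : ∀ b → δ b 0ℚ ≡ 0ℚ
δ-zero true  = refl
δ-zero false = refl

∑-δ : ∀ {A : Set} (xs : List A) b (g : A → ℚ) → ∑ xs (λ x → δ b (g x)) ≡ δ b (∑ xs g)
∑-δ xs true  g = refl
∑-δ xs false g = ∑-zero xs (λ _ → refl)

-- Expresses that `allVecs k` lists every vector exactly once, in the form needed later: a sum
-- against a Kronecker delta collapses to one value.
∑-allVecs : ∀ k (v : Vec Bool k) (g : Vec Bool k → ℚ) →
            ∑ (allVecs k) (λ w → δ ⌊ ≡-dec _≟ᵇ_ v w ⌋ (g w)) ≡ g v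
∑-allVecs zero    []      g = ℚ.+-identityʳ (g [])
∑-allVecs (suc k) (b ∷ v) g = trans (∑-++ (map (true ∷_) (allVecs k)) _ _)
  (trans (cong₂ _+_ (half b true) (half b false)) (total b))
  where
  pick : (b b' : Bool) → ℚ
  pick b b' = δ ⌊ b ≟ᵇ b' ⌋ (g (b' ∷ v))
  same : ∀ b b' w → ⌊ ≡-dec _≟ᵇ_ (b ∷ v) (b' ∷ w) ⌋ ≡ ⌊ b ≟ᵇ b' ⌋ ∧ ⌊ ≡-dec _≟ᵇ_ v w ⌋
  same b b' w = ≡true-ext
    (λ e → let p = dec-true⁻ (≡-dec _≟ᵇ_ (b ∷ v) (b' ∷ w)) e in
      ∧-true⁺ (dec-true⁺ (b ≟ᵇ b') (cong Vec.head p)) (dec-true⁺ (≡-dec _≟ᵇ_ v w) (cong Vec.tail p)))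
    (λ e → let p = ∧-true⁻ e in dec-true⁺ (≡-dec _≟ᵇ_ (b ∷ v) (b' ∷ w))
      (cong₂ _∷_ (dec-true⁻ (b ≟ᵇ b') (proj₁ p)) (dec-true⁻ (≡-dec _≟ᵇ_ v w) (proj₂ p))))
  δ-∧ : ∀ a c x → δ (a ∧ c) x ≡ δ a (δ c x)
  δ-∧ true  c x = refl
  δ-∧ false c x = refl
  half : ∀ b b' → ∑ (map (b' ∷_) (allVecs k)) (λ w → δ ⌊ ≡-dec _≟ᵇ_ (b ∷ v) w ⌋ (g w)) ≡ pick b b'
  half b b' = trans (∑-map (b' ∷_) (allVecs k) _) (trans
    (∑-cong (allVecs k) (λ w → trans (cong (λ c → δ c (g (b' ∷ w))) (same b b' w)) (δ-∧ ⌊ b ≟ᵇ b' ⌋ _ _)))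
    (trans (∑-δ (allVecs k) ⌊ b ≟ᵇ b' ⌋ _) (cong (δ ⌊ b ≟ᵇ b' ⌋) (∑-allVecs k v (g ∘ (b' ∷_))))))
  total : ∀ b → pick b true + pick b false ≡ g (b ∷ v)
  total true  = ℚ.+-identityʳ _
  total false = ℚ.+-identityˡ _

x≡-x⇒x≡0 : ∀ {x : ℚ} → x ≡ - x → x ≡ 0ℚ
x≡-x⇒x≡0 {x} e = trans (solve 1 (λ x → x := con ℚ.½ :* (x :+ x)) refl x)
  (trans (cong (ℚ.½ *_) (trans (cong (x +_) e) (ℚ.+-inverseʳ x))) (ℚ.*-zeroʳ ℚ.½))

-- Linear operators on cochains given on basis states, and supports

module Operators (Γ : Graph) where
  open Graph Γ
  open Chromatic Γ

  Img : Set
  Img = State → List (ℚ × State)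

  eqState⁻ : ∀ S T → eqState S T ≡ true → S ≡ T
  eqState⁻ (s , ℓ) (t , κ) e with ∧-true⁻ {⌊ ≡-dec _≟ᵇ_ s t ⌋} e
  ... | p , q = cong₂ _,_ (dec-true⁻ (≡-dec _≟ᵇ_ s t) p) (dec-true⁻ (≡-dec _≟ᵇ_ ℓ κ) q)

  ∑-allStates : ∀ S (g : State → ℚ) → ∑ allStates (λ T → δ (eqState S T) (g T)) ≡ g S
  ∑-allStates (s , ℓ) g = begin
    ∑ allStates (λ T → δ (eqState (s , ℓ) T) (g T))
      ≡⟨ ∑-concatMap (λ t → map (t ,_) (allVecs n)) (allVecs m) _ ⟩
    ∑ (allVecs m) (λ t → ∑ (map (t ,_) (allVecs n)) (λ T → δ (eqState (s , ℓ) T) (g T)))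
      ≡⟨ ∑-cong (allVecs m) (λ t → trans (∑-map (t ,_) (allVecs n) _) (inner t)) ⟩
    ∑ (allVecs m) (λ t → δ ⌊ ≡-dec _≟ᵇ_ s t ⌋ (g (t , ℓ)))
      ≡⟨ ∑-allVecs m s (λ t → g (t , ℓ)) ⟩
    g (s , ℓ) ∎
    where
    open ≡-Reasoning
    inner : ∀ t → ∑ (allVecs n) (λ κ → δ (eqState (s , ℓ) (t , κ)) (g (t , κ))) ≡ δ ⌊ ≡-dec _≟ᵇ_ s t ⌋ (g (t , ℓ))
    inner t with ≡-dec _≟ᵇ_ s t
    ... | yes _ = ∑-allVecs n ℓ (λ κ → g (t , κ))
    ... | no  _ = ∑-zero (allVecs n) (λ _ → refl)

  pairing : List (ℚ × State) → (State → ℚ) → ℚ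
  pairing []             h = 0ℚ
  pairing ((c , S) ∷ xs) h = c * h S + pairing xs h

  -- The transpose of  extend A,  acting on functionals.
  ⟦_⟧ : Img → (State → ℚ) → State → ℚ
  ⟦ A ⟧ h S = pairing (A S) h

  indicator : State → State → ℚ
  indicator T S = δ (eqState S T) 1ℚ

  pairing-cong : ∀ xs {g h : State → ℚ} → (∀ S → g S ≡ h S) → pairing xs g ≡ pairing xs h
  pairing-cong []             e = refl
  pairing-cong ((c , S) ∷ xs) e = cong₂ _+_ (cong (c *_) (e S)) (pairing-cong xs e)

  pairing-++ : ∀ xs ys h → pairing (xs ++ ys) h ≡ pairing xs h + pairing ys h
  pairing-++ []             ys h = sym (ℚ.+-identityˡ _)
  pairing-++ ((c , S) ∷ xs) ys h = trans (cong (c * h S +_) (pairing-++ xs ys h)) (sym (ℚ.+-assoc (c * h S) _ _))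

  coeffIn-pairing : ∀ xs T → coeffIn xs T ≡ pairing xs (indicator T)
  coeffIn-pairing []             T = refl
  coeffIn-pairing ((c , S) ∷ xs) T = cong₂ _+_ (head (eqState S T)) (coeffIn-pairing xs T)
    where
    head : ∀ b → δ b c ≡ c * δ b 1ℚ
    head true  = sym (ℚ.*-identityʳ c)
    head false = sym (ℚ.*-zeroʳ c)

  pairing-coeffIn : ∀ xs h → ∑ allStates (λ S → coeffIn xs S * h S) ≡ pairing xs h
  pairing-coeffIn []             h = ∑-zero allStates (λ S → ℚ.*-zeroˡ (h S))
  pairing-coeffIn ((c , S) ∷ xs) h = begin
    ∑ allStates (λ T → (δ (eqState S T) c + coeffIn xs T) * h T)
      ≡⟨ ∑-cong allStates (λ T → trans (ℚ.*-distribʳ-+ (h T) (δ (eqState S T) c) (coeffIn xs T)) (cong (_+ _) (δ-* (eqState S T) (h T)))) ⟩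
    ∑ allStates (λ T → δ (eqState S T) (c * h T) + coeffIn xs T * h T)
      ≡⟨ ∑-+ allStates _ _ ⟩
    ∑ allStates (λ T → δ (eqState S T) (c * h T)) + ∑ allStates (λ T → coeffIn xs T * h T)
      ≡⟨ cong₂ _+_ (∑-allStates S (λ T → c * h T)) (pairing-coeffIn xs h) ⟩
    c * h S + pairing xs h ∎
    where
    open ≡-Reasoning
    δ-* : ∀ b x → δ b c * x ≡ δ b (c * x)
    δ-* true  x = refl
    δ-* false x = ℚ.*-zeroˡ x

  extend-⟦⟧ : ∀ A f T → extend A f T ≡ ∑ allStates (λ S → f S * ⟦ A ⟧ (indicator T) S)
  extend-⟦⟧ A f T = ∑-cong allStates (λ S → cong (f S *_) (coeffIn-pairing (A S) T))

  scale : ℚ → List (ℚ × State) → List (ℚ × State)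
  scale c = map (λ x → c * proj₁ x , proj₂ x)

  pairing-scale : ∀ c xs h → pairing (scale c xs) h ≡ c * pairing xs h
  pairing-scale c []             h = sym (ℚ.*-zeroʳ c)
  pairing-scale c ((b , S) ∷ xs) h = trans (cong₂ _+_ (ℚ.*-assoc c b (h S)) (pairing-scale c xs h))
    (sym (ℚ.*-distribˡ-+ c (b * h S) (pairing xs h)))

  infixr 9 _⨟_
  _⨟_ : Img → Img → Img
  (B ⨟ A) S = concatMap (λ x → scale (proj₁ x) (A (proj₂ x))) (B S)

  negᵢ : Img → Img
  negᵢ A S = scale (- 1ℚ) (A S)

  zeroᵢ : Img
  zeroᵢ S = []

  idᵢ : Img
  idᵢ S = (1ℚ , S) ∷ []

  ⟦⟧-⨟ : ∀ B A h S → ⟦ B ⨟ A ⟧ h S ≡ ⟦ B ⟧ (⟦ A ⟧ h) S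
  ⟦⟧-⨟ B A h S = go (B S)
    where
    go : ∀ xs → pairing (concatMap (λ x → scale (proj₁ x) (A (proj₂ x))) xs) h ≡ pairing xs (⟦ A ⟧ h)
    go []             = refl
    go ((c , T) ∷ xs) = trans (pairing-++ (scale c (A T)) _ h) (cong₂ _+_ (pairing-scale c (A T) h) (go xs))

  ⟦⟧-neg : ∀ A h S → ⟦ negᵢ A ⟧ h S ≡ - ⟦ A ⟧ h S
  ⟦⟧-neg A h S = trans (pairing-scale (- 1ℚ) (A S) h) (solve 1 (λ x → con (- 1ℚ) :* x := :- x) refl (⟦ A ⟧ h S))

  ⟦⟧-id : ∀ h S → ⟦ idᵢ ⟧ h S ≡ h S
  ⟦⟧-id h S = trans (ℚ.+-identityʳ _) (ℚ.*-identityˡ (h S))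

  neg : Cochain → Cochain
  neg f S = - f S

  ≐-refl : ∀ {f} → f ≐ f
  ≐-refl S = refl

  ≐-sym : ∀ {f g} → f ≐ g → g ≐ f
  ≐-sym e S = sym (e S)

  infixr 4 _⟫_
  _⟫_ : ∀ {f g h} → f ≐ g → g ≐ h → f ≐ h
  (e ⟫ e') S = trans (e S) (e' S)

  ⊖-zero⇒≐ : ∀ {f g} → (f ⊖ g) ≐ zeroC → f ≐ g
  ⊖-zero⇒≐ {f} {g} e S = trans (solve 2 (λ a b → a := (a :- b) :+ b) refl (f S) (g S))
    (trans (cong (_+ g S) (e S)) (ℚ.+-identityˡ _))

  ⊖-self : ∀ {f g} → f ≐ g → (f ⊖ g) ≐ zeroC
  ⊖-self {f} {g} e S = trans (cong (_- g S) (e S)) (ℚ.+-inverseʳ (g S))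

  module _ (A : Img) where
    extend-cong : ∀ {f g} → f ≐ g → extend A f ≐ extend A g
    extend-cong e T = ∑-cong allStates (λ S → cong (_* coeffIn (A S) T) (e S))

    extend-⊕ : ∀ f g → extend A (f ⊕ g) ≐ (extend A f ⊕ extend A g)
    extend-⊕ f g T = trans (∑-cong allStates (λ S → ℚ.*-distribʳ-+ (coeffIn (A S) T) (f S) (g S))) (∑-+ allStates _ _)

    extend-⊙ : ∀ c f → extend A (c ⊙ f) ≐ (c ⊙ extend A f)
    extend-⊙ c f T = trans (∑-cong allStates (λ S → ℚ.*-assoc c (f S) (coeffIn (A S) T))) (∑-*ˡ allStates c _)

    extend-neg : ∀ f → extend A (neg f) ≐ neg (extend A f)
    extend-neg f = extend-cong (λ S → sym (-1* (f S))) ⟫ extend-⊙ (- 1ℚ) f ⟫ (λ S → -1* _)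
      where
      -1* : ∀ x → - 1ℚ * x ≡ - x
      -1* x = solve 1 (λ x → con (- 1ℚ) :* x := :- x) refl x

    extend-⊖ : ∀ f g → extend A (f ⊖ g) ≐ (extend A f ⊖ extend A g)
    extend-⊖ f g T = trans (extend-⊕ f (neg g) T) (cong (extend A f T +_) (extend-neg g T))

    extend-zero : ∀ {f} → f ≐ zeroC → extend A f ≐ zeroC
    extend-zero e T = ∑-zero allStates (λ S → trans (cong (_* coeffIn (A S) T) (e S)) (ℚ.*-zeroˡ (coeffIn (A S) T)))

  -- Matrix multiplication: the two sums over states are exchanged. The order is reversed because
  -- `⨟` composes from left to right.
  extend-⨟ : ∀ A B f → extend A (extend B f) ≐ extend (B ⨟ A) f
  extend-⨟ A B f T = begin
    ∑ allStates (λ S' → ∑ allStates (λ S → f S * coeffIn (B S) S') * coeffIn (A S') T)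
      ≡⟨ ∑-cong allStates (λ S' → sym (∑-*ʳ allStates (coeffIn (A S') T) _)) ⟩
    ∑ allStates (λ S' → ∑ allStates (λ S → (f S * coeffIn (B S) S') * coeffIn (A S') T))
      ≡⟨ ∑-swap allStates allStates _ ⟩
    ∑ allStates (λ S → ∑ allStates (λ S' → (f S * coeffIn (B S) S') * coeffIn (A S') T))
      ≡⟨ ∑-cong allStates (λ S → trans (∑-cong allStates (λ S' → ℚ.*-assoc (f S) _ _)) (∑-*ˡ allStates (f S) _)) ⟩
    ∑ allStates (λ S → f S * ∑ allStates (λ S' → coeffIn (B S) S' * coeffIn (A S') T))
      ≡⟨ ∑-cong allStates (λ S → cong (f S *_) (inner S)) ⟩
    ∑ allStates (λ S → f S * ⟦ B ⨟ A ⟧ (indicator T) S)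
      ≡⟨ extend-⟦⟧ (B ⨟ A) f T ⟨
    extend (B ⨟ A) f T ∎
    where
    open ≡-Reasoning
    inner : ∀ S → ∑ allStates (λ S' → coeffIn (B S) S' * coeffIn (A S') T) ≡ ⟦ B ⨟ A ⟧ (indicator T) S
    inner S = trans (pairing-coeffIn (B S) (λ S' → coeffIn (A S') T))
      (trans (pairing-cong (B S) (λ S' → coeffIn-pairing (A S') T)) (sym (⟦⟧-⨟ B A (indicator T) S)))

  -- Supports

  -- A disjunction at each state, so that `P` need not be decidable. `InC`, `InCtot` and `InCle` are
  -- instances by unfolding, which lets all support lemmas apply to them directly.
  Supp : (State → Set) → Cochain → Set
  Supp P f = ∀ S → f S ≡ 0ℚ ⊎ P S

  module _ {P : State → Set} where
    Supp-resp : ∀ {f g} → f ≐ g → Supp P f → Supp P g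
    Supp-resp e p S with p S
    ... | inj₁ z = inj₁ (trans (sym (e S)) z)
    ... | inj₂ q = inj₂ q

    Supp-zero : Supp P zeroC
    Supp-zero S = inj₁ refl

    Supp-⊕ : ∀ {f g} → Supp P f → Supp P g → Supp P (f ⊕ g)
    Supp-⊕ p q S with p S | q S
    ... | inj₁ x | inj₁ y = inj₁ (cong₂ _+_ x y)
    ... | inj₁ _ | inj₂ y = inj₂ y
    ... | inj₂ x | _      = inj₂ x

    Supp-neg : ∀ {f} → Supp P f → Supp P (neg f)
    Supp-neg p S with p S
    ... | inj₁ x = inj₁ (cong -_ x)
    ... | inj₂ x = inj₂ x

    Supp-⊖ : ∀ {f g} → Supp P f → Supp P g → Supp P (f ⊖ g)
    Supp-⊖ p q = Supp-⊕ p (Supp-neg q)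

    Supp-⊙ : ∀ {f} c → Supp P f → Supp P (c ⊙ f)
    Supp-⊙ c p S with p S
    ... | inj₁ x = inj₁ (trans (cong (c *_) x) (ℚ.*-zeroʳ c))
    ... | inj₂ x = inj₂ x

  Supp-mono : ∀ {P R : State → Set} {f} → (∀ {S} → P S → R S) → Supp P f → Supp R f
  Supp-mono i p S with p S
  ... | inj₁ x = inj₁ x
  ... | inj₂ x = inj₂ (i x)

  Supp-∩ : ∀ {P R : State → Set} {f} → Supp P f → Supp R f → Supp (λ S → P S × R S) f
  Supp-∩ p r S with p S | r S
  ... | inj₁ x | _      = inj₁ x
  ... | inj₂ _ | inj₁ x = inj₁ x
  ... | inj₂ x | inj₂ y = inj₂ (x , y)

  Supp-∅ : ∀ {P : State → Set} {f} → (∀ {S} → ¬ P S) → Supp P f → f ≐ zeroC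
  Supp-∅ ¬P p S with p S
  ... | inj₁ x = x
  ... | inj₂ x = ⊥-elim (¬P x)

  -- The value at `T` is a finite sum. Either some summand exhibits `T` as a term of the image of a
  -- state in the support, which gives `R T`, or every summand is zero.
  Supp-extend : ∀ {P R : State → Set} A {f} → (∀ {S} → P S → All (R ∘ proj₂) (A S)) →
                Supp P f → Supp R (extend A f)
  Supp-extend {P} {R} A {f} h p T = go allStates
    where
    coeff : ∀ xs → All (R ∘ proj₂) xs → coeffIn xs T ≡ 0ℚ ⊎ R T
    coeff []             []       = inj₁ refl
    coeff ((c , S) ∷ xs) (r ∷ rs) with eqState S T in eq | coeff xs rs
    ... | _     | inj₂ y = inj₂ y
    ... | true  | inj₁ _ = inj₂ (subst R (eqState⁻ S T eq) r)
    ... | false | inj₁ y = inj₁ (trans (ℚ.+-identityˡ _) y)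
    term : ∀ S → f S * coeffIn (A S) T ≡ 0ℚ ⊎ R T
    term S with p S
    ... | inj₁ z = inj₁ (trans (cong (_* coeffIn (A S) T) z) (ℚ.*-zeroˡ (coeffIn (A S) T)))
    ... | inj₂ q with coeff (A S) (h q)
    ... | inj₁ z = inj₁ (trans (cong (f S *_) z) (ℚ.*-zeroʳ (f S)))
    ... | inj₂ r = inj₂ r
    go : ∀ xs → ∑ xs (λ S → f S * coeffIn (A S) T) ≡ 0ℚ ⊎ R T
    go []       = inj₁ refl
    go (S ∷ xs) with term S | go xs
    ... | inj₂ r | _      = inj₂ r
    ... | inj₁ _ | inj₂ r = inj₂ r
    ... | inj₁ x | inj₁ y = inj₁ (cong₂ _+_ x y)

  -- Used to split a cocycle equation into its part on states containing an edge and its part on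
  -- states avoiding it.
  Supp-disjoint : ∀ {P R : State → Set} {f g} → (∀ {S} → P S → ¬ R S) →
                  Supp P f → Supp R g → (f ⊕ g) ≐ zeroC → f ≐ zeroC × g ≐ zeroC
  Supp-disjoint {f = f} {g} ¬PR p r e = (λ S → proj₁ (go S)) , (λ S → proj₂ (go S))
    where
    go : ∀ S → f S ≡ 0ℚ × g S ≡ 0ℚ
    go S with p S | r S
    ... | inj₁ x | _      = x , trans (sym (ℚ.+-identityˡ (g S))) (trans (cong (_+ g S) (sym x)) (e S))
    ... | inj₂ _ | inj₁ y = trans (sym (ℚ.+-identityʳ (f S))) (trans (cong (f S +_) (sym y)) (e S)) , y
    ... | inj₂ x | inj₂ y = ⊥-elim (¬PR x y)

  -- Identities between operators are checked on the basis states of the support.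
  module _ {P : State → Set} where
    extend-≐ : ∀ A B {f} → (∀ {S} → P S → ∀ h → ⟦ A ⟧ h S ≡ ⟦ B ⟧ h S) →
               Supp P f → extend A f ≐ extend B f
    extend-≐ A B {f} e p T = trans (extend-⟦⟧ A f T) (trans (∑-cong allStates go) (sym (extend-⟦⟧ B f T)))
      where
      go : ∀ S → f S * ⟦ A ⟧ (indicator T) S ≡ f S * ⟦ B ⟧ (indicator T) S
      go S with p S
      ... | inj₁ z = trans (cong (_* ⟦ A ⟧ (indicator T) S) z)
                      (trans (ℚ.*-zeroˡ (⟦ A ⟧ (indicator T) S)) (sym (trans (cong (_* ⟦ B ⟧ (indicator T) S) z) (ℚ.*-zeroˡ (⟦ B ⟧ (indicator T) S)))))
      ... | inj₂ q = cong (f S *_) (e q (indicator T))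

    extend-≐id : ∀ A {f} → (∀ {S} → P S → ∀ h → ⟦ A ⟧ h S ≡ h S) → Supp P f → extend A f ≐ f
    extend-≐id A {f} e p = extend-≐ A idᵢ (λ q h → trans (e q h) (sym (⟦⟧-id h _))) p ⟫ ident
      where
      ident : extend idᵢ f ≐ f
      ident T = trans (∑-cong allStates (λ S → trans (cong (f S *_) (ℚ.+-identityʳ _)) (comm S))) (∑-allStates T f)
        where
        eq-sym : ∀ S → eqState S T ≡ eqState T S
        eq-sym S = ≡true-ext (flip S T) (flip T S)
          where
          flip : ∀ S T → eqState S T ≡ true → eqState T S ≡ true
          flip S T x = subst (λ U → eqState T U ≡ true) (sym (eqState⁻ S T x))
            (∧-true⁺ (dec-true⁺ (≡-dec _≟ᵇ_ (proj₁ T) (proj₁ T)) refl) (dec-true⁺ (≡-dec _≟ᵇ_ (proj₂ T) (proj₂ T)) refl))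
        comm : ∀ S → f S * δ (eqState S T) 1ℚ ≡ δ (eqState T S) (f S)
        comm S rewrite eq-sym S with eqState T S
        ... | true  = ℚ.*-identityʳ (f S)
        ... | false = ℚ.*-zeroʳ (f S)

    extend-≐0 : ∀ A {f} → (∀ {S} → P S → ∀ h → ⟦ A ⟧ h S ≡ 0ℚ) → Supp P f → extend A f ≐ zeroC
    extend-≐0 A {f} e p = extend-≐ A zeroᵢ e p ⟫ (λ T → ∑-zero allStates (λ S → ℚ.*-zeroʳ (f S)))

    -- The hypothesis has `A` and `B` in the opposite order because `⟦_⟧` is a transpose.
    commute : ∀ A B A' B' {f} → (∀ {S} → P S → ∀ h → ⟦ B ⟧ (⟦ A ⟧ h) S ≡ ⟦ B' ⟧ (⟦ A' ⟧ h) S) →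
              Supp P f → extend A (extend B f) ≐ extend A' (extend B' f)
    commute A B A' B' {f} e p T = trans (extend-⨟ A B f T) (trans
      (extend-≐ (B ⨟ A) (B' ⨟ A') (λ q h → trans (⟦⟧-⨟ B A h _) (trans (e q h) (sym (⟦⟧-⨟ B' A' h _)))) p T)
      (sym (extend-⨟ A' B' f T)))

    anticommute : ∀ A B A' B' {f} → (∀ {S} → P S → ∀ h → ⟦ B ⟧ (⟦ A ⟧ h) S ≡ - ⟦ B' ⟧ (⟦ A' ⟧ h) S) →
                  Supp P f → extend A (extend B f) ≐ neg (extend A' (extend B' f))
    anticommute A B A' B' {f} e p T = trans (extend-⨟ A B f T) (trans
      (extend-≐ (B ⨟ A) (negᵢ (B' ⨟ A')) opposite p T)
      (trans negate (cong -_ (sym (extend-⨟ A' B' f T)))))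
      where
      opposite : ∀ {S} → P S → ∀ h → ⟦ B ⨟ A ⟧ h S ≡ ⟦ negᵢ (B' ⨟ A') ⟧ h S
      opposite {S} q h = trans (⟦⟧-⨟ B A h S) (trans (e q h)
        (trans (cong -_ (sym (⟦⟧-⨟ B' A' h S))) (sym (⟦⟧-neg (B' ⨟ A') h S))))
      negate : extend (negᵢ (B' ⨟ A')) f T ≡ - extend (B' ⨟ A') f T
      negate = trans (extend-⟦⟧ (negᵢ (B' ⨟ A')) f T)
        (trans (∑-cong allStates (λ S → trans (cong (f S *_) (⟦⟧-neg (B' ⨟ A') (indicator T) S))
          (solve 2 (λ a b → a :* (:- b) := con (- 1ℚ) :* (a :* b)) refl (f S) (⟦ B' ⨟ A' ⟧ (indicator T) S))))
        (trans (∑-*ˡ allStates (- 1ℚ) (λ S → f S * ⟦ B' ⨟ A' ⟧ (indicator T) S))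
        (trans (solve 1 (λ x → con (- 1ℚ) :* x := :- x) refl _) (cong -_ (sym (extend-⟦⟧ (B' ⨟ A') f T))))))

  cut : (State → Bool) → Cochain → Cochain
  cut p f S = δ (p S) (f S)

  Supp-cut : ∀ {P} p {f} → Supp P f → Supp (λ S → P S × p S ≡ true) (cut p f)
  Supp-cut p {f} h S with p S | h S
  ... | true  | inj₁ x = inj₁ x
  ... | true  | inj₂ x = inj₂ (x , refl)
  ... | false | _      = inj₁ refl

  cut-split : ∀ p f → f ≐ (cut p f ⊕ cut (not ∘ p) f)
  cut-split p f S with p S
  ... | true  = sym (ℚ.+-identityʳ _)
  ... | false = sym (ℚ.+-identityˡ _)

  cut-cong : ∀ p {f g} → f ≐ g → cut p f ≐ cut p g
  cut-cong p e S = cong (δ (p S)) (e S)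

  cut-⊕ : ∀ p f g → cut p (f ⊕ g) ≐ (cut p f ⊕ cut p g)
  cut-⊕ p f g S with p S
  ... | true  = refl
  ... | false = refl

  cut-⊖ : ∀ p f g → cut p (f ⊖ g) ≐ (cut p f ⊖ cut p g)
  cut-⊖ p f g S with p S
  ... | true  = refl
  ... | false = refl

  cut-⊙ : ∀ p c f → cut p (c ⊙ f) ≐ (c ⊙ cut p f)
  cut-⊙ p c f S with p S
  ... | true  = refl
  ... | false = sym (ℚ.*-zeroʳ c)

  cut-id : ∀ {P} p {f} → (∀ {S} → P S → p S ≡ true) → Supp P f → cut p f ≐ f
  cut-id p {f} i h S with h S
  ... | inj₂ q rewrite i q = refl
  ... | inj₁ z = trans (cong (δ (p S)) z) (trans (δ-zero (p S)) (sym z))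

  cut-zero : ∀ {P} p {f} → (∀ {S} → P S → p S ≡ false) → Supp P f → cut p f ≐ zeroC
  cut-zero p {f} i h S with h S
  ... | inj₂ q rewrite i q = refl
  ... | inj₁ z = trans (cong (δ (p S)) z) (δ-zero (p S))

-- Connected components, their representatives, and the effect of adding an edge

module Components (Γ : Graph) where
  open Graph Γ
  open Chromatic Γ

  src tgt : Fin m → Fin n
  src e = proj₁ (ends e)
  tgt e = proj₂ (ends e)

  _∋_ : StateE → Fin m → Set
  s ∋ e = lookup s e ≡ true

  _∌_ : StateE → Fin m → Set
  s ∌ e = lookup s e ≡ false

  _⊆_ : StateE → StateE → Set
  s ⊆ t = ∀ e → s ∋ e → t ∋ e

  -- The edges come from a predicate, so that one notion of path serves both for a state and for the
  -- union of a state with a list of free edges.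
  data Path (E : Fin m → Set) (u : Fin n) : Fin n → Set where
    stop : Path E u u
    fwd  : ∀ e → E e → Path E u (src e) → Path E u (tgt e)
    bwd  : ∀ e → E e → Path E u (tgt e) → Path E u (src e)

  module _ {E : Fin m → Set} where
    Path-trans : ∀ {u v w} → Path E u v → Path E v w → Path E u w
    Path-trans p stop        = p
    Path-trans p (fwd e i q) = fwd e i (Path-trans p q)
    Path-trans p (bwd e i q) = bwd e i (Path-trans p q)

    Path-sym : ∀ {u v} → Path E u v → Path E v u
    Path-sym stop        = stop
    Path-sym (fwd e i q) = Path-trans (bwd e i stop) (Path-sym q)
    Path-sym (bwd e i q) = Path-trans (fwd e i stop) (Path-sym q)

  Path-mono : ∀ {E E' : Fin m → Set} → (∀ {e} → E e → E' e) → ∀ {u v} → Path E u v → Path E' u v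
  Path-mono i stop        = stop
  Path-mono i (fwd e x q) = fwd e (i x) (Path-mono i q)
  Path-mono i (bwd e x q) = bwd e (i x) (Path-mono i q)

  -- conn decides the existence of a path: the sets reach k s u grow strictly
  -- with k until they stabilise, which happens for some k ≤ n.
  module _ (s : StateE) (u : Fin n) where
    data Step (k : ℕ) (v : Fin n) : Set where
      stay : reach k s u v ≡ true → Step k v
      fwd  : ∀ e → s ∋ e → reach k s u (src e) ≡ true → tgt e ≡ v → Step k v
      bwd  : ∀ e → s ∋ e → reach k s u (tgt e) ≡ true → src e ≡ v → Step k v

    reach-suc⁻ : ∀ k v → reach (suc k) s u v ≡ true → Step k v
    reach-suc⁻ k v h with ∨-true⁻ {reach k s u v} h
    ... | inj₁ x = stay x
    ... | inj₂ x with anyL⁻ _ (allFin m) x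
    ... | e , y with ∧-true⁻ {lookup s e} y
    ... | i , z with ∨-true⁻ {reach k s u (src e) ∧ ⌊ tgt e ≟ᶠ v ⌋} z
    ... | inj₁ w = let a , b = ∧-true⁻ w in fwd e i a (dec-true⁻ (tgt e ≟ᶠ v) b)
    ... | inj₂ w = let a , b = ∧-true⁻ w in bwd e i a (dec-true⁻ (src e ≟ᶠ v) b)

    reach-suc⁺ : ∀ k v → Step k v → reach (suc k) s u v ≡ true
    reach-suc⁺ k v (stay h)          = ∨-trueˡ h
    reach-suc⁺ k v (fwd e i h refl) = ∨-trueʳ {reach k s u v} (anyL⁺ _ (∈-allFin e)
      (∧-true⁺ i (∨-trueˡ (∧-true⁺ h (dec-true⁺ (tgt e ≟ᶠ tgt e) refl)))))
    reach-suc⁺ k v (bwd e i h refl) = ∨-trueʳ {reach k s u v} (anyL⁺ _ (∈-allFin e)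
      (∧-true⁺ i (∨-trueʳ {reach k s u (src e) ∧ ⌊ tgt e ≟ᶠ src e ⌋} (∧-true⁺ h (dec-true⁺ (src e ≟ᶠ src e) refl)))))

    reach-sound : ∀ k v → reach k s u v ≡ true → Path (s ∋_) u v
    reach-sound zero    v h = subst (Path (s ∋_) u) (dec-true⁻ (u ≟ᶠ v) h) stop
    reach-sound (suc k) v h with reach-suc⁻ k v h
    ... | stay x          = reach-sound k v x
    ... | fwd e i x refl = fwd e i (reach-sound k (src e) x)
    ... | bwd e i x refl = bwd e i (reach-sound k (tgt e) x)

    reach-refl : ∀ k → reach k s u u ≡ true
    reach-refl zero    = dec-true⁺ (u ≟ᶠ u) refl
    reach-refl (suc k) = ∨-trueˡ (reach-refl k)

    Stable : ℕ → Set
    Stable k = ∀ v → reach (suc k) s u v ≡ true → reach k s u v ≡ true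

    Stable-suc : ∀ k → Stable k → Stable (suc k)
    Stable-suc k st v h with reach-suc⁻ (suc k) v h
    ... | stay x         = x
    ... | fwd e i x eq = reach-suc⁺ k v (fwd e i (st (src e) x) eq)
    ... | bwd e i x eq = reach-suc⁺ k v (bwd e i (st (tgt e) x) eq)

    stable-or-large : ∀ k → Stable k ⊎ k ℕ.< count (reach k s u)
    stable-or-large zero = inj₂ (ℕ.≤-trans (s≤s z≤n)
      (count-strict {p = λ _ → false} (λ _ ()) u refl (reach-refl zero)))
    stable-or-large (suc k) with stable-or-large k
    ... | inj₁ st = inj₁ (Stable-suc k st)
    ... | inj₂ lt with any? (λ v → (reach (suc k) s u v ∧ not (reach k s u v)) ≟ᵇ true)
    ... | yes (v , h) = let a , b = ∧-true⁻ h in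
          inj₂ (ℕ.≤-trans (s≤s lt) (count-strict {p = reach k s u} {reach (suc k) s u} (λ _ → ∨-trueˡ) v (not-true (reach k s u v) b) a))
      where
      not-true : ∀ b → not b ≡ true → b ≡ false
      not-true false _ = refl
    ... | no none = inj₁ (Stable-suc k (λ v h → stable v h (bool-cases (reach k s u v))))
      where
      stable : ∀ v → reach (suc k) s u v ≡ true → reach k s u v ≡ true ⊎ reach k s u v ≡ false → reach k s u v ≡ true
      stable v h (inj₁ x) = x
      stable v h (inj₂ x) = ⊥-elim (none (v , ∧-true⁺ h (cong not x)))

    conn-complete : ∀ {v} → Path (s ∋_) u v → conn s u v ≡ true
    conn-complete p with stable-or-large n
    ... | inj₂ lt = ⊥-elim (ℕ.<⇒≱ lt (count-≤ (reach n s u)))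
    ... | inj₁ st = go p
      where
      go : ∀ {v} → Path (s ∋_) u v → conn s u v ≡ true
      go stop        = reach-refl n
      go (fwd e i q) = st (tgt e) (reach-suc⁺ n (tgt e) (fwd e i (go q) refl))
      go (bwd e i q) = st (src e) (reach-suc⁺ n (src e) (bwd e i (go q) refl))

  Conn : StateE → Fin n → Fin n → Set
  Conn s u v = conn s u v ≡ true

  conn-sound : ∀ s {u v} → Conn s u v → Path (s ∋_) u v
  conn-sound s {u} {v} = reach-sound s u n v

  module _ {s : StateE} where
    conn-refl : ∀ {u} → Conn s u u
    conn-refl {u} = conn-complete s u stop

    conn-sym : ∀ {u v} → Conn s u v → Conn s v u
    conn-sym {u} {v} h = conn-complete s v (Path-sym (conn-sound s h))

    conn-trans : ∀ {u v w} → Conn s u v → Conn s v w → Conn s u w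
    conn-trans {u} h k = conn-complete s u (Path-trans (conn-sound s h) (conn-sound s k))

    conn-edge : ∀ {e} → s ∋ e → Conn s (src e) (tgt e)
    conn-edge {e} i = conn-complete s (src e) (fwd e i stop)

    conn-congʳ : ∀ {u v w} → Conn s v w → conn s u v ≡ conn s u w
    conn-congʳ h = ≡true-ext (λ x → conn-trans x h) (λ x → conn-trans x (conn-sym h))

  conn-mono : ∀ {s t} → s ⊆ t → ∀ {u v} → Conn s u v → Conn t u v
  conn-mono {s} {t} i {u} h = conn-complete t u (Path-mono (λ {e} → i e) (conn-sound s h))

  add remove : StateE → Fin m → StateE
  add    s e = s [ e ]≔ true
  remove s e = s [ e ]≔ false

  add-∋ : ∀ s e → add s e ∋ e
  add-∋ s e = lookup-≔ s e

  add-other : ∀ s {e f} → f ≢ e → lookup (add s e) f ≡ lookup s f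
  add-other s = lookup-≔′ s

  remove-∌ : ∀ s e → remove s e ∌ e
  remove-∌ s e = lookup-≔ s e

  remove-other : ∀ s {e f} → f ≢ e → lookup (remove s e) f ≡ lookup s f
  remove-other s = lookup-≔′ s

  add-⊇ : ∀ s e → s ⊆ add s e
  add-⊇ s e f i with f ≟ᶠ e
  ... | yes refl = add-∋ s e
  ... | no ne    = trans (add-other s ne) i

  add⁻ : ∀ s e f → add s e ∋ f → s ∋ f ⊎ f ≡ e
  add⁻ s e f i with f ≟ᶠ e
  ... | yes x = inj₂ x
  ... | no ne = inj₁ (trans (sym (add-other s ne)) i)

  add-comm : ∀ s e f → add (add s e) f ≡ add (add s f) e
  add-comm s e f with e ≟ᶠ f
  ... | yes refl = refl
  ... | no ne    = []≔-commutes s e f ne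

  add-remove : ∀ s e → s ∋ e → add (remove s e) e ≡ s
  add-remove s e i = trans ([]≔-idempotent s e) (≔-same s e i)

  remove-add : ∀ s e → s ∌ e → remove (add s e) e ≡ s
  remove-add s e i = trans ([]≔-idempotent s e) (≔-same s e i)

  -- Crossing `e` and then crossing it back returns to the component of the start, so one crossing
  -- in one direction is always enough.
  conn-add⁻ : ∀ s e {u v} → Conn (add s e) u v →
              Conn s u v ⊎ (Conn s u (src e) × Conn s (tgt e) v) ⊎ (Conn s u (tgt e) × Conn s (src e) v)
  conn-add⁻ s e {u} h = go (conn-sound (add s e) h)
    where
    R : Fin n → Set
    R v = Conn s u v ⊎ (Conn s u (src e) × Conn s (tgt e) v) ⊎ (Conn s u (tgt e) × Conn s (src e) v)
    step : ∀ {v w} → Conn s v w → R v → R w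
    step c (inj₁ x)              = inj₁ (conn-trans x c)
    step c (inj₂ (inj₁ (x , y))) = inj₂ (inj₁ (x , conn-trans y c))
    step c (inj₂ (inj₂ (x , y))) = inj₂ (inj₂ (x , conn-trans y c))
    go : ∀ {v} → Path (add s e ∋_) u v → R v
    go stop = inj₁ conn-refl
    go (fwd f i p) with add⁻ s e f i | go p
    ... | inj₁ j    | r                    = step (conn-edge j) r
    ... | inj₂ refl | inj₁ x               = inj₂ (inj₁ (x , conn-refl))
    ... | inj₂ refl | inj₂ (inj₁ (x , _))  = inj₂ (inj₁ (x , conn-refl))
    ... | inj₂ refl | inj₂ (inj₂ (x , _))  = inj₁ x
    go (bwd f i p) with add⁻ s e f i | go p
    ... | inj₁ j    | r                    = step (conn-sym (conn-edge j)) r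
    ... | inj₂ refl | inj₁ x               = inj₂ (inj₂ (x , conn-refl))
    ... | inj₂ refl | inj₂ (inj₁ (x , _))  = inj₁ x
    ... | inj₂ refl | inj₂ (inj₂ (x , _))  = inj₂ (inj₂ (x , conn-refl))

  conn-loop : ∀ s e → Conn s (src e) (tgt e) → ∀ {u v} → Conn (add s e) u v → Conn s u v
  conn-loop s e loop c with conn-add⁻ s e c
  ... | inj₁ x              = x
  ... | inj₂ (inj₁ (x , y)) = conn-trans x (conn-trans loop y)
  ... | inj₂ (inj₂ (x , y)) = conn-trans x (conn-trans (conn-sym loop) y)

  -- Representatives

  isRep⁻ : ∀ {s v w} → isRep s v ≡ true → Conn s v w → toℕ v ℕ.≤ toℕ w
  isRep⁻ {s} {v} {w} h c with toℕ w ℕ.<? toℕ v | allL⁻ (λ w → not (⌊ toℕ w ℕ.<? toℕ v ⌋ ∧ conn s v w)) (∈-allFin w) h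
  ... | no ¬lt | _ = ℕ.≮⇒≥ ¬lt
  ... | yes _  | x rewrite c = ⊥-elim (true≢false (sym x))

  isRep⁺ : ∀ {s v} → (∀ w → Conn s v w → toℕ v ℕ.≤ toℕ w) → isRep s v ≡ true
  isRep⁺ {s} {v} h = allL⁺ _ (allFin n) go
    where
    go : ∀ w → not (⌊ toℕ w ℕ.<? toℕ v ⌋ ∧ conn s v w) ≡ true
    go w with toℕ w ℕ.<? toℕ v | conn s v w in eq
    ... | no _   | _     = refl
    ... | yes _  | false = refl
    ... | yes lt | true  = ⊥-elim (ℕ.<⇒≱ lt (h w eq))

  firstConn : StateE → Fin n → List (Fin n) → Fin n
  firstConn s v []       = v
  firstConn s v (w ∷ ws) = if conn s v w then w else firstConn s v ws

  -- The search in the definition of rep is a local function without a name; it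
  -- is recovered here by unification.
  mutual
    repSearch : StateE → Fin n → List (Fin n) → Fin n
    repSearch = _

    rep-first : ∀ s v → rep s v ≡ firstConn s v (allFin n)
    rep-first s v with allFin n
    ... | xs = same (repSearch s v) refl (λ _ _ → refl) xs
      where
      same : ∀ (g : List (Fin n) → Fin n) → g [] ≡ v →
             (∀ w ws → g (w ∷ ws) ≡ (if conn s v w then w else g ws)) → ∀ xs → g xs ≡ firstConn s v xs
      same g p q []       = p
      same g p q (x ∷ xs) rewrite q x xs | same g p q xs = refl

  -- The search meets vertices in increasing order, so its first hit is the least one. The monotone
  -- `f` replaces the identity to make the induction along `tabulate` go through.
  firstConn-spec : ∀ s v {k} (f : Fin k → Fin n) → (∀ i j → toℕ i ℕ.≤ toℕ j → toℕ (f i) ℕ.≤ toℕ (f j)) →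
                   ∀ i → Conn s v (f i) →
                   Conn s v (firstConn s v (tabulate f)) × (∀ j → Conn s v (f j) → toℕ (firstConn s v (tabulate f)) ℕ.≤ toℕ (f j))
  firstConn-spec s v {suc k} f mono i c with conn s v (f zero) in eq
  ... | true = eq , λ j _ → mono zero j z≤n
  firstConn-spec s v {suc k} f mono zero    c | false = ⊥-elim (true≢false (trans (sym c) eq))
  firstConn-spec s v {suc k} f mono (suc i) c | false
    with firstConn-spec s v (f ∘ suc) (λ i j le → mono (suc i) (suc j) (s≤s le)) i c
  ... | p , q = p , λ { zero c' → ⊥-elim (true≢false (trans (sym c') eq)) ; (suc j) c' → q j c' }

  rep-spec : ∀ s v → Conn s v (rep s v) × (∀ w → Conn s v w → toℕ (rep s v) ℕ.≤ toℕ w)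
  rep-spec s v rewrite rep-first s v = firstConn-spec s v id (λ _ _ le → le) v conn-refl

  module _ {s : StateE} where
    conn-rep : ∀ {v} → Conn s v (rep s v)
    conn-rep {v} = proj₁ (rep-spec s v)

    isRep-rep : ∀ {v} → isRep s (rep s v) ≡ true
    isRep-rep {v} = isRep⁺ (λ w c → proj₂ (rep-spec s v) w (conn-trans (conn-rep {v}) c))

    isRep-unique : ∀ {u v} → isRep s u ≡ true → isRep s v ≡ true → Conn s u v → u ≡ v
    isRep-unique ru rv c = toℕ-injective (ℕ.≤-antisym (isRep⁻ ru c) (isRep⁻ rv (conn-sym c)))

    rep-unique : ∀ {u v} → isRep s v ≡ true → Conn s u v → rep s u ≡ v
    rep-unique {u} rv c = isRep-unique isRep-rep rv (conn-trans (conn-sym (conn-rep {u})) c)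

  isRep-mono : ∀ {s t} → s ⊆ t → ∀ {v} → isRep t v ≡ true → isRep s v ≡ true
  isRep-mono i r = isRep⁺ (λ w c → isRep⁻ r (conn-mono i c))

  conn-add-rep : ∀ s e {u v} → Conn (add s e) u v →
    Conn s u v ⊎ (Conn s u (rep s (src e)) × Conn s (rep s (tgt e)) v) ⊎ (Conn s u (rep s (tgt e)) × Conn s (rep s (src e)) v)
  conn-add-rep s e c with conn-add⁻ s e c
  ... | inj₁ x              = inj₁ x
  ... | inj₂ (inj₁ (x , y)) = inj₂ (inj₁ (conn-trans x conn-rep , conn-trans (conn-sym conn-rep) y))
  ... | inj₂ (inj₂ (x , y)) = inj₂ (inj₂ (conn-trans x conn-rep , conn-trans (conn-sym conn-rep) y))

  -- The two components joined by `e`, named by their representatives in increasing order and not by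
  -- the direction of `e`: `p` goes on to represent the merged component and `q` stops being a
  -- representative. This fixes where the merged label is stored.
  record Merge (s : StateE) (e : Fin m) : Set where
    field
      p q    : Fin n
      p<q    : toℕ p ℕ.< toℕ q
      rep-p  : isRep s p ≡ true
      rep-q  : isRep s q ≡ true
      joined : Conn (add s e) p q
      split  : ∀ {u v} → Conn (add s e) u v →
               Conn s u v ⊎ (Conn s u p × Conn s q v) ⊎ (Conn s u q × Conn s p v)
      joins  : ∀ ℓ → joinsXX (s , ℓ) e ≡ lookup ℓ p ∧ lookup ℓ q

    p≢q : p ≢ q
    p≢q eq = ℕ.<-irrefl (cong toℕ eq) p<q

    ¬conn : ¬ Conn s p q
    ¬conn c = p≢q (isRep-unique rep-p rep-q c)

    private
      low : ∀ {w} → Conn (add s e) p w → toℕ p ℕ.≤ toℕ w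
      low c with split c
      ... | inj₁ x              = isRep⁻ rep-p x
      ... | inj₂ (inj₁ (_ , x)) = ℕ.≤-trans (ℕ.<⇒≤ p<q) (isRep⁻ rep-q x)
      ... | inj₂ (inj₂ (_ , x)) = isRep⁻ rep-p x

    isRep-p : isRep (add s e) p ≡ true
    isRep-p = isRep⁺ (λ _ → low)

    ¬isRep-q : isRep (add s e) q ≡ false
    ¬isRep-q = not-true⇒false (λ r → ℕ.<⇒≱ p<q (isRep⁻ r (conn-sym joined)))

    isRep-other : ∀ {v} → v ≢ q → isRep s v ≡ true → isRep (add s e) v ≡ true
    isRep-other {v} ne r = isRep⁺ go
      where
      go : ∀ w → Conn (add s e) v w → toℕ v ℕ.≤ toℕ w
      go w c with split c
      ... | inj₁ x              = isRep⁻ r x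
      ... | inj₂ (inj₁ (x , y)) rewrite isRep-unique r rep-p x = low c
      ... | inj₂ (inj₂ (x , y)) = ⊥-elim (ne (isRep-unique r rep-q x))

  merge : ∀ s e → conn s (src e) (tgt e) ≡ false → Merge s e
  merge s e apart with ℕ.<-cmp (toℕ A) (toℕ B)
    where
    A = rep s (src e)
    B = rep s (tgt e)
  ... | tri≈ _ eq _ = ⊥-elim (true≢false (trans (sym
          (conn-trans (conn-rep {v = src e}) (conn-trans (subst (Conn s (rep s (src e))) (toℕ-injective eq) conn-refl) (conn-sym (conn-rep {v = tgt e}))))) apart))
  ... | tri< lt _ _ = record
    { p = rep s (src e) ; q = rep s (tgt e) ; p<q = lt ; rep-p = isRep-rep ; rep-q = isRep-rep
    ; joined = conn-trans (conn-sym (conn-mono (add-⊇ s e) (conn-rep {v = src e})))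
        (conn-trans (conn-edge (add-∋ s e)) (conn-mono (add-⊇ s e) (conn-rep {v = tgt e})))
    ; split = conn-add-rep s e
    ; joins = λ ℓ → cong (λ b → not b ∧ xlab (s , ℓ) (src e) ∧ xlab (s , ℓ) (tgt e)) apart }
  ... | tri> _ _ gt = record
    { p = rep s (tgt e) ; q = rep s (src e) ; p<q = gt ; rep-p = isRep-rep ; rep-q = isRep-rep
    ; joined = conn-trans (conn-sym (conn-mono (add-⊇ s e) (conn-rep {v = tgt e})))
        (conn-trans (conn-sym (conn-edge (add-∋ s e))) (conn-mono (add-⊇ s e) (conn-rep {v = src e})))
    ; split = Sum.map₂ Sum.swap ∘ conn-add-rep s e
    ; joins = λ ℓ → trans (cong (λ b → not b ∧ xlab (s , ℓ) (src e) ∧ xlab (s , ℓ) (tgt e)) apart)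
        (∧-comm (xlab (s , ℓ) (src e)) (xlab (s , ℓ) (tgt e))) }

-- Labellings after adding an edge: merging, independence of the order, degrees

module Labels (Γ : Graph) where
  open Graph Γ
  open Chromatic Γ
  open Components Γ

  Labelling : Set
  Labelling = Vec Bool n

  -- newLab (s , ℓ) e  is  push (add s e) ℓ.
  push : StateE → Labelling → Labelling
  push t ℓ = Vec.tabulate λ v → isRep t v ∧ eqℕ (countL (λ w → lookup ℓ w ∧ conn t v w) (allFin n)) 1

  xCount : StateE → Labelling → Fin n → ℕ
  xCount t ℓ v = count (λ w → lookup ℓ w ∧ conn t v w)

  lookup-push : ∀ t ℓ v → lookup (push t ℓ) v ≡ isRep t v ∧ eqℕ (xCount t ℓ v) 1
  lookup-push t ℓ v = trans (lookup∘tabulate _ v)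
    (cong (λ k → isRep t v ∧ eqℕ k 1) (countL-allFin (λ w → lookup ℓ w ∧ conn t v w)))

  Valid-push : ∀ t ℓ → Valid (t , push t ℓ)
  Valid-push t ℓ v h = proj₁ (∧-true⁻ (trans (sym (lookup-push t ℓ v)) h))

  ¬isRep⇒false : ∀ s ℓ → Valid (s , ℓ) → ∀ {v} → isRep s v ≡ false → lookup ℓ v ≡ false
  ¬isRep⇒false s ℓ val {v} r = not-true⇒false (λ h → true≢false (trans (sym (val v h)) r))

  ∧-conn-refl : ∀ t (ℓ : Labelling) v → lookup ℓ v ∧ conn t v v ≡ lookup ℓ v
  ∧-conn-refl t ℓ v = trans (cong (lookup ℓ v ∧_) conn-refl) (∧-identityʳ _)

  xCount-one : ∀ t ℓ {v} → (∀ w → lookup ℓ w ≡ true → Conn t v w → w ≡ v) → xCount t ℓ v ≡ toNat (lookup ℓ v)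
  xCount-one t ℓ {v} h = trans
    (count-one _ v (λ w x → let a , b = ∧-true⁻ x in h w a b)) (cong toNat (∧-conn-refl t ℓ v))

  push-valid : ∀ t ℓ → Valid (t , ℓ) → push t ℓ ≡ ℓ
  push-valid t ℓ val = lookup-ext λ v → trans (lookup-push t ℓ v) (go v (bool-cases (isRep t v)))
    where
    go : ∀ v → isRep t v ≡ true ⊎ isRep t v ≡ false → isRep t v ∧ eqℕ (xCount t ℓ v) 1 ≡ lookup ℓ v
    go v (inj₁ r) rewrite r = trans (cong (λ k → eqℕ k 1)
      (xCount-one t ℓ (λ w x c → sym (isRep-unique r (val w x) c)))) (eqℕ-1-toNat _)
    go v (inj₂ r) rewrite r = sym (¬isRep⇒false t ℓ val r)

  Valid-add⁻ : ∀ s e ℓ → Valid (add s e , ℓ) → Valid (s , ℓ)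
  Valid-add⁻ s e ℓ val v h = isRep-mono (add-⊇ s e) (val v h)

  Valid-loop : ∀ s e ℓ → Conn s (src e) (tgt e) → Valid (s , ℓ) → Valid (add s e , ℓ)
  Valid-loop s e ℓ loop val v h = isRep⁺ λ w c → isRep⁻ (val v h) (conn-loop s e loop c)

  push-loop : ∀ s e ℓ → Conn s (src e) (tgt e) → Valid (s , ℓ) → push (add s e) ℓ ≡ ℓ
  push-loop s e ℓ loop val = push-valid (add s e) ℓ (Valid-loop s e ℓ loop val)

  module _ {s e} (M : Merge s e) ℓ (val : Valid (s , ℓ)) where
    open Merge M

    xCount-p : xCount (add s e) ℓ p ≡ toNat (lookup ℓ p) ℕ.+ toNat (lookup ℓ q)
    xCount-p = trans (count-two _ p q p≢q only) (cong₂ ℕ._+_ (cong toNat (∧-conn-refl (add s e) ℓ p))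
      (cong toNat (trans (cong (lookup ℓ q ∧_) joined) (∧-identityʳ _))))
      where
      only : ∀ w → lookup ℓ w ∧ conn (add s e) p w ≡ true → w ≡ p ⊎ w ≡ q
      only w h with ∧-true⁻ {lookup ℓ w} h
      ... | x , c with split c
      ... | inj₁ y              = inj₁ (sym (isRep-unique rep-p (val w x) y))
      ... | inj₂ (inj₁ (_ , y)) = inj₂ (sym (isRep-unique rep-q (val w x) y))
      ... | inj₂ (inj₂ (y , _)) = ⊥-elim (¬conn y)

    xCount-other : ∀ {v} → isRep s v ≡ true → v ≢ p → v ≢ q → xCount (add s e) ℓ v ≡ toNat (lookup ℓ v)
    xCount-other {v} r np nq = xCount-one (add s e) ℓ only
      where
      only : ∀ w → lookup ℓ w ≡ true → Conn (add s e) v w → w ≡ v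
      only w x c with split c
      ... | inj₁ y              = sym (isRep-unique r (val w x) y)
      ... | inj₂ (inj₁ (y , _)) = ⊥-elim (np (isRep-unique r rep-p y))
      ... | inj₂ (inj₂ (y , _)) = ⊥-elim (nq (isRep-unique r rep-q y))

    -- Among the two merged labels exactly one `x` gives `x`, and none or two give 1. So `xor` is
    -- the product with x² = 1, which agrees with d where d is nonzero and with Φ on two `x`'s.
    push-merge : push (add s e) ℓ ≡ (ℓ [ q ]≔ false) [ p ]≔ (lookup ℓ p xor lookup ℓ q)
    push-merge = lookup-ext λ v → trans (lookup-push (add s e) ℓ v) (go v)
      where
      go : ∀ v → isRep (add s e) v ∧ eqℕ (xCount (add s e) ℓ v) 1 ≡
                 lookup ((ℓ [ q ]≔ false) [ p ]≔ (lookup ℓ p xor lookup ℓ q)) v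
      go v with v ≟ᶠ p
      ... | yes refl rewrite isRep-p = trans (cong (λ k → eqℕ k 1) xCount-p)
              (trans (eqℕ-1-toNat₂ (lookup ℓ p) (lookup ℓ q)) (sym (lookup-≔ (ℓ [ q ]≔ false) p)))
      ... | no np with v ≟ᶠ q
      ... | yes refl rewrite ¬isRep-q = sym (trans (lookup-≔′ (ℓ [ q ]≔ false) np) (lookup-≔ ℓ q))
      ... | no nq = trans (old (bool-cases (isRep s v)))
              (sym (trans (lookup-≔′ (ℓ [ q ]≔ false) np) (lookup-≔′ ℓ nq)))
        where
        old : isRep s v ≡ true ⊎ isRep s v ≡ false →
              isRep (add s e) v ∧ eqℕ (xCount (add s e) ℓ v) 1 ≡ lookup ℓ v
        old (inj₁ r) rewrite isRep-other nq r = trans (cong (λ k → eqℕ k 1) (xCount-other r np nq)) (eqℕ-1-toNat _)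
        old (inj₂ r) = trans (cong (_∧ eqℕ (xCount (add s e) ℓ v) 1) notRep) (sym (¬isRep⇒false s ℓ val r))
          where
          notRep : isRep (add s e) v ≡ false
          notRep = not-true⇒false (λ x → true≢false (trans (sym (isRep-mono (add-⊇ s e) {v} x)) r))

  -- Labels are multiplied in ℚ[x]/(x² = 1): only the parity of the number of
  -- x's in a component matters, so that the order of merging is irrelevant.
  parity : StateE → Labelling → Fin n → Bool
  parity t ℓ v = sum (λ w → lookup ℓ w ∧ conn t v w)

  -- After adding one edge a component contains at most two old ones, so its number of `x`'s is a
  -- sum of two bits. On such numbers "equal to 1" and "odd" agree.
  push-parity : ∀ s e ℓ → Valid (s , ℓ) → ∀ v → lookup (push (add s e) ℓ) v ≡ isRep (add s e) v ∧ parity (add s e) ℓ v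
  push-parity s e ℓ val v = trans (lookup-push (add s e) ℓ v) (go (bool-cases (isRep (add s e) v)))
    where
    two : isRep (add s e) v ≡ true → ∃₂ λ b b' → xCount (add s e) ℓ v ≡ toNat b ℕ.+ toNat b'
    two r with bool-cases (conn s (src e) (tgt e))
    ... | inj₁ loop = lookup ℓ v , false , trans
            (xCount-one (add s e) ℓ (λ w x c → sym (isRep-unique r (Valid-loop s e ℓ loop val w x) c)))
            (sym (ℕ.+-identityʳ _))
    ... | inj₂ apart with v ≟ᶠ Merge.p (merge s e apart) | v ≟ᶠ Merge.q (merge s e apart)
    ... | yes refl | _        = lookup ℓ (Merge.p (merge s e apart)) , lookup ℓ (Merge.q (merge s e apart)) , xCount-p (merge s e apart) ℓ val
    ... | no _     | yes refl = ⊥-elim (true≢false (trans (sym r) (Merge.¬isRep-q (merge s e apart))))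
    ... | no np    | no nq    = lookup ℓ v , false , trans
            (xCount-other (merge s e apart) ℓ val (isRep-mono (add-⊇ s e) r) np nq) (sym (ℕ.+-identityʳ _))
    go : isRep (add s e) v ≡ true ⊎ isRep (add s e) v ≡ false →
         isRep (add s e) v ∧ eqℕ (xCount (add s e) ℓ v) 1 ≡ isRep (add s e) v ∧ parity (add s e) ℓ v
    go (inj₂ r) rewrite r = refl
    go (inj₁ r) with two r
    ... | b , b' , eq = cong (isRep (add s e) v ∧_) (begin
      eqℕ (xCount (add s e) ℓ v) 1    ≡⟨ cong (λ k → eqℕ k 1) eq ⟩
      eqℕ (toNat b ℕ.+ toNat b') 1    ≡⟨ eqℕ-1-toNat₂ b b' ⟩
      b xor b'                        ≡⟨ cong (b xor_) (odd-toNat b') ⟨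
      b xor odd (toNat b')            ≡⟨ odd-toNat+ b (toNat b') ⟨
      odd (toNat b ℕ.+ toNat b')      ≡⟨ cong odd eq ⟨
      odd (xCount (add s e) ℓ v)      ≡⟨ odd-count (λ w → lookup ℓ w ∧ conn (add s e) v w) ⟩
      parity (add s e) ℓ v ∎)
      where open ≡-Reasoning

  -- Double counting modulo 2: each `x` of `ℓ`, at a vertex `u`, is counted once through the
  -- representative of its component in `t`, and that representative lies in the same component of
  -- `t'` as `u`.
  parity-push : ∀ {t t'} → t ⊆ t' → ∀ ℓ κ → (∀ v → lookup κ v ≡ isRep t v ∧ parity t ℓ v) →
                ∀ v → parity t' κ v ≡ parity t' ℓ v
  parity-push {t} {t'} i ℓ κ eq v = begin
    sum (λ w → lookup κ w ∧ conn t' v w)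
      ≡⟨ sum-cong-≗ (λ w → trans (cong (_∧ conn t' v w) (eq w)) (rearrange w)) ⟩
    sum (λ w → sum (λ u → term w u))
      ≡⟨ ∑-comm term ⟩
    sum (λ u → sum (λ w → term w u))
      ≡⟨ sum-cong-≗ inner ⟩
    sum (λ u → lookup ℓ u ∧ conn t' v u) ∎
    where
    open ≡-Reasoning
    term : Fin n → Fin n → Bool
    term w u = (isRep t w ∧ (lookup ℓ u ∧ conn t w u)) ∧ conn t' v w
    rearrange : ∀ w → (isRep t w ∧ parity t ℓ w) ∧ conn t' v w ≡ sum (term w)
    rearrange w = trans (cong (_∧ conn t' v w) (*-distribˡ-sum (isRep t w) (λ u → lookup ℓ u ∧ conn t w u)))
      (*-distribʳ-sum (conn t' v w) (λ u → isRep t w ∧ (lookup ℓ u ∧ conn t w u)))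
    inner : ∀ u → sum (λ w → term w u) ≡ lookup ℓ u ∧ conn t' v u
    inner u = begin
      sum (λ w → term w u)   ≡⟨ sum-one (λ w → term w u) (rep t u) only ⟩
      term (rep t u) u       ≡⟨ cong (_∧ conn t' v (rep t u)) (cong₂ _∧_ (isRep-rep {t} {u})
                                  (trans (cong (lookup ℓ u ∧_) (conn-sym (conn-rep {t} {u}))) (∧-identityʳ _))) ⟩
      lookup ℓ u ∧ conn t' v (rep t u) ≡⟨ cong (lookup ℓ u ∧_) (conn-congʳ (conn-mono i (conn-sym (conn-rep {t} {u})))) ⟩
      lookup ℓ u ∧ conn t' v u ∎
      where
      only : ∀ w → term w u ≡ true → w ≡ rep t u
      only w h with ∧-true⁻ {isRep t w ∧ (lookup ℓ u ∧ conn t w u)} h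
      ... | x , _ with ∧-true⁻ {isRep t w} x
      ... | r , y = sym (rep-unique r (conn-sym (proj₂ (∧-true⁻ {lookup ℓ u} y))))

  -- Either order of adding the two edges yields the parity labelling of `s` with both edges added,
  -- and that does not mention the order.
  push-swap : ∀ s e f ℓ → Valid (s , ℓ) →
              push (add (add s e) f) (push (add s e) ℓ) ≡ push (add (add s f) e) (push (add s f) ℓ)
  push-swap s e f ℓ val = lookup-ext λ v → trans (half e f v)
    (trans (cong (λ t → isRep t v ∧ parity t ℓ v) (add-comm s e f)) (sym (half f e v)))
    where
    half : ∀ e f v → lookup (push (add (add s e) f) (push (add s e) ℓ)) v ≡
                     isRep (add (add s e) f) v ∧ parity (add (add s e) f) ℓ v
    half e f v = trans (push-parity (add s e) f (push (add s e) ℓ) (Valid-push (add s e) ℓ) v)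
      (cong (isRep (add (add s e) f) v ∧_) (parity-push (add-⊇ (add s e) f) ℓ (push (add s e) ℓ) (push-parity s e ℓ val) v))

  -- Degrees

  joinsXX-loop : ∀ s ℓ e → Conn s (src e) (tgt e) → joinsXX (s , ℓ) e ≡ false
  joinsXX-loop s ℓ e loop = cong (λ b → not b ∧ xlab (s , ℓ) (src e) ∧ xlab (s , ℓ) (tgt e)) loop

  countTrue-merge : ∀ (ℓ : Labelling) {p q} → p ≢ q → ∀ b →
    toNat (lookup ℓ p) ℕ.+ (toNat (lookup ℓ q) ℕ.+ countTrue ((ℓ [ q ]≔ false) [ p ]≔ b)) ≡ toNat b ℕ.+ countTrue ℓ
  countTrue-merge ℓ {p} {q} ne b = begin
    x ℕ.+ (y ℕ.+ c)                            ≡⟨ ℕ.+-assoc x y c ⟨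
    (x ℕ.+ y) ℕ.+ c                            ≡⟨ cong (ℕ._+ c) (ℕ.+-comm x y) ⟩
    (y ℕ.+ x) ℕ.+ c                            ≡⟨ ℕ.+-assoc y x c ⟩
    y ℕ.+ (x ℕ.+ c)                            ≡⟨ cong (λ k → y ℕ.+ (toNat k ℕ.+ c)) (lookup-≔′ ℓ ne) ⟨
    y ℕ.+ (toNat (lookup (ℓ [ q ]≔ false) p) ℕ.+ c) ≡⟨ cong (y ℕ.+_) (countTrue-≔ (ℓ [ q ]≔ false) p b) ⟩
    y ℕ.+ (toNat b ℕ.+ countTrue (ℓ [ q ]≔ false)) ≡⟨ ℕ.+-assoc y (toNat b) _ ⟨
    (y ℕ.+ toNat b) ℕ.+ countTrue (ℓ [ q ]≔ false) ≡⟨ cong (ℕ._+ countTrue (ℓ [ q ]≔ false)) (ℕ.+-comm y (toNat b)) ⟩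
    (toNat b ℕ.+ y) ℕ.+ countTrue (ℓ [ q ]≔ false) ≡⟨ ℕ.+-assoc (toNat b) y _ ⟩
    toNat b ℕ.+ (y ℕ.+ countTrue (ℓ [ q ]≔ false)) ≡⟨ cong (toNat b ℕ.+_) (countTrue-≔ ℓ q false) ⟩
    toNat b ℕ.+ countTrue ℓ ∎
    where
    open ≡-Reasoning
    x = toNat (lookup ℓ p)
    y = toNat (lookup ℓ q)
    c = countTrue ((ℓ [ q ]≔ false) [ p ]≔ b)

  module _ {s e} (M : Merge s e) ℓ (val : Valid (s , ℓ)) where
    open Merge M

    degree-merge : toNat (lookup ℓ p) ℕ.+ (toNat (lookup ℓ q) ℕ.+ countTrue (push (add s e) ℓ)) ≡
                   toNat (lookup ℓ p xor lookup ℓ q) ℕ.+ countTrue ℓ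
    degree-merge = trans (cong (λ κ → toNat (lookup ℓ p) ℕ.+ (toNat (lookup ℓ q) ℕ.+ countTrue κ)) (push-merge M ℓ val))
      (countTrue-merge ℓ p≢q (lookup ℓ p xor lookup ℓ q))

  degree-joins : ∀ s e ℓ → Valid (s , ℓ) → joinsXX (s , ℓ) e ≡ true → suc (suc (countTrue (push (add s e) ℓ))) ≡ countTrue ℓ
  degree-joins s e ℓ val j = go (bool-cases (conn s (src e) (tgt e)))
    where
    both : ∀ b b' {x y} → b ∧ b' ≡ true → toNat b ℕ.+ (toNat b' ℕ.+ x) ≡ toNat (b xor b') ℕ.+ y → suc (suc x) ≡ y
    both true true _ eq = eq
    go : Conn s (src e) (tgt e) ⊎ conn s (src e) (tgt e) ≡ false → suc (suc (countTrue (push (add s e) ℓ))) ≡ countTrue ℓ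
    go (inj₁ loop)  = ⊥-elim (true≢false (trans (sym j) (joinsXX-loop s ℓ e loop)))
    go (inj₂ apart) = let M = merge s e apart in
      both (lookup ℓ (Merge.p M)) (lookup ℓ (Merge.q M)) (trans (sym (Merge.joins M ℓ)) j) (degree-merge M ℓ val)

  degree-preserved : ∀ s e ℓ → Valid (s , ℓ) → joinsXX (s , ℓ) e ≡ false → countTrue (push (add s e) ℓ) ≡ countTrue ℓ
  degree-preserved s e ℓ val j = go (bool-cases (conn s (src e) (tgt e)))
    where
    not-both : ∀ b b' {x y} → b ∧ b' ≡ false → toNat b ℕ.+ (toNat b' ℕ.+ x) ≡ toNat (b xor b') ℕ.+ y → x ≡ y
    not-both true  false _ eq = ℕ.suc-injective eq
    not-both false true  _ eq = ℕ.suc-injective eq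
    not-both false false _ eq = eq
    go : Conn s (src e) (tgt e) ⊎ conn s (src e) (tgt e) ≡ false → countTrue (push (add s e) ℓ) ≡ countTrue ℓ
    go (inj₁ loop)  = cong countTrue (push-loop s e ℓ loop val)
    go (inj₂ apart) = let M = merge s e apart in
      not-both (lookup ℓ (Merge.p M)) (lookup ℓ (Merge.q M)) (trans (sym (Merge.joins M ℓ)) j) (degree-merge M ℓ val)

  degree-≤ : ∀ s e ℓ → Valid (s , ℓ) → countTrue (push (add s e) ℓ) ℕ.≤ countTrue ℓ
  degree-≤ s e ℓ val with bool-cases (joinsXX (s , ℓ) e)
  ... | inj₁ j = subst (countTrue (push (add s e) ℓ) ℕ.≤_) (degree-joins s e ℓ val j) (ℕ.m≤n⇒m≤1+n (ℕ.n≤1+n _))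
  ... | inj₂ j = ℕ.≤-reflexive (degree-preserved s e ℓ val j)

  -- Joining two `x`'s lowers the degree by 2. This converse of `degree-preserved` replaces the
  -- condition on labels by a numerical one, which is easy to transport between states.
  degree⇒¬joins : ∀ s e ℓ → Valid (s , ℓ) → countTrue (push (add s e) ℓ) ≡ countTrue ℓ → joinsXX (s , ℓ) e ≡ false
  degree⇒¬joins s e ℓ val eq = not-true⇒false λ j →
    ℕ.m≢1+n+m _ {1} (trans eq (sym (degree-joins s e ℓ val j)))

  module _ {s e} (M : Merge s e) ℓ (val : Valid (s , ℓ)) (j : joinsXX (s , ℓ) e ≡ false) where
    open Merge M

    xlab-merge : ∀ {v} → xlab (s , ℓ) v ≡ true → xlab (add s e , push (add s e) ℓ) v ≡ true
    xlab-merge {v} x = trans (cong (λ κ → lookup κ (rep (add s e) v)) (push-merge M ℓ val)) (go (rep s v ≟ᶠ p) (rep s v ≟ᶠ q))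
      where
      κ = (ℓ [ q ]≔ false) [ p ]≔ (lookup ℓ p xor lookup ℓ q)
      one : ∀ b b' → b ∧ b' ≡ false → b ≡ true ⊎ b' ≡ true → b xor b' ≡ true
      one true  false _ _       = refl
      one false true  _ _       = refl
      one false false _ (inj₁ ())
      one false false _ (inj₂ ())
      v~rep : Conn (add s e) v (rep s v)
      v~rep = conn-mono (add-⊇ s e) (conn-rep {s} {v})
      at-p : Conn (add s e) v p → lookup ℓ p ≡ true ⊎ lookup ℓ q ≡ true → lookup κ (rep (add s e) v) ≡ true
      at-p c h = trans (cong (lookup κ) (rep-unique isRep-p c))
        (trans (lookup-≔ (ℓ [ q ]≔ false) p) (one (lookup ℓ p) (lookup ℓ q) (trans (sym (joins ℓ)) j) h))
      go : Dec (rep s v ≡ p) → Dec (rep s v ≡ q) → lookup κ (rep (add s e) v) ≡ true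
      go (yes ep) _ = at-p (subst (Conn (add s e) v) ep v~rep) (inj₁ (subst (λ w → lookup ℓ w ≡ true) ep x))
      go (no _) (yes eq) = at-p (conn-trans (subst (Conn (add s e) v) eq v~rep) (conn-sym joined))
        (inj₂ (subst (λ w → lookup ℓ w ≡ true) eq x))
      go (no np) (no nq) = trans (cong (lookup κ) (rep-unique (isRep-other nq (isRep-rep {s} {v})) v~rep))
        (trans (lookup-≔′ (ℓ [ q ]≔ false) np) (trans (lookup-≔′ ℓ nq) x))

  -- With x·x excluded, a component labelled `x` can only merge with one labelled 1, and x·1 = x.
  -- Hence requiring the label `x` at a vertex defines a subcomplex for d.
  xlab-preserved : ∀ s e ℓ → Valid (s , ℓ) → joinsXX (s , ℓ) e ≡ false → ∀ {v} →
                   xlab (s , ℓ) v ≡ true → xlab (add s e , push (add s e) ℓ) v ≡ true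
  xlab-preserved s e ℓ val j {v} x = go (bool-cases (conn s (src e) (tgt e)))
    where
    go : Conn s (src e) (tgt e) ⊎ conn s (src e) (tgt e) ≡ false → xlab (add s e , push (add s e) ℓ) v ≡ true
    go (inj₂ apart) = xlab-merge (merge s e apart) ℓ val j {v} x
    go (inj₁ loop)  = trans (cong (λ κ → lookup κ (rep (add s e) v)) (push-loop s e ℓ loop val))
      (trans (cong (lookup ℓ) (rep-unique (Valid-loop s e ℓ loop val (rep s v) x) (conn-mono (add-⊇ s e) (conn-rep {s} {v})))) x)

-- The operator of a single edge: signs, anticommutation, d and Φ + d as sums over edges

δ-∧ : ∀ a b x → δ a (δ b x) ≡ δ (a ∧ b) x
δ-∧ true  b x = refl
δ-∧ false b x = refl

δ-neg : ∀ b b' {x y} → b ≡ b' → (b ≡ true → x ≡ - y) → δ b x ≡ - δ b' y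
δ-neg true  .true  refl h = h refl
δ-neg false .false refl h = refl

*-δ : ∀ c b x → c * δ b x ≡ δ b (c * x)
*-δ c true  x = refl
*-δ c false x = ℚ.*-zeroʳ c

module EdgeOperators (Γ : Graph) where
  open Graph Γ
  open Chromatic Γ
  open Operators Γ public
  open Components Γ public
  open Labels Γ public

  sgn : StateE → Fin m → ℚ
  sgn s e = signQ (nSign s e)

  grow : State → Fin m → State
  grow (s , ℓ) e = add s e , push (add s e) ℓ

  signQ² : ∀ k → signQ k * signQ k ≡ 1ℚ
  signQ² zero    = refl
  signQ² (suc k) = trans (solve 1 (λ x → (:- x) :* (:- x) := x :* x) refl (signQ k)) (signQ² k)

  sgn² : ∀ s e → sgn s e * sgn s e ≡ 1ℚ
  sgn² s e = signQ² (nSign s e)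

  nSign-add : ∀ s e f → s ∌ f → nSign (add s f) e ≡ toNat ⌊ toℕ f ℕ.<? toℕ e ⌋ ℕ.+ nSign s e
  nSign-add s e f new = begin
    nSign (add s f) e       ≡⟨ countL-allFin (smaller (add s f)) ⟩
    count (smaller (add s f)) ≡⟨ count-remove (smaller (add s f)) f ⟩
    toNat (smaller (add s f) f) ℕ.+ count (λ g → smaller (add s f) g ∧ not ⌊ g ≟ᶠ f ⌋)
      ≡⟨ cong₂ ℕ._+_ (cong (λ b → toNat (b ∧ ⌊ toℕ f ℕ.<? toℕ e ⌋)) (add-∋ s f)) (count-cong other) ⟩
    toNat ⌊ toℕ f ℕ.<? toℕ e ⌋ ℕ.+ count (smaller s) ≡⟨ cong (toNat ⌊ toℕ f ℕ.<? toℕ e ⌋ ℕ.+_) (countL-allFin (smaller s)) ⟨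
    toNat ⌊ toℕ f ℕ.<? toℕ e ⌋ ℕ.+ nSign s e ∎
    where
    open ≡-Reasoning
    smaller : StateE → Fin m → Bool
    smaller t g = lookup t g ∧ ⌊ toℕ g ℕ.<? toℕ e ⌋
    other : ∀ g → smaller (add s f) g ∧ not ⌊ g ≟ᶠ f ⌋ ≡ smaller s g
    other g with g ≟ᶠ f
    ... | yes refl = trans (∧-zeroʳ _) (cong (_∧ ⌊ toℕ f ℕ.<? toℕ e ⌋) (sym new))
    ... | no ne    = trans (∧-identityʳ _) (cong (_∧ ⌊ toℕ g ℕ.<? toℕ e ⌋) (add-other s ne))

  -- One of the two edges precedes the other. Adding the smaller one first contributes a factor -1
  -- to the sign of the larger, and adding the larger one changes nothing for the smaller.
  sgn-swap : ∀ s {e f} → s ∌ e → s ∌ f → e ≢ f → sgn s e * sgn (add s e) f ≡ - (sgn s f * sgn (add s f) e)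
  sgn-swap s {e} {f} ne nf e≢f rewrite nSign-add s f e ne | nSign-add s e f nf
    with toℕ e ℕ.<? toℕ f | toℕ f ℕ.<? toℕ e
  ... | yes p | yes q = ⊥-elim (ℕ.<-asym p q)
  ... | no p  | no q  = ⊥-elim (e≢f (toℕ-injective (ℕ.≤-antisym (ℕ.≮⇒≥ q) (ℕ.≮⇒≥ p))))
  ... | yes _ | no _  = solve 2 (λ x y → x :* (:- y) := :- (y :* x)) refl (signQ (nSign s e)) (signQ (nSign s f))
  ... | no _  | yes _ = solve 2 (λ x y → x :* y := :- (y :* (:- x))) refl (signQ (nSign s e)) (signQ (nSign s f))

  -- The three differentials d, Φ and Φ + d are sums over edges of operators
  -- which differ only in the condition under which an edge contributes.
  Gate : Set
  Gate = State → Fin m → Bool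

  dGate ΦGate DGate : Gate
  dGate S e = not (joinsXX S e)
  ΦGate     = joinsXX
  DGate S e = true

  edge : Gate → Fin m → Img
  edge g e S = if lookup (proj₁ S) e then [] else
               if g S e then (sgn (proj₁ S) e , grow S e) ∷ [] else []

  edges : Gate → List (Fin m) → Img
  edges g U S = concatMap (λ e → edge g e S) U

  active : Gate → Fin m → State → Bool
  active g e S = not (lookup (proj₁ S) e) ∧ g S e

  ⟦⟧-edge : ∀ g e h S → ⟦ edge g e ⟧ h S ≡ δ (active g e S) (sgn (proj₁ S) e * h (grow S e))
  ⟦⟧-edge g e h S with lookup (proj₁ S) e | g S e
  ... | true  | _     = refl
  ... | false | true  = ℚ.+-identityʳ _
  ... | false | false = refl

  active⁺ : ∀ g e S → proj₁ S ∌ e → g S e ≡ true → active g e S ≡ true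
  active⁺ g e S ne ge = ∧-true⁺ (cong not ne) ge

  active⁻ : ∀ g e S → active g e S ≡ true → proj₁ S ∌ e × g S e ≡ true
  active⁻ g e S h = map₁ not-true (∧-true⁻ {not (lookup (proj₁ S) e)} h)
    where
    not-true : ∀ {b} → not b ≡ true → b ≡ false
    not-true {false} _ = refl

  ⟦⟧-edge-on : ∀ g e h S → proj₁ S ∌ e → g S e ≡ true → ⟦ edge g e ⟧ h S ≡ sgn (proj₁ S) e * h (grow S e)
  ⟦⟧-edge-on g e h S ne ge = trans (⟦⟧-edge g e h S) (cong (λ b → δ b _) (active⁺ g e S ne ge))

  ⟦⟧-edge-off : ∀ g e h S → g S e ≡ false → ⟦ edge g e ⟧ h S ≡ 0ℚ
  ⟦⟧-edge-off g e h S ge = trans (⟦⟧-edge g e h S)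
    (cong (λ b → δ b (sgn (proj₁ S) e * h (grow S e))) (trans (cong (not (lookup (proj₁ S) e) ∧_) ge) (∧-zeroʳ _)))

  ⟦⟧-edge-old : ∀ g e h S → proj₁ S ∋ e → ⟦ edge g e ⟧ h S ≡ 0ℚ
  ⟦⟧-edge-old g e h S i = trans (⟦⟧-edge g e h S) (cong (λ b → δ (not b ∧ g S e) (sgn (proj₁ S) e * h (grow S e))) i)

  All-edge : ∀ {R : State → Set} g e S → (proj₁ S ∌ e → g S e ≡ true → R (grow S e)) → All (R ∘ proj₂) (edge g e S)
  All-edge g e S h with lookup (proj₁ S) e | g S e
  ... | true  | _     = []
  ... | false | true  = h refl refl ∷ []
  ... | false | false = []

  module _ {P R : State → Set} {f : Cochain} where
    Supp-edge : ∀ g e → (∀ S → P S → proj₁ S ∌ e → g S e ≡ true → R (grow S e)) →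
                Supp P f → Supp R (extend (edge g e) f)
    Supp-edge g e h = Supp-extend (edge g e) (λ {S} p → All-edge g e S (h S p))

    Supp-edges : ∀ g U → (∀ S e → e ∈ U → P S → proj₁ S ∌ e → g S e ≡ true → R (grow S e)) →
                 Supp P f → Supp R (extend (edges g U) f)
    Supp-edges g U h = Supp-extend (edges g U) (λ {S} p → go U S (λ e i → h S e i p))
      where
      go : ∀ U S → (∀ e → e ∈ U → proj₁ S ∌ e → g S e ≡ true → R (grow S e)) → All (R ∘ proj₂) (edges g U S)
      go []      S h = []
      go (e ∷ U) S h = ++⁺ (All-edge g e S (h e (here refl))) (go U S (λ e i → h e (there i)))

  Valid-grow : ∀ S e → Valid (grow S e)
  Valid-grow (s , ℓ) e = Valid-push (add s e) ℓ

  extend-++ : ∀ A B f → extend (λ S → A S ++ B S) f ≐ (extend A f ⊕ extend B f)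
  extend-++ A B f T = trans (extend-⟦⟧ (λ S → A S ++ B S) f T) (trans
    (∑-cong allStates (λ S → trans (cong (f S *_) (pairing-++ (A S) (B S) (indicator T)))
      (ℚ.*-distribˡ-+ (f S) (⟦ A ⟧ (indicator T) S) (⟦ B ⟧ (indicator T) S))))
    (trans (∑-+ allStates _ _) (sym (cong₂ _+_ (extend-⟦⟧ A f T) (extend-⟦⟧ B f T)))))

  edges-∷ : ∀ g e U f → extend (edges g (e ∷ U)) f ≐ (extend (edge g e) f ⊕ extend (edges g U) f)
  edges-∷ g e U f = extend-++ (edge g e) (edges g U) f

  edges-[] : ∀ g f → extend (edges g []) f ≐ zeroC
  edges-[] g f T = ∑-zero allStates (λ S → ℚ.*-zeroʳ (f S))

  -- If both steps survive in one order, they survive in the other. One implication suffices, the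
  -- edges being interchangeable.
  Symmetric : Gate → Set
  Symmetric g = ∀ S e f → Valid S → proj₁ S ∌ e → proj₁ S ∌ f → g S e ≡ true → g (grow S e) f ≡ true →
                g S f ≡ true × g (grow S f) e ≡ true

  grow-swap : ∀ S e f → Valid S → grow (grow S e) f ≡ grow (grow S f) e
  grow-swap (s , ℓ) e f val = cong₂ _,_ (add-comm s e f) (push-swap s e f ℓ val)

  module _ (g : Gate) (g-sym : Symmetric g) where

    -- The two composites reach the same state with opposite signs. The case `e = f` is included:
    -- there both sides vanish, because an edge that has been added is no longer available.
    edge-anticommute : ∀ e f {F} → Supp Valid F →
      extend (edge g e) (extend (edge g f) F) ≐ neg (extend (edge g f) (extend (edge g e) F))
    edge-anticommute e f = anticommute (edge g e) (edge g f) (edge g f) (edge g e) (λ {S} val h → go S val h)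
      where
      two : ∀ e f h S → ⟦ edge g f ⟧ (⟦ edge g e ⟧ h) S ≡
            δ (active g f S ∧ active g e (grow S f)) (sgn (proj₁ S) f * (sgn (proj₁ (grow S f)) e * h (grow (grow S f) e)))
      two e f h S = begin
        ⟦ edge g f ⟧ (⟦ edge g e ⟧ h) S
          ≡⟨ ⟦⟧-edge g f (⟦ edge g e ⟧ h) S ⟩
        δ (active g f S) (a * ⟦ edge g e ⟧ h (grow S f))
          ≡⟨ cong (λ x → δ (active g f S) (a * x)) (⟦⟧-edge g e h (grow S f)) ⟩
        δ (active g f S) (a * δ (active g e (grow S f)) b)
          ≡⟨ cong (δ (active g f S)) (*-δ a (active g e (grow S f)) b) ⟩
        δ (active g f S) (δ (active g e (grow S f)) (a * b))
          ≡⟨ δ-∧ (active g f S) (active g e (grow S f)) (a * b) ⟩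
        δ (active g f S ∧ active g e (grow S f)) (a * b) ∎
        where
        open ≡-Reasoning
        a = sgn (proj₁ S) f
        b = sgn (proj₁ (grow S f)) e * h (grow (grow S f) e)
      record Both (S : State) (e f : Fin m) : Set where
        constructor both
        field
          ≢  : f ≢ e
          ∌e : proj₁ S ∌ e
          ∌f : proj₁ S ∌ f
          on : active g e S ∧ active g f (grow S e) ≡ true
      swap : ∀ S e f → Valid S → active g f S ∧ active g e (grow S f) ≡ true → Both S e f
      swap S e f val h with ∧-true⁻ {active g f S} h
      ... | x , y with active⁻ g f S x | active⁻ g e (grow S f) y
      ... | nf , gf | ne' , ge = both f≢e ne nf
            (∧-true⁺ (active⁺ g e S ne (proj₁ sym')) (active⁺ g f (grow S e) (trans (add-other (proj₁ S) f≢e) nf) (proj₂ sym')))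
        where
        f≢e : f ≢ e
        f≢e refl = true≢false (trans (sym (add-∋ (proj₁ S) f)) ne')
        ne : proj₁ S ∌ e
        ne = trans (sym (add-other (proj₁ S) (f≢e ∘ sym))) ne'
        sym' = g-sym S f e val nf ne gf ge
      go : ∀ S → Valid S → ∀ h → ⟦ edge g f ⟧ (⟦ edge g e ⟧ h) S ≡ - ⟦ edge g e ⟧ (⟦ edge g f ⟧ h) S
      go S val h = trans (two e f h S) (trans (δ-neg _ _
          (≡true-ext (λ x → Both.on (swap S e f val x)) (λ x → Both.on (swap S f e val x)))
          (λ x → value (swap S e f val x)))
        (cong -_ (sym (two f e h S))))
        where
        value : Both S e f → sgn (proj₁ S) f * (sgn (proj₁ (grow S f)) e * h (grow (grow S f) e)) ≡
                             - (sgn (proj₁ S) e * (sgn (proj₁ (grow S e)) f * h (grow (grow S e) f)))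
        value b = begin
          a * (b' * H)                             ≡⟨ ℚ.*-assoc a b' H ⟨
          a * b' * H                               ≡⟨ cong₂ _*_ (sgn-swap (proj₁ S) (Both.∌f b) (Both.∌e b) (Both.≢ b)) (cong h (grow-swap S f e val)) ⟩
          - (c * c') * H'                          ≡⟨ solve 3 (λ c c' H → (:- (c :* c')) :* H := :- (c :* (c' :* H))) refl c c' H' ⟩
          - (c * (c' * H')) ∎
          where
          open ≡-Reasoning
          a = sgn (proj₁ S) f
          b' = sgn (proj₁ (grow S f)) e
          c = sgn (proj₁ S) e
          c' = sgn (proj₁ (grow S e)) f
          H = h (grow (grow S f) e)
          H' = h (grow (grow S e) f)

    -- An operator that anticommutes with itself squares to zero, as 2 is invertible in ℚ.
    edge² : ∀ e {F} → Supp Valid F → extend (edge g e) (extend (edge g e) F) ≐ zeroC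
    edge² e v T = x≡-x⇒x≡0 (edge-anticommute e e v T)

    edge-edges : ∀ e U {F} → Supp Valid F →
      extend (edge g e) (extend (edges g U) F) ≐ neg (extend (edges g U) (extend (edge g e) F))
    edge-edges e []      {F} v T = trans (extend-zero (edge g e) (edges-[] g F) T)
      (cong -_ (sym (edges-[] g (extend (edge g e) F) T)))
    edge-edges e (f ∷ U) {F} v T = begin
      extend (edge g e) (extend (edges g (f ∷ U)) F) T
        ≡⟨ extend-cong (edge g e) (edges-∷ g f U F) T ⟩
      extend (edge g e) (extend (edge g f) F ⊕ extend (edges g U) F) T
        ≡⟨ extend-⊕ (edge g e) (extend (edge g f) F) (extend (edges g U) F) T ⟩
      extend (edge g e) (extend (edge g f) F) T + extend (edge g e) (extend (edges g U) F) T
        ≡⟨ cong₂ _+_ (edge-anticommute e f v T) (edge-edges e U v T) ⟩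
      - a + - b
        ≡⟨ solve 2 (λ a b → :- a :+ :- b := :- (a :+ b)) refl a b ⟩
      - (a + b)
        ≡⟨ cong -_ (edges-∷ g f U (extend (edge g e) F) T) ⟨
      - extend (edges g (f ∷ U)) (extend (edge g e) F) T ∎
      where
      open ≡-Reasoning
      a = extend (edge g f) (extend (edge g e) F) T
      b = extend (edges g U) (extend (edge g e) F) T

    edges² : ∀ U {F} → Supp Valid F → extend (edges g U) (extend (edges g U) F) ≐ zeroC
    edges² []      {F} v = edges-[] g (extend (edges g []) F)
    edges² (e ∷ U) {F} v T = begin
      extend (edges g (e ∷ U)) (extend (edges g (e ∷ U)) F) T
        ≡⟨ extend-cong (edges g (e ∷ U)) (edges-∷ g e U F) T ⟩
      extend (edges g (e ∷ U)) (A ⊕ B) T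
        ≡⟨ edges-∷ g e U (A ⊕ B) T ⟩
      extend (edge g e) (A ⊕ B) T + extend (edges g U) (A ⊕ B) T
        ≡⟨ cong₂ _+_ (extend-⊕ (edge g e) A B T) (extend-⊕ (edges g U) A B T) ⟩
      (extend (edge g e) A T + extend (edge g e) B T) + (extend (edges g U) A T + extend (edges g U) B T)
        ≡⟨ cong₂ _+_ (cong₂ _+_ (edge² e v T) (edge-edges e U v T)) (cong (extend (edges g U) A T +_) (edges² U v T)) ⟩
      (0ℚ + - x) + (x + 0ℚ)
        ≡⟨ solve 1 (λ x → (con 0ℚ :+ :- x) :+ (x :+ con 0ℚ) := con 0ℚ) refl x ⟩
      0ℚ ∎
      where
      open ≡-Reasoning
      A = extend (edge g e) F
      B = extend (edges g U) F
      x = extend (edges g U) A T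

  not-joins : ∀ S e → dGate S e ≡ true → joinsXX S e ≡ false
  not-joins S e h with joinsXX S e
  ... | false = refl

  -- The product of the labels of three components does not vanish iff the
  -- degree is preserved; this makes the condition symmetric.
  dGate-symmetric : Symmetric dGate
  dGate-symmetric S@(s , ℓ) e f val ne nf ge gf =
      cong not (degree⇒¬joins s f ℓ val deg-f)
    , cong not (degree⇒¬joins (add s f) e (push (add s f) ℓ) (Valid-push (add s f) ℓ) (trans deg-fe (sym deg-f)))
    where
    deg : State → ℕ
    deg S = countTrue (proj₂ S)
    deg-ef : deg (grow (grow S e) f) ≡ deg S
    deg-ef = trans (degree-preserved (add s e) f (push (add s e) ℓ) (Valid-push (add s e) ℓ) (not-joins (grow S e) f gf))
      (degree-preserved s e ℓ val (not-joins S e ge))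
    deg-fe : deg (grow (grow S f) e) ≡ deg S
    deg-fe = trans (cong deg (grow-swap S f e val)) deg-ef
    deg-f : deg (grow S f) ≡ deg S
    deg-f = ℕ.≤-antisym (degree-≤ s f ℓ val)
      (ℕ.≤-trans (ℕ.≤-reflexive (sym deg-fe)) (degree-≤ (add s f) e (push (add s f) ℓ) (Valid-push (add s f) ℓ)))

  DGate-symmetric : Symmetric DGate
  DGate-symmetric _ _ _ _ _ _ _ _ = refl , refl

  extend-img : ∀ A B f → (∀ S → A S ≡ B S) → extend A f ≐ extend B f
  extend-img A B f e T = ∑-cong allStates (λ S → cong (λ xs → f S * coeffIn xs T) (e S))

  -- The branches of the conditional in `dImg` stand in the opposite order to those of `edge dGate`,
  -- hence the case analysis. For `Φ` the analogous identity holds by unfolding.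
  d-edges : ∀ f → d f ≐ extend (edges dGate (allFin m)) f
  d-edges f = extend-img dImg (edges dGate (allFin m)) f (λ S → concatMap-cong (term S) (allFin m))
    where
    term : ∀ S e → (if lookup (proj₁ S) e then [] else
                    if joinsXX S e then [] else (sgn (proj₁ S) e , grow S e) ∷ []) ≡ edge dGate e S
    term S e with lookup (proj₁ S) e | joinsXX S e
    ... | true  | _     = refl
    ... | false | true  = refl
    ... | false | false = refl

  -- `ΦGate` and `dGate` are complementary, so each edge outside the state contributes to exactly
  -- one of Φ and d. The sum therefore has no condition on labels.
  D-edges : ∀ f → D f ≐ extend (edges DGate (allFin m)) f
  D-edges f T = trans (cong (Φ f T +_) (d-edges f T)) (sym (split (allFin m)))
    where
    termwise : ∀ e → extend (edge DGate e) f T ≡ extend (edge ΦGate e) f T + extend (edge dGate e) f T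
    termwise e = trans (∑-cong allStates (λ S → trans (cong (f S *_) (go S)) (ℚ.*-distribˡ-+ (f S) _ _))) (∑-+ allStates _ _)
      where
      go : ∀ S → coeffIn (edge DGate e S) T ≡ coeffIn (edge ΦGate e S) T + coeffIn (edge dGate e S) T
      go S with lookup (proj₁ S) e | joinsXX S e
      ... | true  | _     = refl
      ... | false | true  = sym (ℚ.+-identityʳ _)
      ... | false | false = sym (ℚ.+-identityˡ _)
    split : ∀ U → extend (edges DGate U) f T ≡ extend (edges ΦGate U) f T + extend (edges dGate U) f T
    split []      = trans (edges-[] DGate f T) (sym (cong₂ _+_ (edges-[] ΦGate f T) (edges-[] dGate f T)))
    split (e ∷ U) = begin
      extend (edges DGate (e ∷ U)) f T  ≡⟨ edges-∷ DGate e U f T ⟩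
      extend (edge DGate e) f T + extend (edges DGate U) f T ≡⟨ cong₂ _+_ (termwise e) (split U) ⟩
      (a + b) + (a' + b') ≡⟨ solve 4 (λ a b a' b' → (a :+ b) :+ (a' :+ b') := (a :+ a') :+ (b :+ b')) refl a b a' b' ⟩
      (a + a') + (b + b') ≡⟨ cong₂ _+_ (edges-∷ ΦGate e U f T) (edges-∷ dGate e U f T) ⟨
      extend (edges ΦGate (e ∷ U)) f T + extend (edges dGate (e ∷ U)) f T ∎
      where
      open ≡-Reasoning
      a = extend (edge ΦGate e) f T
      b = extend (edge dGate e) f T
      a' = extend (edges ΦGate U) f T
      b' = extend (edges dGate U) f T

-- Deletion and contraction, and vanishing above the diagonal

module Regions (Γ : Graph) where
  open Graph Γ
  open Chromatic Γ
  open EdgeOperators Γ public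

  ∂ : Fin m → Cochain → Cochain
  ∂ e = extend (edge dGate e)

  ∂s : List (Fin m) → Cochain → Cochain
  ∂s U = extend (edges dGate U)

  -- The complex (Reg U C K Q, ∂s U) is the chromatic complex of the graph
  -- obtained by contracting the edges of C and deleting those outside C ∪ U,
  -- restricted to labellings satisfying K and to the bidegrees in Q.
  record Reg (U : List (Fin m)) (C : StateE) (K : Labelling → Set) (Q : ℕ → ℕ → Set) (S : State) : Set where
    constructor reg
    field
      valid  : Valid S
      above  : C ⊆ proj₁ S
      below  : ∀ f → proj₁ S ∋ f → C ∋ f ⊎ f ∈ U
      label  : K (proj₂ S)
      degree : Q (countTrue (proj₁ S)) (countTrue (proj₂ S))

  -- The bidegrees of cochains whose differential has bidegree in `Q`, that is, where primitives are
  -- sought.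
  ↓_ : (ℕ → ℕ → Set) → ℕ → ℕ → Set
  (↓ Q) i j = Q (suc i) j

  Exact : List (Fin m) → StateE → (Labelling → Set) → (ℕ → ℕ → Set) → Set
  Exact U C K Q = ∀ F → Supp (Reg U C K Q) F → ∂s U F ≐ zeroC →
                  ∃ λ G → Supp (Reg U C K (↓ Q)) G × ∂s U G ≐ F

  Closed : (Labelling → Set) → Set
  Closed K = ∀ s e ℓ → Valid (s , ℓ) → joinsXX (s , ℓ) e ≡ false → K ℓ → K (push (add s e) ℓ)

  Supp-Valid : ∀ {U C K Q F} → Supp (Reg U C K Q) F → Supp Valid F
  Supp-Valid = Supp-mono Reg.valid

  module _ {K : Labelling → Set} (closed : Closed K) where

    module _ {U : List (Fin m)} {C : StateE} {Q : ℕ → ℕ → Set} where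
      degree-grow : ∀ s e ℓ → Reg U C K (↓ Q) (s , ℓ) → s ∌ e → dGate (s , ℓ) e ≡ true →
                    Q (countTrue (add s e)) (countTrue (push (add s e) ℓ))
      degree-grow s e ℓ r ne ge = subst₂ Q (sym (countTrue-set s e ne))
        (sym (degree-preserved s e ℓ (Reg.valid r) (not-joins (s , ℓ) e ge))) (Reg.degree r)

      Reg-grow : ∀ S e → e ∈ U → Reg U C K (↓ Q) S → proj₁ S ∌ e → dGate S e ≡ true → Reg U C K Q (grow S e)
      Reg-grow (s , ℓ) e i r ne ge = reg (Valid-grow (s , ℓ) e) (λ f x → add-⊇ s e f (Reg.above r f x)) below
        (closed s e ℓ (Reg.valid r) (not-joins (s , ℓ) e ge) (Reg.label r)) (degree-grow s e ℓ r ne ge)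
        where
        below : ∀ f → add s e ∋ f → C ∋ f ⊎ f ∈ U
        below f x with add⁻ s e f x
        ... | inj₁ y    = Reg.below r f y
        ... | inj₂ refl = inj₂ i

      Reg-contract : ∀ S e → Reg U C K (↓ Q) S → proj₁ S ∌ e → dGate S e ≡ true → Reg U (add C e) K Q (grow S e)
      Reg-contract (s , ℓ) e r ne ge = reg (Valid-grow (s , ℓ) e) above below
        (closed s e ℓ (Reg.valid r) (not-joins (s , ℓ) e ge) (Reg.label r)) (degree-grow s e ℓ r ne ge)
        where
        above : add C e ⊆ add s e
        above f x with add⁻ C e f x
        ... | inj₁ y    = add-⊇ s e f (Reg.above r f y)
        ... | inj₂ refl = add-∋ s e
        below : ∀ f → add s e ∋ f → add C e ∋ f ⊎ f ∈ U
        below f x with add⁻ s e f x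
        ... | inj₁ y    = Sum.map₁ (add-⊇ C e f) (Reg.below r f y)
        ... | inj₂ refl = inj₁ (add-∋ C e)

      Supp-∂s : ∀ {F} → Supp (Reg U C K (↓ Q)) F → Supp (Reg U C K Q) (∂s U F)
      Supp-∂s = Supp-edges dGate U (λ S e i r → Reg-grow S e i r)

      Supp-∂ : ∀ e {F} → Supp (Reg U C K (↓ Q)) F → Supp (Reg U (add C e) K Q) (∂ e F)
      Supp-∂ e = Supp-edge dGate e (λ S r → Reg-contract S e r)

  module _ {U : List (Fin m)} {C : StateE} {K : Labelling → Set} {Q : ℕ → ℕ → Set} where
    Reg-∷ : ∀ {e S} → Reg U C K Q S → Reg (e ∷ U) C K Q S
    Reg-∷ r = record { Reg r ; below = λ f x → Sum.map₂ there (Reg.below r f x) }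

    Reg-uncontract : ∀ {e S} → Reg U (add C e) K Q S → Reg (e ∷ U) C K Q S
    Reg-uncontract {e} r = record { Reg r
      ; above = λ f x → Reg.above r f (add-⊇ C e f x)
      ; below = λ f x → below f (Reg.below r f x) }
      where
      below : ∀ f → add C e ∋ f ⊎ f ∈ U → C ∋ f ⊎ f ∈ e ∷ U
      below f (inj₂ i) = inj₂ (there i)
      below f (inj₁ x) with add⁻ C e f x
      ... | inj₁ y    = inj₁ y
      ... | inj₂ refl = inj₂ (here refl)

    Reg-∋ : ∀ {e S} → Reg U (add C e) K Q S → proj₁ S ∋ e
    Reg-∋ {e} r = Reg.above r e (add-∋ C e)

    Reg-∌ : ∀ {e S} → e ∉ U → C ∌ e → Reg U C K Q S → proj₁ S ∌ e
    Reg-∌ {e} e∉U C∌e r = not-true⇒false λ x → Sum.[ false⇒not-true C∌e , e∉U ] (Reg.below r e x)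

    Reg-delete : ∀ {e S} → Reg (e ∷ U) C K Q S → proj₁ S ∌ e → Reg U C K Q S
    Reg-delete {e} {S} r ne = record { Reg r ; below = λ f x → below f x (Reg.below r f x) }
      where
      below : ∀ f → proj₁ S ∋ f → C ∋ f ⊎ f ∈ e ∷ U → C ∋ f ⊎ f ∈ U
      below f x (inj₁ y)           = inj₁ y
      below f x (inj₂ (there i))   = inj₂ i
      below f x (inj₂ (here refl)) = ⊥-elim (false⇒not-true ne x)

  -- A section of the merging map `∂ e`: delete `e` and keep the vector of labels. If `e` was a
  -- bridge of the state, the piece whose representative is new receives the label 1.
  retract : Fin m → Img
  retract e (t , κ) = if lookup t e then (sgn (remove t e) e , (remove t e , κ)) ∷ [] else []

  ⟦⟧-retract : ∀ e h t κ → t ∋ e → ⟦ retract e ⟧ h (t , κ) ≡ sgn (remove t e) e * h (remove t e , κ)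
  ⟦⟧-retract e h t κ i = trans (cong (λ b → pairing (if b then (sgn (remove t e) e , (remove t e , κ)) ∷ [] else []) h) i)
    (ℚ.+-identityʳ _)

  All-retract : ∀ {R : State → Set} e t κ → (t ∋ e → R (remove t e , κ)) → All (R ∘ proj₂) (retract e (t , κ))
  All-retract e t κ h with lookup t e
  ... | true  = h refl ∷ []
  ... | false = []

  sgn-sgn : ∀ s e x → sgn s e * (sgn s e * x) ≡ x
  sgn-sgn s e x = trans (sym (ℚ.*-assoc (sgn s e) (sgn s e) x)) (trans (cong (_* x) (sgn² s e)) (ℚ.*-identityˡ x))

  grow-remove : ∀ e t κ → t ∋ e → Valid (t , κ) → grow (remove t e , κ) e ≡ (t , κ)
  grow-remove e t κ i val = cong₂ _,_ (add-remove t e i)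
    (trans (cong (λ t' → push t' κ) (add-remove t e i)) (push-valid t κ val))

  Valid-remove : ∀ e t κ → t ∋ e → Valid (t , κ) → Valid (remove t e , κ)
  Valid-remove e t κ i val = Valid-add⁻ (remove t e) e κ (subst (λ t' → Valid (t' , κ)) (sym (add-remove t e i)) val)

  -- Merging with the unit label 1 gives back every label, so `∂ e` is onto the states containing
  -- `e`.
  ∂-retract : ∀ e {F} → Supp (λ S → Valid S × proj₁ S ∋ e) F → ∂ e (extend (retract e) F) ≐ F
  ∂-retract e {F} p T = trans (extend-⨟ (edge dGate e) (retract e) F T)
    (extend-≐id (retract e ⨟ edge dGate e) (λ {S} → go S) p T)
    where
    go : ∀ S → Valid S × proj₁ S ∋ e → ∀ h → ⟦ retract e ⨟ edge dGate e ⟧ h S ≡ h S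
    go (t , κ) (val , i) h = begin
      ⟦ retract e ⨟ edge dGate e ⟧ h (t , κ)        ≡⟨ ⟦⟧-⨟ (retract e) (edge dGate e) h (t , κ) ⟩
      ⟦ retract e ⟧ (⟦ edge dGate e ⟧ h) (t , κ)    ≡⟨ ⟦⟧-retract e _ t κ i ⟩
      a * ⟦ edge dGate e ⟧ h (remove t e , κ)       ≡⟨ cong (a *_) (⟦⟧-edge-on dGate e h (remove t e , κ) (remove-∌ t e) (cong not free)) ⟩
      a * (a * h (grow (remove t e , κ) e))         ≡⟨ sgn-sgn (remove t e) e _ ⟩
      h (grow (remove t e , κ) e)                   ≡⟨ cong h (grow-remove e t κ i val) ⟩
      h (t , κ) ∎
      where
      open ≡-Reasoning
      a = sgn (remove t e) e
      free : joinsXX (remove t e , κ) e ≡ false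
      free = degree⇒¬joins (remove t e) e κ (Valid-remove e t κ i val)
        (cong (countTrue ∘ proj₂) (grow-remove e t κ i val))

  -- Where adding `e` leaves the vector of labels unchanged, `retract e` undoes `∂ e`, so `∂ e` is
  -- injective on such states. This applies to loops and to merging a label 1 into the root
  -- component.
  retract-∂ : ∀ e {F} → Supp (λ S → proj₁ S ∌ e × joinsXX S e ≡ false × push (add (proj₁ S) e) (proj₂ S) ≡ proj₂ S) F →
              extend (retract e) (∂ e F) ≐ F
  retract-∂ e {F} p T = trans (extend-⨟ (retract e) (edge dGate e) F T)
    (extend-≐id (edge dGate e ⨟ retract e) (λ {S} → go S) p T)
    where
    go : ∀ S → proj₁ S ∌ e × joinsXX S e ≡ false × push (add (proj₁ S) e) (proj₂ S) ≡ proj₂ S →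
         ∀ h → ⟦ edge dGate e ⨟ retract e ⟧ h S ≡ h S
    go (s , ℓ) (ne , free , same) h = begin
      ⟦ edge dGate e ⨟ retract e ⟧ h (s , ℓ)        ≡⟨ ⟦⟧-⨟ (edge dGate e) (retract e) h (s , ℓ) ⟩
      ⟦ edge dGate e ⟧ (⟦ retract e ⟧ h) (s , ℓ)    ≡⟨ ⟦⟧-edge-on dGate e (⟦ retract e ⟧ h) (s , ℓ) ne (cong not free) ⟩
      sgn s e * ⟦ retract e ⟧ h (grow (s , ℓ) e)    ≡⟨ cong (sgn s e *_) (⟦⟧-retract e h (add s e) _ (add-∋ s e)) ⟩
      sgn s e * (sgn (remove (add s e) e) e * h (remove (add s e) e , push (add s e) ℓ))
        ≡⟨ cong₂ (λ s' κ → sgn s e * (sgn s' e * h (s' , κ))) (remove-add s e ne) same ⟩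
      sgn s e * (sgn s e * h (s , ℓ))               ≡⟨ sgn-sgn s e _ ⟩
      h (s , ℓ) ∎
      where open ≡-Reasoning

  ∂s² : ∀ U {F} → Supp Valid F → ∂s U (∂s U F) ≐ zeroC
  ∂s² = edges² dGate dGate-symmetric

  ∂-∂s : ∀ e U {F} → Supp Valid F → ∂ e (∂s U F) ≐ neg (∂s U (∂ e F))
  ∂-∂s = edge-edges dGate dGate-symmetric

  ∂-old : ∀ e {F} → Supp (λ S → proj₁ S ∋ e) F → ∂ e F ≐ zeroC
  ∂-old e = extend-≐0 (edge dGate e) (λ {S} i h → ⟦⟧-edge-old dGate e h S i)

  module _ {K : Labelling → Set} (closed : Closed K) {U : List (Fin m)} {e : Fin m} {C : StateE}
           (e∉U : e ∉ U) (C∌e : C ∌ e) {Q : ℕ → ℕ → Set} where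

    -- Since `∂ e` is onto the states containing `e`, subtracting a coboundary removes that part of
    -- a cocycle. What remains lives in the deletion and is annihilated by `∂ e` and `∂s U`
    -- separately, as their values have disjoint supports. So it suffices to treat the kernel of the
    -- merging map.
    reduce : (∀ F → Supp (Reg U C K Q) F → ∂s U F ≐ zeroC → ∂ e F ≐ zeroC →
                ∃ λ G → Supp (Reg (e ∷ U) C K (↓ Q)) G × ∂s (e ∷ U) G ≐ F) →
             Exact (e ∷ U) C K Q
    reduce solvable F supp cocycle =
      let G' , suppG' , eq = solvable F' suppF' (proj₂ both) (proj₁ both) in
      (G' ⊕ g) , Supp-⊕ suppG' (Supp-mono Reg-∷ suppg) ,
      λ S → trans (extend-⊕ (edges dGate (e ∷ U)) G' g S) (trans (cong (_+ ∂s (e ∷ U) g S) (eq S))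
        (solve 2 (λ a b → (a :- b) :+ b := a) refl (F S) (∂s (e ∷ U) g S)))
      where
      has : State → Bool
      has S = lookup (proj₁ S) e
      F₁ = cut has F
      F₀ = cut (not ∘ has) F
      g = extend (retract e) F₁
      F' = F ⊖ ∂s (e ∷ U) g
      supp₁ : Supp (λ S → Reg (e ∷ U) C K Q S × has S ≡ true) F₁
      supp₁ = Supp-cut has supp
      supp₀ : Supp (Reg U C K Q) F₀
      supp₀ = Supp-mono (λ { {S} (r , x) → Reg-delete r (not-has S x) }) (Supp-cut (not ∘ has) supp)
        where
        not-has : ∀ S → not (has S) ≡ true → proj₁ S ∌ e
        not-has S x with has S
        ... | false = refl
      suppg : Supp (Reg U C K (↓ Q)) g
      suppg = Supp-extend (retract e) (λ { {t , κ} (r , _) → All-retract e t κ (removed t κ r) }) supp₁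
        where
        removed : ∀ t κ → Reg (e ∷ U) C K Q (t , κ) → t ∋ e → Reg U C K (↓ Q) (remove t e , κ)
        removed t κ r i = reg (Valid-remove e t κ i (Reg.valid r)) above (λ f x → below f x (f ≟ᶠ e)) (Reg.label r)
          (subst (λ k → Q k (countTrue κ)) (sym (countTrue-unset t e i)) (Reg.degree r))
          where
          above : C ⊆ remove t e
          above f x = trans (remove-other t (λ { refl → false⇒not-true C∌e x })) (Reg.above r f x)
          below : ∀ f → remove t e ∋ f → Dec (f ≡ e) → C ∋ f ⊎ f ∈ U
          below f x (yes refl) = ⊥-elim (false⇒not-true (remove-∌ t e) x)
          below f x (no ne) with Reg.below r f (trans (sym (remove-other t ne)) x)
          ... | inj₁ y           = inj₁ y
          ... | inj₂ (here y)    = ⊥-elim (ne y)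
          ... | inj₂ (there y)   = inj₂ y
      F'-eq : F' ≐ (F₀ ⊖ ∂s U g)
      F'-eq S = trans (cong₂ _-_ (cut-split has F S) (trans (edges-∷ dGate e U g S)
          (cong (_+ ∂s U g S) (∂-retract e (Supp-mono (λ x → Reg.valid (proj₁ x) , proj₂ x) supp₁) S))))
        (solve 3 (λ a b c → (a :+ b) :- (a :+ c) := b :- c) refl (F₁ S) (F₀ S) (∂s U g S))
      suppF' : Supp (Reg U C K Q) F'
      suppF' = Supp-resp (≐-sym F'-eq) (Supp-⊖ supp₀ (Supp-∂s closed suppg))
      both : ∂ e F' ≐ zeroC × ∂s U F' ≐ zeroC
      both = Supp-disjoint {P = λ S → proj₁ S ∋ e} {R = λ S → proj₁ S ∌ e} (λ x y → false⇒not-true y x)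
        (Supp-edge dGate e (λ S _ _ _ → add-∋ (proj₁ S) e) suppF')
        (Supp-edges dGate U (λ S f i r _ _ → trans (add-other (proj₁ S) (λ { refl → e∉U i })) (Reg-∌ e∉U C∌e r)) suppF')
        (λ S → trans (sym (edges-∷ dGate e U F' S)) (trans (extend-⊖ (edges dGate (e ∷ U)) F (∂s (e ∷ U) g) S)
          (cong₂ _-_ (cocycle S) (∂s² (e ∷ U) (Supp-Valid suppg) S))))

    -- The chase through the mapping cone: `G₀` solves the equation in the deletion up to the error
    -- `∂ e G₀`. This is a cocycle of the contraction because `∂ e F = 0` and the operators
    -- anticommute, and `G₁` removes it. `Q` is the same throughout since contracted edges count in
    -- the dimension.
    cone : Exact U C K Q → Exact U (add C e) K Q →
           ∀ F → Supp (Reg U C K Q) F → ∂s U F ≐ zeroC → ∂ e F ≐ zeroC →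
           ∃ λ G → Supp (Reg (e ∷ U) C K (↓ Q)) G × ∂s (e ∷ U) G ≐ F
    cone exact₀ exact₁ F supp cocycle kill =
      (G₀ ⊖ G₁) , Supp-⊖ (Supp-mono Reg-∷ supp₀) (Supp-mono Reg-uncontract supp₁) , λ S → begin
      ∂s (e ∷ U) (G₀ ⊖ G₁) S
        ≡⟨ extend-⊖ (edges dGate (e ∷ U)) G₀ G₁ S ⟩
      ∂s (e ∷ U) G₀ S - ∂s (e ∷ U) G₁ S
        ≡⟨ cong₂ _-_ (edges-∷ dGate e U G₀ S) (edges-∷ dGate e U G₁ S) ⟩
      (∂ e G₀ S + ∂s U G₀ S) - (∂ e G₁ S + ∂s U G₁ S)
        ≡⟨ cong₂ (λ x y → (∂ e G₀ S + x) - y) (eq₀ S) (cong₂ _+_ (∂-old e (Supp-mono Reg-∋ supp₁) S) (eq₁ S)) ⟩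
      (∂ e G₀ S + F S) - (0ℚ + ∂ e G₀ S)
        ≡⟨ solve 2 (λ a b → (a :+ b) :- (con 0ℚ :+ a) := b) refl (∂ e G₀ S) (F S) ⟩
      F S ∎
      where
      open ≡-Reasoning
      solution₀ = exact₀ F supp cocycle
      G₀ = proj₁ solution₀
      supp₀ = proj₁ (proj₂ solution₀)
      eq₀ = proj₂ (proj₂ solution₀)
      closed₀ : ∂s U (∂ e G₀) ≐ zeroC
      closed₀ S = begin
        ∂s U (∂ e G₀) S         ≡⟨ solve 1 (λ x → x := :- (:- x)) refl (∂s U (∂ e G₀) S) ⟩
        - (- ∂s U (∂ e G₀) S)   ≡⟨ cong -_ (∂-∂s e U (Supp-Valid supp₀) S) ⟨
        - ∂ e (∂s U G₀) S       ≡⟨ cong -_ (extend-cong (edge dGate e) eq₀ S) ⟩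
        - ∂ e F S               ≡⟨ cong -_ (kill S) ⟩
        0ℚ ∎
      solution₁ = exact₁ (∂ e G₀) (Supp-∂ closed e supp₀) closed₀
      G₁ = proj₁ solution₁
      supp₁ = proj₁ (proj₂ solution₁)
      eq₁ = proj₂ (proj₂ solution₁)

    exact-cone : Exact U C K Q → Exact U (add C e) K Q → Exact (e ∷ U) C K Q
    exact-cone exact₀ exact₁ = reduce (cone exact₀ exact₁)

    -- For a loop the merging map changes no label and is injective, so its kernel is zero.
    exact-loop : Conn C (src e) (tgt e) → Exact (e ∷ U) C K Q
    exact-loop loop = reduce λ F supp _ kill → zeroC , Supp-zero , λ S → trans
      (extend-zero (edges dGate (e ∷ U)) ≐-refl S) (sym (trans
        (sym (retract-∂ e (Supp-mono (λ {S} → loops S) supp) S))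
        (extend-zero (retract e) kill S)))
      where
      loops : ∀ S → Reg U C K Q S → proj₁ S ∌ e × joinsXX S e ≡ false × push (add (proj₁ S) e) (proj₂ S) ≡ proj₂ S
      loops (s , ℓ) r = Reg-∌ e∉U C∌e r , joinsXX-loop s ℓ e loop' , push-loop s e ℓ loop' (Reg.valid r)
        where
        loop' : Conn s (src e) (tgt e)
        loop' = conn-mono (Reg.above r) loop

  -- Cohomology vanishes above the diagonal i + j = n.

  rank : StateE → ℕ
  rank C = count (isRep C)

  All-∉ : ∀ {e : Fin m} {U} → All (e ≢_) U → e ∉ U
  All-∉ a i = All.lookup a i refl

  exact-none : ∀ {U C K Q} → (∀ {S} → ¬ Reg U C K Q S) → Exact U C K Q
  exact-none {U} none F supp _ = zeroC , Supp-zero , λ S → trans (extend-zero (edges dGate U) ≐-refl S) (sym (Supp-∅ none supp S))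

  countTrue-valid : ∀ s ℓ → Valid (s , ℓ) → countTrue ℓ ℕ.≤ rank s
  countTrue-valid s ℓ val = subst (ℕ._≤ rank s) (sym (countTrue-count ℓ)) (count-mono val)

  rank-merge : ∀ C e → conn C (src e) (tgt e) ≡ false → suc (rank (add C e)) ℕ.≤ rank C
  rank-merge C e apart = count-strict {p = isRep (add C e)} {isRep C} (λ v → isRep-mono (add-⊇ C e) {v})
    (Merge.q M) (Merge.¬isRep-q M) (Merge.rep-q M)
    where M = merge C e apart

  -- The invariant is that the contracted edges and the components of `C` number at most `n`
  -- together: contracting an edge that is not a loop adds one edge and loses at least one
  -- component. With no free edge left the only underlying state is `C`, whose degree is at most its
  -- number of components.
  exact-above : ∀ U C {Q} → (∀ i j → Q i j → n ℕ.< i ℕ.+ j) → Unique U → (∀ {e} → e ∈ U → C ∌ e) →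
                countTrue C ℕ.+ rank C ℕ.≤ n → Exact U C (λ _ → ⊤) Q
  exact-above []      C hi uniq new bound = exact-none (λ {S} → none S)
    where
    none : ∀ S → ¬ Reg [] C (λ _ → ⊤) _ S
    none (s , ℓ) (reg val ab be _ q) = ℕ.<⇒≱ (hi _ _ q)
      (ℕ.≤-trans (ℕ.+-mono-≤ (ℕ.≤-reflexive (cong countTrue s≡C)) (countTrue-valid s ℓ val)) (subst (λ t → countTrue C ℕ.+ rank t ℕ.≤ n) (sym s≡C) bound))
      where
      s≡C : s ≡ C
      s≡C = lookup-ext (λ f → ≡true-ext (λ x → Sum.[ id , (λ ()) ] (be f x)) (ab f))
  exact-above (e ∷ U) C hi (e# ∷ uniq) new bound with bool-cases (conn C (src e) (tgt e))
  ... | inj₁ loop  = exact-loop (λ _ _ _ _ _ _ → tt) (All-∉ e#) (new (here refl)) loop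
  ... | inj₂ apart = exact-cone (λ _ _ _ _ _ _ → tt) (All-∉ e#) (new (here refl))
    (exact-above U C hi uniq (new ∘ there) bound)
    (exact-above U (add C e) hi uniq
      (λ { {f} i → trans (add-other C (λ { refl → All-∉ e# i })) (new (there i)) })
      (ℕ.≤-trans (ℕ.≤-reflexive (trans (cong (ℕ._+ rank (add C e)) (countTrue-set C e (new (here refl)))) (sym (ℕ.+-suc (countTrue C) _))))
        (ℕ.≤-trans (ℕ.+-monoʳ-≤ (countTrue C) (rank-merge C e apart)) bound)))

  ∅ : StateE
  ∅ = Vec.replicate m false

  ∅-∌ : ∀ e → ∅ ∌ e
  ∅-∌ e = lookup-replicate e false

  countTrue-∅ : countTrue ∅ ≡ 0
  countTrue-∅ = trans (countTrue-count ∅) (count-none (lookup ∅) ∅-∌)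

-- Multiplication by x on the component of the root

module Rooted (Γ : Graph) (root : Fin (Graph.n Γ)) (root-least : ∀ (v : Fin (Graph.n Γ)) → toℕ root ℕ.≤ toℕ v) where
  open Graph Γ
  open Chromatic Γ
  open Regions Γ public

  -- The root is the least vertex, so it represents its component in every state and the label of
  -- that component is always stored at `root`.
  Marked : Labelling → Set
  Marked ℓ = lookup ℓ root ≡ true

  isRep-root : ∀ s → isRep s root ≡ true
  isRep-root s = isRep⁺ (λ w _ → root-least w)

  rep-root : ∀ {s v} → Conn s v root → rep s v ≡ root
  rep-root {s} c = rep-unique (isRep-root s) c

  xlab-root : ∀ s ℓ → xlab (s , ℓ) root ≡ lookup ℓ root
  xlab-root s ℓ = cong (lookup ℓ) (rep-root {s} {root} conn-refl)

  Marked-closed : Closed Marked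
  Marked-closed s e ℓ val free x = trans (sym (xlab-root (add s e) (push (add s e) ℓ)))
    (xlab-preserved s e ℓ val free {root} (trans (xlab-root s ℓ) x))

  mark unmark : Labelling → Labelling
  mark   ℓ = ℓ [ root ]≔ true
  unmark ℓ = ℓ [ root ]≔ false

  Valid-mark : ∀ s ℓ b → Valid (s , ℓ) → Valid (s , ℓ [ root ]≔ b)
  Valid-mark s ℓ b val v h with v ≟ᶠ root
  ... | yes refl = isRep-root s
  ... | no ne    = val v (trans (sym (lookup-≔′ ℓ ne)) h)

  -- Multiplication by x at the root, and its partial inverse.
  up down : Img
  up   (s , ℓ) = if lookup ℓ root then [] else (1ℚ , (s , mark ℓ)) ∷ []
  down (s , ℓ) = if lookup ℓ root then (1ℚ , (s , unmark ℓ)) ∷ [] else []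

  ⟦⟧-up : ∀ h s ℓ → lookup ℓ root ≡ false → ⟦ up ⟧ h (s , ℓ) ≡ h (s , mark ℓ)
  ⟦⟧-up h s ℓ x = trans (cong (λ b → pairing (if b then [] else (1ℚ , (s , mark ℓ)) ∷ []) h) x)
    (trans (ℚ.+-identityʳ _) (ℚ.*-identityˡ _))

  ⟦⟧-up-marked : ∀ h s ℓ → Marked ℓ → ⟦ up ⟧ h (s , ℓ) ≡ 0ℚ
  ⟦⟧-up-marked h s ℓ x = cong (λ b → pairing (if b then [] else (1ℚ , (s , mark ℓ)) ∷ []) h) x

  ⟦⟧-down : ∀ h s ℓ → Marked ℓ → ⟦ down ⟧ h (s , ℓ) ≡ h (s , unmark ℓ)
  ⟦⟧-down h s ℓ x = trans (cong (λ b → pairing (if b then (1ℚ , (s , unmark ℓ)) ∷ [] else []) h) x)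
    (trans (ℚ.+-identityʳ _) (ℚ.*-identityˡ _))

  All-up : ∀ {R : State → Set} s ℓ → (lookup ℓ root ≡ false → R (s , mark ℓ)) → All (R ∘ proj₂) (up (s , ℓ))
  All-up s ℓ h with lookup ℓ root
  ... | true  = []
  ... | false = h refl ∷ []

  All-down : ∀ {R : State → Set} s ℓ → (Marked ℓ → R (s , unmark ℓ)) → All (R ∘ proj₂) (down (s , ℓ))
  All-down s ℓ h with lookup ℓ root
  ... | true  = h refl ∷ []
  ... | false = []

  up-down : ∀ {F} → Supp (λ S → Marked (proj₂ S)) F → extend up (extend down F) ≐ F
  up-down {F} p T = trans (extend-⨟ up down F T) (extend-≐id (down ⨟ up) (λ {S} → go S) p T)
    where
    go : ∀ S → Marked (proj₂ S) → ∀ h → ⟦ down ⨟ up ⟧ h S ≡ h S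
    go (s , ℓ) x h = begin
      ⟦ down ⨟ up ⟧ h (s , ℓ)           ≡⟨ ⟦⟧-⨟ down up h (s , ℓ) ⟩
      ⟦ down ⟧ (⟦ up ⟧ h) (s , ℓ)       ≡⟨ ⟦⟧-down (⟦ up ⟧ h) s ℓ x ⟩
      ⟦ up ⟧ h (s , unmark ℓ)           ≡⟨ ⟦⟧-up h s (unmark ℓ) (lookup-≔ ℓ root) ⟩
      h (s , mark (unmark ℓ))           ≡⟨ cong (λ κ → h (s , κ)) (trans ([]≔-idempotent ℓ root) (≔-same ℓ root x)) ⟩
      h (s , ℓ) ∎
      where open ≡-Reasoning

  down-up : ∀ {F} → Supp (λ S → lookup (proj₂ S) root ≡ false) F → extend down (extend up F) ≐ F
  down-up {F} p T = trans (extend-⨟ down up F T) (extend-≐id (up ⨟ down) (λ {S} → go S) p T)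
    where
    go : ∀ S → lookup (proj₂ S) root ≡ false → ∀ h → ⟦ up ⨟ down ⟧ h S ≡ h S
    go (s , ℓ) x h = begin
      ⟦ up ⨟ down ⟧ h (s , ℓ)           ≡⟨ ⟦⟧-⨟ up down h (s , ℓ) ⟩
      ⟦ up ⟧ (⟦ down ⟧ h) (s , ℓ)       ≡⟨ ⟦⟧-up (⟦ down ⟧ h) s ℓ x ⟩
      ⟦ down ⟧ h (s , mark ℓ)           ≡⟨ ⟦⟧-down h s (mark ℓ) (lookup-≔ ℓ root) ⟩
      h (s , unmark (mark ℓ))           ≡⟨ cong (λ κ → h (s , κ)) (trans ([]≔-idempotent ℓ root) (≔-same ℓ root x)) ⟩
      h (s , ℓ) ∎
      where open ≡-Reasoning

  up-marked : ∀ {F} → Supp (λ S → Marked (proj₂ S)) F → extend up F ≐ zeroC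
  up-marked = extend-≐0 up (λ { {s , ℓ} x h → ⟦⟧-up-marked h s ℓ x })

  -- On the unmarked part `down` inverts `up`, so an element of the kernel has no such part: the
  -- kernel of multiplication by x is its image.
  up-kernel : ∀ {F} → extend up F ≐ zeroC → Supp (λ S → Marked (proj₂ S)) F
  up-kernel {F} e = Supp-resp marked-part (Supp-mono proj₂ (Supp-cut marked {F} (λ S → inj₂ tt)))
    where
    marked : State → Bool
    marked S = lookup (proj₂ S) root
    F₁ = cut marked F
    F₀ = cut (not ∘ marked) F
    unmarked : Supp (λ S → lookup (proj₂ S) root ≡ false) F₀
    unmarked S with lookup (proj₂ S) root
    ... | true  = inj₁ refl
    ... | false = inj₂ refl
    F₀≐0 : F₀ ≐ zeroC
    F₀≐0 S = trans (sym (down-up unmarked S)) (extend-zero down up₀ S)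
      where
      up₀ : extend up F₀ ≐ zeroC
      up₀ T = begin
        extend up F₀ T                      ≡⟨ ℚ.+-identityˡ _ ⟨
        0ℚ + extend up F₀ T                 ≡⟨ cong (_+ extend up F₀ T) (up-marked (Supp-mono {P = λ S → ⊤ × marked S ≡ true} proj₂ (Supp-cut marked {F} (λ S → inj₂ tt))) T) ⟨
        extend up F₁ T + extend up F₀ T     ≡⟨ extend-⊕ up F₁ F₀ T ⟨
        extend up (F₁ ⊕ F₀) T               ≡⟨ extend-cong up (cut-split marked F) T ⟨
        extend up F T                       ≡⟨ e T ⟩
        0ℚ ∎
        where open ≡-Reasoning
    marked-part : F₁ ≐ F
    marked-part S = sym (trans (cut-split marked F S) (trans (cong (F₁ S +_) (F₀≐0 S)) (ℚ.+-identityʳ _)))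

  -- In ℚ[x]/(x² = 1) multiplication by x flips the label of a component.
  push-mark : ∀ s e ℓ → Valid (s , ℓ) → lookup ℓ root ≡ false →
              push (add s e) (mark ℓ) ≡ push (add s e) ℓ [ root ]≔ not (lookup (push (add s e) ℓ) root)
  push-mark s e ℓ val x = go (bool-cases (conn s (src e) (tgt e)))
    where
    flip : Labelling → Labelling
    flip κ = κ [ root ]≔ not (lookup κ root)
    go : Conn s (src e) (tgt e) ⊎ conn s (src e) (tgt e) ≡ false → push (add s e) (mark ℓ) ≡ flip (push (add s e) ℓ)
    go (inj₁ loop) = trans (push-loop s e (mark ℓ) loop (Valid-mark s ℓ true val))
      (trans (cong (λ b → ℓ [ root ]≔ not b) (sym x)) (cong flip (sym (push-loop s e ℓ loop val))))
    go (inj₂ apart) = trans (push-merge M (mark ℓ) (Valid-mark s ℓ true val))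
      (trans (move (p ≟ᶠ root)) (cong flip (sym (push-merge M ℓ val))))
      where
      M = merge s e apart
      open Merge M
      q≢root : q ≢ root
      q≢root eq = ℕ.<⇒≱ p<q (subst (λ v → toℕ v ℕ.≤ toℕ p) (sym eq) (root-least p))
      move : Dec (p ≡ root) → (mark ℓ [ q ]≔ false) [ p ]≔ (lookup (mark ℓ) p xor lookup (mark ℓ) q)
                              ≡ flip ((ℓ [ q ]≔ false) [ p ]≔ (lookup ℓ p xor lookup ℓ q))
      move (yes refl) = begin
        (mark ℓ [ q ]≔ false) [ p ]≔ (lookup (mark ℓ) p xor lookup (mark ℓ) q)
          ≡⟨ cong₂ (λ κ b → κ [ p ]≔ b) ([]≔-commutes ℓ p q p≢q) (cong₂ _xor_ (lookup-≔ ℓ p) (lookup-≔′ ℓ q≢root)) ⟩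
        ((ℓ [ q ]≔ false) [ p ]≔ true) [ p ]≔ not (lookup ℓ q)
          ≡⟨ []≔-idempotent (ℓ [ q ]≔ false) p ⟩
        (ℓ [ q ]≔ false) [ p ]≔ not (lookup ℓ q)
          ≡⟨ []≔-idempotent (ℓ [ q ]≔ false) p ⟨
        ((ℓ [ q ]≔ false) [ p ]≔ b) [ p ]≔ not (lookup ℓ q)
          ≡⟨ cong (λ c → ((ℓ [ q ]≔ false) [ p ]≔ b) [ p ]≔ not c)
               (trans (lookup-≔ (ℓ [ q ]≔ false) p) (cong (_xor lookup ℓ q) x)) ⟨
        flip ((ℓ [ q ]≔ false) [ p ]≔ b) ∎
        where
        open ≡-Reasoning
        b = lookup ℓ p xor lookup ℓ q
      move (no p≢root) = begin
        (mark ℓ [ q ]≔ false) [ p ]≔ (lookup (mark ℓ) p xor lookup (mark ℓ) q)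
          ≡⟨ cong₂ (λ κ b → κ [ p ]≔ b) ([]≔-commutes ℓ root q (q≢root ∘ sym)) (cong₂ _xor_ (lookup-≔′ ℓ p≢root) (lookup-≔′ ℓ q≢root)) ⟩
        ((ℓ [ q ]≔ false) [ root ]≔ true) [ p ]≔ b
          ≡⟨ []≔-commutes (ℓ [ q ]≔ false) root p (p≢root ∘ sym) ⟩
        ((ℓ [ q ]≔ false) [ p ]≔ b) [ root ]≔ true
          ≡⟨ cong (λ c → ((ℓ [ q ]≔ false) [ p ]≔ b) [ root ]≔ not c)
               (trans (lookup-≔′ (ℓ [ q ]≔ false) (p≢root ∘ sym)) (trans (lookup-≔′ ℓ (q≢root ∘ sym)) x)) ⟨
        flip ((ℓ [ q ]≔ false) [ p ]≔ b) ∎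
        where
        open ≡-Reasoning
        b = lookup ℓ p xor lookup ℓ q

  -- Cases on the label of the root before and after. A marked root stays marked and both sides
  -- vanish. If an unmarked root becomes marked, it has merged with an `x`, and a further `x` gives
  -- x·x = 0 on both sides. Otherwise marking commutes with merging, and comparing degrees shows
  -- that the two gates agree.
  up-∂ : ∀ e {F} → Supp Valid F → extend up (∂ e F) ≐ ∂ e (extend up F)
  up-∂ e = commute up (edge dGate e) (edge dGate e) up (λ { {s , ℓ} val h → go s ℓ val h (bool-cases (lookup ℓ root)) })
    where
    go : ∀ s ℓ → Valid (s , ℓ) → ∀ h → Marked ℓ ⊎ lookup ℓ root ≡ false →
         ⟦ edge dGate e ⟧ (⟦ up ⟧ h) (s , ℓ) ≡ ⟦ up ⟧ (⟦ edge dGate e ⟧ h) (s , ℓ)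
    go s ℓ val h (inj₁ x) = trans (trans (⟦⟧-edge dGate e (⟦ up ⟧ h) (s , ℓ)) (vanish (bool-cases (active dGate e (s , ℓ)))))
      (sym (⟦⟧-up-marked (⟦ edge dGate e ⟧ h) s ℓ x))
      where
      vanish : active dGate e (s , ℓ) ≡ true ⊎ active dGate e (s , ℓ) ≡ false →
               δ (active dGate e (s , ℓ)) (sgn s e * ⟦ up ⟧ h (grow (s , ℓ) e)) ≡ 0ℚ
      vanish (inj₂ off) = cong (λ b → δ b (sgn s e * ⟦ up ⟧ h (grow (s , ℓ) e))) off
      vanish (inj₁ on)  = trans (cong (λ y → δ (active dGate e (s , ℓ)) (sgn s e * y))
        (⟦⟧-up-marked h (add s e) (push (add s e) ℓ)
          (Marked-closed s e ℓ val (not-joins (s , ℓ) e (proj₂ (active⁻ dGate e (s , ℓ) on))) x)))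
        (trans (cong (δ (active dGate e (s , ℓ))) (ℚ.*-zeroʳ (sgn s e))) (δ-zero (active dGate e (s , ℓ))))
    go s ℓ val h (inj₂ x) = trans (⟦⟧-edge dGate e (⟦ up ⟧ h) (s , ℓ))
      (trans (compare (bool-cases (lookup κ root)))
      (trans (sym (⟦⟧-edge dGate e h (s , mark ℓ))) (sym (⟦⟧-up (⟦ edge dGate e ⟧ h) s ℓ x))))
      where
      κ = push (add s e) ℓ
      val' : Valid (s , mark ℓ)
      val' = Valid-mark s ℓ true val
      deg-mark : countTrue (mark ℓ) ≡ suc (countTrue ℓ)
      deg-mark = countTrue-set ℓ root x
      compare : Marked κ ⊎ lookup κ root ≡ false →
        δ (active dGate e (s , ℓ)) (sgn s e * ⟦ up ⟧ h (add s e , κ)) ≡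
        δ (active dGate e (s , mark ℓ)) (sgn s e * h (add s e , push (add s e) (mark ℓ)))
      compare (inj₂ y) = cong₂ (λ b z → δ b (sgn s e * z))
        (cong (λ b → not (lookup s e) ∧ not b) (≡true-ext
          (λ j → not-false (λ free → false⇒not-true (degree⇒¬joins s e ℓ val (ℕ.suc-injective (trans (sym deg-κ') (trans
            (degree-preserved s e (mark ℓ) val' free) deg-mark)))) j))
          (λ j → not-false (λ free → false⇒not-true (degree⇒¬joins s e (mark ℓ) val' (trans deg-κ' (trans
            (cong suc (degree-preserved s e ℓ val free)) (sym deg-mark)))) j))))
        (trans (⟦⟧-up h (add s e) κ y) (cong (λ λ' → h (add s e , λ')) (sym κ')))
        where
        not-false : ∀ {b} → (b ≡ false → ⊥) → b ≡ true
        not-false {true}  _ = refl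
        not-false {false} f = ⊥-elim (f refl)
        κ' : push (add s e) (mark ℓ) ≡ mark κ
        κ' = trans (push-mark s e ℓ val x) (cong (λ b → κ [ root ]≔ not b) y)
        deg-κ' : countTrue (push (add s e) (mark ℓ)) ≡ suc (countTrue κ)
        deg-κ' = trans (cong countTrue κ') (countTrue-set κ root y)
      compare (inj₁ y) = trans
        (trans (cong (λ z → δ (active dGate e (s , ℓ)) (sgn s e * z)) (⟦⟧-up-marked h (add s e) κ y))
          (trans (cong (δ (active dGate e (s , ℓ))) (ℚ.*-zeroʳ (sgn s e))) (δ-zero (active dGate e (s , ℓ)))))
        (sym (cong (λ b → δ b (sgn s e * h (add s e , push (add s e) (mark ℓ))))
          (trans (cong (λ b → not (lookup s e) ∧ not b) joins) (∧-zeroʳ _))))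
        where
        κ' : push (add s e) (mark ℓ) ≡ unmark κ
        κ' = trans (push-mark s e ℓ val x) (cong (λ b → κ [ root ]≔ not b) y)
        -- With x² = 1 the extra `x` flips the root label back to 1. The resulting loss of degree
        -- betrays a product x·x.
        drop : countTrue (push (add s e) (mark ℓ)) ℕ.< countTrue (mark ℓ)
        drop = ℕ.≤-trans (ℕ.≤-reflexive (trans (cong (suc ∘ countTrue) κ') (countTrue-unset κ root y)))
          (ℕ.≤-trans (degree-≤ s e ℓ val) (ℕ.≤-trans (ℕ.n≤1+n _) (ℕ.≤-reflexive (sym deg-mark))))
        joins : joinsXX (s , mark ℓ) e ≡ true
        joins with bool-cases (joinsXX (s , mark ℓ) e)
        ... | inj₁ j    = j
        ... | inj₂ free = ⊥-elim (ℕ.<-irrefl (degree-preserved s e (mark ℓ) val' free) drop)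

  up-∂s : ∀ U {F} → Supp Valid F → extend up (∂s U F) ≐ ∂s U (extend up F)
  up-∂s []      {F} v T = trans (extend-zero up (edges-[] dGate F) T) (sym (edges-[] dGate (extend up F) T))
  up-∂s (e ∷ U) {F} v T = begin
    extend up (∂s (e ∷ U) F) T                     ≡⟨ extend-cong up (edges-∷ dGate e U F) T ⟩
    extend up (∂ e F ⊕ ∂s U F) T                   ≡⟨ extend-⊕ up (∂ e F) (∂s U F) T ⟩
    extend up (∂ e F) T + extend up (∂s U F) T     ≡⟨ cong₂ _+_ (up-∂ e v T) (up-∂s U v T) ⟩
    ∂ e (extend up F) T + ∂s U (extend up F) T     ≡⟨ edges-∷ dGate e U (extend up F) T ⟨
    ∂s (e ∷ U) (extend up F) T ∎
    where open ≡-Reasoning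

-- Kernel of the merging map for a bridge at the root

module Bridges (Γ : Graph) (root : Fin (Graph.n Γ)) (root-least : ∀ (v : Fin (Graph.n Γ)) → toℕ root ℕ.≤ toℕ v) where
  open Graph Γ
  open Chromatic Γ
  open Rooted Γ root root-least public

  -- The vertex `b` lies across `e` from the root. The hypothesis `bridge` says that the contracted
  -- and remaining free edges never connect it to the root, so in every state of the deletion `e`
  -- joins the root component to that of `b`.
  module Bridge {U : List (Fin m)} {C : StateE} {e : Fin m} (e∉U : e ∉ U) (C∌e : C ∌ e) (b : Fin n)
                (joined : Conn (add C e) root b)
                (bridge : ∀ s → (∀ f → s ∋ f → C ∋ f ⊎ f ∈ U) → ¬ Conn s root b) where

    Between : StateE → Set
    Between s = C ⊆ s × (∀ f → s ∋ f → C ∋ f ⊎ f ∈ U)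

    add-mono : ∀ s → C ⊆ s → add C e ⊆ add s e
    add-mono s ab f x with add⁻ C e f x
    ... | inj₁ y    = add-⊇ s e f (ab f y)
    ... | inj₂ refl = add-∋ s e

    module At s (btw : Between s) where
      q : Fin n
      q = rep s b

      apart : conn s (src e) (tgt e) ≡ false
      apart = not-true⇒false λ loop → bridge s (proj₂ btw)
        (conn-loop s e loop (conn-mono (add-mono s (proj₁ btw)) joined))

      M : Merge s e
      M = merge s e apart

      ends≡ : Merge.p M ≡ root × Merge.q M ≡ q
      ends≡ with Merge.split M (conn-mono (add-mono s (proj₁ btw)) joined)
      ... | inj₁ x              = ⊥-elim (bridge s (proj₂ btw) x)
      ... | inj₂ (inj₁ (x , y)) = sym (isRep-unique (isRep-root s) (Merge.rep-p M) x) , sym (rep-unique (Merge.rep-q M) (conn-sym y))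
      ... | inj₂ (inj₂ (x , y)) = ⊥-elim (ℕ.<⇒≱ (Merge.p<q M)
            (subst (λ v → toℕ v ℕ.≤ toℕ (Merge.p M)) (isRep-unique (isRep-root s) (Merge.rep-q M) x) (root-least (Merge.p M))))

      joins-bridge : ∀ ℓ → joinsXX (s , ℓ) e ≡ lookup ℓ root ∧ lookup ℓ q
      joins-bridge ℓ = trans (Merge.joins M ℓ) (cong₂ (λ v w → lookup ℓ v ∧ lookup ℓ w) (proj₁ ends≡) (proj₂ ends≡))

      push-bridge : ∀ ℓ → Valid (s , ℓ) → push (add s e) ℓ ≡ (ℓ [ q ]≔ false) [ root ]≔ (lookup ℓ root xor lookup ℓ q)
      push-bridge ℓ val = trans (push-merge M ℓ val)
        (cong₂ (λ v w → (ℓ [ w ]≔ false) [ v ]≔ (lookup ℓ v xor lookup ℓ w)) (proj₁ ends≡) (proj₂ ends≡))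

      q≢root : q ≢ root
      q≢root eq = bridge s (proj₂ btw) (conn-sym (subst (Conn s b) eq (conn-rep {s} {b})))

      ¬isRep-q : isRep (add s e) q ≡ false
      ¬isRep-q = subst (λ v → isRep (add s e) v ≡ false) (proj₂ ends≡) (Merge.¬isRep-q M)

    -- States in which both sides of the bridge e carry the label x.
    xx : State → Bool
    xx S = xlab S b

    XX : State → Set
    XX S = Reg U C Marked (λ _ _ → ⊤) S × xx S ≡ true

    between : ∀ {K Q S} → Reg U C K Q S → Between (proj₁ S)
    between r = Reg.above r , Reg.below r

    ∂-XX : ∀ {F} → Supp XX F → ∂ e F ≐ zeroC
    ∂-XX = extend-≐0 (edge dGate e) λ { {s , ℓ} (r , x) h → ⟦⟧-edge-off dGate e h (s , ℓ)
      (cong not (trans (At.joins-bridge s (between r) ℓ) (∧-true⁺ (Reg.label r) x))) }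

    -- The root carries `x`. Merging it with a label 1 leaves the vector of labels unchanged, so
    -- `∂ e` is injective on those states, while states with `x` on both sides are sent to zero.
    -- Hence the kernel consists of the latter.
    kernel : ∀ {Q F} → Supp (Reg U C Marked Q) F → ∂ e F ≐ zeroC → Supp (λ S → Reg U C Marked Q S × xx S ≡ true) F
    kernel {Q} {F} supp kill = Supp-resp F₁≐F (Supp-cut xx supp)
      where
      F₁ = cut xx F
      F₀ = cut (not ∘ xx) F
      ∂F₀ : ∂ e F₀ ≐ zeroC
      ∂F₀ T = begin
        ∂ e F₀ T              ≡⟨ ℚ.+-identityˡ _ ⟨
        0ℚ + ∂ e F₀ T         ≡⟨ cong (_+ ∂ e F₀ T) (∂-XX (Supp-mono (λ { (r , x) → record { Reg r ; degree = tt } , x }) (Supp-cut xx supp)) T) ⟨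
        ∂ e F₁ T + ∂ e F₀ T   ≡⟨ extend-⊕ (edge dGate e) F₁ F₀ T ⟨
        ∂ e (F₁ ⊕ F₀) T       ≡⟨ extend-cong (edge dGate e) (cut-split xx F) T ⟨
        ∂ e F T               ≡⟨ kill T ⟩
        0ℚ ∎
        where open ≡-Reasoning
      fixed : ∀ S → Reg U C Marked Q S × not (xx S) ≡ true →
              proj₁ S ∌ e × joinsXX S e ≡ false × push (add (proj₁ S) e) (proj₂ S) ≡ proj₂ S
      fixed (s , ℓ) (r , x) = Reg-∌ e∉U C∌e r
        , trans (joins-bridge ℓ) (trans (cong (lookup ℓ root ∧_) xq) (∧-zeroʳ _))
        , trans (push-bridge ℓ (Reg.valid r)) (trans (cong (λ κ → κ [ root ]≔ (lookup ℓ root xor lookup ℓ q)) (≔-same ℓ q xq))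
            (≔-same ℓ root (trans (Reg.label r) (sym (cong₂ _xor_ (Reg.label r) xq)))))
        where
        open At s (between r)
        xq : lookup ℓ q ≡ false
        xq with lookup ℓ q
        ... | false = refl
      F₀≐0 : F₀ ≐ zeroC
      F₀≐0 S = trans (sym (retract-∂ e (Supp-mono (λ {S} → fixed S) (Supp-cut (not ∘ xx) supp)) S)) (extend-zero (retract e) ∂F₀ S)
      F₁≐F : F₁ ≐ F
      F₁≐F S = sym (trans (cut-split xx F S) (trans (cong (F₁ S +_) (F₀≐0 S)) (ℚ.+-identityʳ _)))

    -- Dividing by x at the root and then merging along the bridge identifies
    -- the cochains supported on XX with the marked cochains of the contraction.
    Θ : Cochain → Cochain
    Θ F = ∂ e (extend down F)

    split : Img
    split (t , κ) = if lookup t e then (sgn (remove t e) e , (remove t e , κ [ rep (remove t e) b ]≔ true)) ∷ [] else []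

    ⟦⟧-split : ∀ h t κ → t ∋ e → ⟦ split ⟧ h (t , κ) ≡ sgn (remove t e) e * h (remove t e , κ [ rep (remove t e) b ]≔ true)
    ⟦⟧-split h t κ i = trans (cong (λ c → pairing (if c then (sgn (remove t e) e , (remove t e , κ [ rep (remove t e) b ]≔ true)) ∷ [] else []) h) i)
      (ℚ.+-identityʳ _)

    All-split : ∀ {R : State → Set} t κ → (t ∋ e → R (remove t e , κ [ rep (remove t e) b ]≔ true)) → All (R ∘ proj₂) (split (t , κ))
    All-split t κ h with lookup t e
    ... | true  = h refl ∷ []
    ... | false = []

    between-remove : ∀ {K Q t κ} → Reg U (add C e) K Q (t , κ) → Between (remove t e)
    between-remove {t = t} r = above , (λ f x → below f x (f ≟ᶠ e))
      where
      above : C ⊆ remove t e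
      above f x = trans (remove-other t (λ { refl → false⇒not-true C∌e x })) (Reg.above r f (add-⊇ C e f x))
      below : ∀ f → remove t e ∋ f → Dec (f ≡ e) → C ∋ f ⊎ f ∈ U
      below f x (yes refl) = ⊥-elim (false⇒not-true (remove-∌ t e) x)
      below f x (no ne) with Reg.below r f (trans (sym (remove-other t ne)) x)
      ... | inj₂ y = inj₂ y
      ... | inj₁ y with add⁻ C e f y
      ... | inj₁ z = inj₁ z
      ... | inj₂ z = ⊥-elim (ne z)

    Valid-set : ∀ s ℓ → Valid (s , ℓ) → Valid (s , ℓ [ rep s b ]≔ true)
    Valid-set s ℓ val v h with v ≟ᶠ rep s b
    ... | yes refl = isRep-rep {s} {b}
    ... | no ne    = val v (trans (sym (lookup-≔′ ℓ ne)) h)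

    module _ {Q} {t κ} (r : Reg U (add C e) Marked Q (t , κ)) where
      private
        s = remove t e
        κ₁ = κ [ rep s b ]≔ true
      open At (remove t e) (between-remove r)

      ∋e : t ∋ e
      ∋e = Reg-∋ r

      κ-q : lookup κ q ≡ false
      κ-q = ¬isRep⇒false t κ (Reg.valid r) (subst (λ t' → isRep t' q ≡ false) (add-remove t e ∋e) ¬isRep-q)

      Reg-split : XX (s , κ₁)
      Reg-split = reg (Valid-set s κ (Valid-remove e t κ ∋e (Reg.valid r))) (proj₁ (between-remove r)) (proj₂ (between-remove r))
        (trans (lookup-≔′ κ (q≢root ∘ sym)) (Reg.label r)) tt , lookup-≔ κ q

      Θ-split-basis : ∀ h → ⟦ split ⟧ (⟦ down ⟧ (⟦ edge dGate e ⟧ h)) (t , κ) ≡ h (t , κ)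
      Θ-split-basis h = begin
        ⟦ split ⟧ (⟦ down ⟧ (⟦ edge dGate e ⟧ h)) (t , κ)
          ≡⟨ ⟦⟧-split (⟦ down ⟧ (⟦ edge dGate e ⟧ h)) t κ ∋e ⟩
        sgn s e * ⟦ down ⟧ (⟦ edge dGate e ⟧ h) (s , κ₁)
          ≡⟨ cong (sgn s e *_) (⟦⟧-down (⟦ edge dGate e ⟧ h) s κ₁ (Reg.label (proj₁ Reg-split))) ⟩
        sgn s e * ⟦ edge dGate e ⟧ h (s , unmark κ₁)
          ≡⟨ cong (sgn s e *_) (⟦⟧-edge-on dGate e h (s , unmark κ₁) (remove-∌ t e)
               (cong not (trans (joins-bridge (unmark κ₁)) (cong (_∧ lookup (unmark κ₁) q) (lookup-≔ κ₁ root))))) ⟩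
        sgn s e * (sgn s e * h (add s e , push (add s e) (unmark κ₁)))
          ≡⟨ sgn-sgn s e _ ⟩
        h (add s e , push (add s e) (unmark κ₁))
          ≡⟨ cong₂ (λ u λ' → h (u , λ')) (add-remove t e ∋e) restored ⟩
        h (t , κ) ∎
        where
        open ≡-Reasoning
        restored : push (add s e) (unmark κ₁) ≡ κ
        restored = trans (push-bridge (unmark κ₁) (Valid-mark s κ₁ false (Reg.valid (proj₁ Reg-split)))) (lookup-ext same)
          where
          same : ∀ v → lookup ((unmark κ₁ [ q ]≔ false) [ root ]≔ (lookup (unmark κ₁) root xor lookup (unmark κ₁) q)) v ≡ lookup κ v
          same v with v ≟ᶠ root
          ... | yes refl = trans (lookup-≔ (unmark κ₁ [ q ]≔ false) root) (trans
                (cong₂ _xor_ (lookup-≔ κ₁ root) (trans (lookup-≔′ κ₁ q≢root) (lookup-≔ κ q))) (sym (Reg.label r)))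
          ... | no nr with v ≟ᶠ q
          ... | yes refl = trans (lookup-≔′ (unmark κ₁ [ q ]≔ false) nr) (trans (lookup-≔ (unmark κ₁) q) (sym κ-q))
          ... | no nq    = trans (lookup-≔′ (unmark κ₁ [ q ]≔ false) nr) (trans (lookup-≔′ (unmark κ₁) nq)
                (trans (lookup-≔′ κ₁ nr) (lookup-≔′ κ nq)))

    Θ-split : ∀ {Q H} → Supp (Reg U (add C e) Marked Q) H → Θ (extend split H) ≐ H
    Θ-split {Q} {H} supp T = trans (extend-cong (edge dGate e) (extend-⨟ down split H) T)
      (trans (extend-⨟ (edge dGate e) (split ⨟ down) H T)
      (extend-≐id ((split ⨟ down) ⨟ edge dGate e) (λ { {S} r h → trans (⟦⟧-⨟ (split ⨟ down) (edge dGate e) h S)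
        (trans (⟦⟧-⨟ split down (⟦ edge dGate e ⟧ h) S) (Θ-split-basis r h)) }) supp T))

    split-Θ-basis : ∀ s ℓ → XX (s , ℓ) → ∀ h → ⟦ down ⟧ (⟦ edge dGate e ⟧ (⟦ split ⟧ h)) (s , ℓ) ≡ h (s , ℓ)
    split-Θ-basis s ℓ (r , x) h = begin
      ⟦ down ⟧ (⟦ edge dGate e ⟧ (⟦ split ⟧ h)) (s , ℓ)
        ≡⟨ ⟦⟧-down (⟦ edge dGate e ⟧ (⟦ split ⟧ h)) s ℓ (Reg.label r) ⟩
      ⟦ edge dGate e ⟧ (⟦ split ⟧ h) (s , unmark ℓ)
        ≡⟨ ⟦⟧-edge-on dGate e (⟦ split ⟧ h) (s , unmark ℓ) ∌e
             (cong not (trans (joins-bridge (unmark ℓ)) (cong (_∧ lookup (unmark ℓ) q) (lookup-≔ ℓ root)))) ⟩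
      sgn s e * ⟦ split ⟧ h (add s e , κ)
        ≡⟨ cong (sgn s e *_) (⟦⟧-split h (add s e) κ (add-∋ s e)) ⟩
      sgn s e * (sgn (remove (add s e) e) e * h (remove (add s e) e , κ [ rep (remove (add s e) e) b ]≔ true))
        ≡⟨ cong (λ s' → sgn s e * (sgn s' e * h (s' , κ [ rep s' b ]≔ true))) (remove-add s e ∌e) ⟩
      sgn s e * (sgn s e * h (s , κ [ q ]≔ true))
        ≡⟨ sgn-sgn s e _ ⟩
      h (s , κ [ q ]≔ true)
        ≡⟨ cong (λ λ' → h (s , λ')) (trans (cong (_[ q ]≔ true) (push-bridge (unmark ℓ) (Valid-mark s ℓ false (Reg.valid r)))) (lookup-ext same)) ⟩
      h (s , ℓ) ∎
      where
      open ≡-Reasoning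
      open At s (between r)
      κ = push (add s e) (unmark ℓ)
      ∌e : s ∌ e
      ∌e = Reg-∌ e∉U C∌e r
      c = lookup (unmark ℓ) root xor lookup (unmark ℓ) q
      same : ∀ v → lookup (((unmark ℓ [ q ]≔ false) [ root ]≔ c) [ q ]≔ true) v ≡ lookup ℓ v
      same v with v ≟ᶠ q
      ... | yes refl = trans (lookup-≔ ((unmark ℓ [ q ]≔ false) [ root ]≔ c) q) (sym x)
      ... | no nq with v ≟ᶠ root
      ... | yes refl = trans (lookup-≔′ ((unmark ℓ [ q ]≔ false) [ root ]≔ c) nq) (trans (lookup-≔ (unmark ℓ [ q ]≔ false) root)
            (trans (cong₂ _xor_ (lookup-≔ ℓ root) (trans (lookup-≔′ ℓ q≢root) x)) (sym (Reg.label r))))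
      ... | no nr    = trans (lookup-≔′ ((unmark ℓ [ q ]≔ false) [ root ]≔ c) nq) (trans (lookup-≔′ (unmark ℓ [ q ]≔ false) nr)
            (trans (lookup-≔′ (unmark ℓ) nq) (lookup-≔′ ℓ nr)))

    split-Θ : ∀ {F} → Supp XX F → extend split (Θ F) ≐ F
    split-Θ {F} supp T = trans (extend-cong split (extend-⨟ (edge dGate e) down F) T)
      (trans (extend-⨟ split (down ⨟ edge dGate e) F T)
      (extend-≐id ((down ⨟ edge dGate e) ⨟ split) (λ { {s , ℓ} p h → trans (⟦⟧-⨟ (down ⨟ edge dGate e) split h (s , ℓ))
        (trans (⟦⟧-⨟ down (edge dGate e) (⟦ split ⟧ h) (s , ℓ)) (split-Θ-basis s ℓ p h)) }) supp T))

    XXₗ : (Labelling → Set) → State → Set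
    XXₗ K S = Reg U C K (λ _ _ → ⊤) S × xx S ≡ true

    Supp-∂s-XX : ∀ {K F} → Closed K → Supp (XXₗ K) F → Supp (XXₗ K) (∂s U F)
    Supp-∂s-XX closed = Supp-edges dGate U (λ { (s , ℓ) f i (r , x) ne ge → Reg-grow closed (s , ℓ) f i r ne ge
      , xlab-preserved s f ℓ (Reg.valid r) (not-joins (s , ℓ) f ge) {b} x })

    Supp-down-XX : ∀ {F} → Supp XX F → Supp (XXₗ (λ _ → ⊤)) (extend down F)
    Supp-down-XX = Supp-extend down (λ { {s , ℓ} (r , x) → All-down s ℓ (λ _ →
      reg (Valid-mark s ℓ false (Reg.valid r)) (Reg.above r) (Reg.below r) tt tt
      , trans (lookup-≔′ ℓ (At.q≢root s (between r))) x) })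

    -- `down` commutes with `∂s U` only up to an error `W`. As `up` is a chain map and inverts
    -- `down`, it kills `W`, so `W` is marked. The side of `b` still carries `x` there, and `∂ e`
    -- kills `W` because x·x = 0.
    Θ-∂s : ∀ {F} → Supp XX F → ∂s U (Θ F) ≐ neg (Θ (∂s U F))
    Θ-∂s {F} supp T = begin
      ∂s U (∂ e Y) T                          ≡⟨ solve 1 (λ x → x := :- (:- x)) refl (∂s U (∂ e Y) T) ⟩
      - (- ∂s U (∂ e Y) T)                    ≡⟨ cong -_ (∂-∂s e U (Supp-mono (Reg.valid ∘ proj₁) suppY) T) ⟨
      - ∂ e (∂s U Y) T                        ≡⟨ cong -_ (⊖-zero⇒≐ {∂ e (∂s U Y)} {Θ (∂s U F)} difference T) ⟩
      - Θ (∂s U F) T ∎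
      where
      open ≡-Reasoning
      Y = extend down F
      W = ∂s U Y ⊖ extend down (∂s U F)
      suppY : Supp (XXₗ (λ _ → ⊤)) Y
      suppY = Supp-down-XX supp
      supp∂F : Supp XX (∂s U F)
      supp∂F = Supp-∂s-XX Marked-closed supp
      upW : extend up W ≐ zeroC
      upW S = begin
        extend up W S
          ≡⟨ extend-⊖ up (∂s U Y) (extend down (∂s U F)) S ⟩
        extend up (∂s U Y) S - extend up (extend down (∂s U F)) S
          ≡⟨ cong₂ _-_ (up-∂s U (Supp-mono (Reg.valid ∘ proj₁) suppY) S) (up-down (Supp-mono (Reg.label ∘ proj₁) supp∂F) S) ⟩
        ∂s U (extend up Y) S - ∂s U F S
          ≡⟨ cong (_- ∂s U F S) (extend-cong (edges dGate U) (up-down (Supp-mono (Reg.label ∘ proj₁) supp)) S) ⟩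
        ∂s U F S - ∂s U F S
          ≡⟨ ℚ.+-inverseʳ (∂s U F S) ⟩
        0ℚ ∎
      suppW : Supp XX W
      suppW = Supp-mono (λ { ((r , x) , y) → record { Reg r ; label = y } , x })
        (Supp-∩ (Supp-⊖ (Supp-∂s-XX (λ _ _ _ _ _ _ → tt) suppY) (Supp-down-XX supp∂F)) (up-kernel {W} upW))
      difference : (∂ e (∂s U Y) ⊖ Θ (∂s U F)) ≐ zeroC
      difference S = trans (sym (extend-⊖ (edge dGate e) (∂s U Y) (extend down (∂s U F)) S)) (∂-XX suppW S)

    -- `Θ` adds one edge and removes one `x`: the sum i + j is unchanged, so a bound on it passes to
    -- the contraction.
    shift : (ℕ → ℕ → Set) → ℕ → ℕ → Set
    shift Q i j = ∃ λ i' → i ≡ suc i' × Q i' (suc j)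

    Supp-Θ : ∀ {Q F} → Supp (λ S → Reg U C Marked Q S × xx S ≡ true) F → Supp (Reg U (add C e) Marked (shift Q)) (Θ F)
    Supp-Θ {Q} {F} supp = Supp-mono (λ { {S} (r , x) → record { Reg r ; label = x } }) (Supp-∩
      (Supp-edge {R = Reg U (add C e) (λ _ → ⊤) (shift Q)} dGate e (λ S r ne ge → Reg-contract {λ _ → ⊤} (λ _ _ _ _ _ _ → tt) {Q = shift Q} S e (proj₁ r) ne ge) lowered)
      (Supp-edge {R = Marked ∘ proj₂} dGate e (λ S r _ _ → marked S r) lowered))
      where
      Lowered : State → Set
      Lowered S = Reg U C (λ _ → ⊤) (↓ shift Q) S × lookup (proj₂ S) root ≡ false × xx S ≡ true
      lowered : Supp Lowered (extend down F)
      lowered = Supp-extend down (λ { {s , ℓ} (r , x) → All-down s ℓ (λ y →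
        reg (Valid-mark s ℓ false (Reg.valid r)) (Reg.above r) (Reg.below r) tt
          (countTrue s , refl , subst (Q (countTrue s)) (sym (countTrue-unset ℓ root y)) (Reg.degree r))
        , lookup-≔ ℓ root , trans (lookup-≔′ ℓ (At.q≢root s (between r))) x) }) supp
      marked : ∀ S → Lowered S → Marked (proj₂ (grow S e))
      marked (s , ℓ) (r , y , z) = trans (cong (λ κ → lookup κ root) (At.push-bridge s (between r) ℓ (Reg.valid r)))
        (trans (lookup-≔ (ℓ [ rep s b ]≔ false) root) (cong₂ _xor_ y z))

    -- `Θ` and `split` identify the kernel with the contraction, where a primitive `H` of `Θ F`
    -- exists by assumption. It is carried back as `G`; the sign appears because `Θ` anticommutes
    -- with the differential, and `∂ e` kills `G` as both sides of `e` carry `x`.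
    bridge-solve : ∀ {Q} → Exact U (add C e) Marked (shift Q) →
                   ∀ F → Supp (Reg U C Marked Q) F → ∂s U F ≐ zeroC → ∂ e F ≐ zeroC →
                   ∃ λ G → Supp (Reg (e ∷ U) C Marked (↓ Q)) G × ∂s (e ∷ U) G ≐ F
    bridge-solve {Q} exact F supp cocycle kill =
      neg G , Supp-neg (Supp-mono (Reg-∷ ∘ proj₁) suppG) , λ S → begin
      ∂s (e ∷ U) (neg G) S          ≡⟨ extend-neg (edges dGate (e ∷ U)) G S ⟩
      - ∂s (e ∷ U) G S              ≡⟨ cong -_ (edges-∷ dGate e U G S) ⟩
      - (∂ e G S + ∂s U G S)        ≡⟨ cong₂ (λ x y → - (x + y)) (∂-XX (Supp-mono forget suppG) S) (∂G S) ⟩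
      - (0ℚ + - F S)                ≡⟨ solve 1 (λ x → :- (con 0ℚ :+ :- x) := x) refl (F S) ⟩
      F S ∎
      where
      open ≡-Reasoning
      forget : ∀ {Q S} → Reg U C Marked Q S × xx S ≡ true → XX S
      forget (r , x) = record { Reg r ; degree = tt } , x
      suppF : Supp (λ S → Reg U C Marked Q S × xx S ≡ true) F
      suppF = kernel supp kill
      suppXX : Supp XX F
      suppXX = Supp-mono forget suppF
      ∂Θ : ∂s U (Θ F) ≐ zeroC
      ∂Θ S = trans (Θ-∂s suppXX S) (cong -_ (extend-zero (edge dGate e) (extend-zero down cocycle) S))
      solution = exact (Θ F) (Supp-Θ suppF) ∂Θ
      H = proj₁ solution
      suppH = proj₁ (proj₂ solution)
      G = extend split H
      suppG : Supp (λ S → Reg U C Marked (↓ Q) S × xx S ≡ true) G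
      suppG = Supp-extend split (λ { {t , κ} r → All-split t κ (λ i → at t κ r) }) suppH
        where
        lower : ∀ {i j} → shift Q (suc i) j → Q i (suc j)
        lower (i' , refl , x) = x
        at : ∀ t κ → Reg U (add C e) Marked (↓ shift Q) (t , κ) →
             Reg U C Marked (↓ Q) (remove t e , κ [ rep (remove t e) b ]≔ true) × xx (remove t e , κ [ rep (remove t e) b ]≔ true) ≡ true
        at t κ r = record { Reg (proj₁ (Reg-split r)) ; degree =
            subst₂ Q (sym (countTrue-unset t e (∋e r))) (sym (countTrue-set κ (rep (remove t e) b) (κ-q r))) (lower (Reg.degree r)) }
          , proj₂ (Reg-split r)
      ΘG : Θ G ≐ H
      ΘG = Θ-split suppH
      ∂G : ∂s U G ≐ neg F
      ∂G S = begin
        ∂s U G S                        ≡⟨ split-Θ (Supp-∂s-XX Marked-closed (Supp-mono forget suppG)) S ⟨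
        extend split (Θ (∂s U G)) S     ≡⟨ extend-cong split opposite S ⟩
        extend split (neg (Θ F)) S      ≡⟨ extend-neg split (Θ F) S ⟩
        - extend split (Θ F) S          ≡⟨ cong -_ (split-Θ suppXX S) ⟩
        - F S ∎
        where
        opposite : Θ (∂s U G) ≐ neg (Θ F)
        opposite T = begin
          Θ (∂s U G) T          ≡⟨ solve 1 (λ x → x := :- (:- x)) refl (Θ (∂s U G) T) ⟩
          - (- Θ (∂s U G) T)    ≡⟨ cong -_ (Θ-∂s (Supp-mono forget suppG) T) ⟨
          - ∂s U (Θ G) T        ≡⟨ cong -_ (extend-cong (edges dGate U) ΘG T) ⟩
          - ∂s U H T            ≡⟨ cong -_ (proj₂ (proj₂ solution) T) ⟩
          - Θ F T ∎

-- Vanishing below the strip by growing a tree from the root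

module Vanishing (Γ : Graph) (root : Fin (Graph.n Γ)) (root-least : ∀ (v : Fin (Graph.n Γ)) → toℕ root ℕ.≤ toℕ v) where
  open Graph Γ
  open Chromatic Γ
  open Bridges Γ root root-least public

  -- Signs come from the order of `Fin m` and not from the list, so the free edges may be rearranged
  -- to bring a chosen one to the front.
  ∂s-↭ : ∀ {U V} → U ↭ V → ∀ F → ∂s U F ≐ ∂s V F
  ∂s-↭ Perm.refl F T = refl
  ∂s-↭ (Perm.prep {U} {V} e p) F T = trans (edges-∷ dGate e U F T)
    (trans (cong (∂ e F T +_) (∂s-↭ p F T)) (sym (edges-∷ dGate e V F T)))
  ∂s-↭ (Perm.swap {U} {V} e f p) F T = begin
    ∂s (e ∷ f ∷ U) F T                ≡⟨ edges-∷ dGate e (f ∷ U) F T ⟩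
    ∂ e F T + ∂s (f ∷ U) F T          ≡⟨ cong (∂ e F T +_) (edges-∷ dGate f U F T) ⟩
    ∂ e F T + (∂ f F T + ∂s U F T)    ≡⟨ cong (λ x → ∂ e F T + (∂ f F T + x)) (∂s-↭ p F T) ⟩
    ∂ e F T + (∂ f F T + ∂s V F T)    ≡⟨ solve 3 (λ a b c → a :+ (b :+ c) := b :+ (a :+ c)) refl (∂ e F T) (∂ f F T) (∂s V F T) ⟩
    ∂ f F T + (∂ e F T + ∂s V F T)    ≡⟨ cong (∂ f F T +_) (edges-∷ dGate e V F T) ⟨
    ∂ f F T + ∂s (e ∷ V) F T          ≡⟨ edges-∷ dGate f (e ∷ V) F T ⟨
    ∂s (f ∷ e ∷ V) F T ∎
    where open ≡-Reasoning
  ∂s-↭ (Perm.trans p q) F T = trans (∂s-↭ p F T) (∂s-↭ q F T)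

  Exact-↭ : ∀ {U V C K Q} → U ↭ V → Exact V C K Q → Exact U C K Q
  Exact-↭ {U} {V} {C} {K} p exact F supp cocycle =
    let G , suppG , eq = exact F (Supp-mono (along p) supp) (λ S → trans (sym (∂s-↭ p F S)) (cocycle S)) in
    G , Supp-mono (along (↭-sym p)) suppG , λ S → trans (∂s-↭ p G S) (eq S)
    where
    along : ∀ {U V Q S} → U ↭ V → Reg U C K Q S → Reg V C K Q S
    along p r = record { Reg r ; below = λ f x → Sum.map₂ (∈-resp-↭ p) (Reg.below r f x) }

  union : StateE → List (Fin m) → StateE
  union C []      = C
  union C (e ∷ U) = add (union C U) e

  union⁻ : ∀ C U f → union C U ∋ f → C ∋ f ⊎ f ∈ U
  union⁻ C []      f x = inj₁ x
  union⁻ C (e ∷ U) f x with add⁻ (union C U) e f x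
  ... | inj₁ y = Sum.map₂ there (union⁻ C U f y)
  ... | inj₂ y = inj₂ (here y)

  union⁺ : ∀ C U f → C ∋ f ⊎ f ∈ U → union C U ∋ f
  union⁺ C []      f (inj₁ x)           = x
  union⁺ C (e ∷ U) f (inj₁ x)           = add-⊇ (union C U) e f (union⁺ C U f (inj₁ x))
  union⁺ C (e ∷ U) f (inj₂ (here refl)) = add-∋ (union C U) e
  union⁺ C (e ∷ U) f (inj₂ (there i))   = add-⊇ (union C U) e f (union⁺ C U f (inj₂ i))

  Within : StateE → List (Fin m) → Fin m → Set
  Within C U f = C ∋ f ⊎ f ∈ U

  -- Exactly one end of `e` lies in the root component of `C`; `outer` is the other end. The fields
  -- hide the direction of `e`.
  record Crossing (C : StateE) (e : Fin m) : Set where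
    field
      outer   : Fin n
      outside : ¬ Conn C root outer
      reaches : Conn (add C e) root outer
      only    : ∀ {v} → Conn (add C e) root v → Conn C root v ⊎ Conn C outer v
      at-src  : Conn C root (src e) ⊎ src e ≡ outer
      at-tgt  : Conn C root (tgt e) ⊎ tgt e ≡ outer

    near : ∀ {E : Fin m → Set} → (∀ {f} → C ∋ f → E f) → Path E root outer → Path E root (src e) × Path E root (tgt e)
    near {E} i p = Sum.[ old , new ] at-src , Sum.[ old , new ] at-tgt
      where
      old : ∀ {v} → Conn C root v → Path E root v
      old c = Path-mono (λ {f} → i {f}) (conn-sound C c)
      new : ∀ {v} → v ≡ outer → Path E root v
      new refl = p

  crossing? : ∀ C e → Crossing C e ⊎ (Conn C root (src e) → Conn C root (tgt e)) × (Conn C root (tgt e) → Conn C root (src e))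
  crossing? C e with bool-cases (conn C root (src e)) | bool-cases (conn C root (tgt e))
  ... | inj₁ x | inj₁ y = inj₂ ((λ _ → y) , (λ _ → x))
  ... | inj₂ x | inj₂ y = inj₂ ((λ c → ⊥-elim (false⇒not-true x c)) , (λ c → ⊥-elim (false⇒not-true y c)))
  ... | inj₁ x | inj₂ y = inj₁ record
    { outer = tgt e ; outside = false⇒not-true y
    ; reaches = conn-trans (conn-mono (add-⊇ C e) x) (conn-edge (add-∋ C e))
    ; only = λ c → only (conn-add⁻ C e c)
    ; at-src = inj₁ x ; at-tgt = inj₂ refl }
    where
    only : ∀ {v} → Conn C root v ⊎ (Conn C root (src e) × Conn C (tgt e) v) ⊎ (Conn C root (tgt e) × Conn C (src e) v) →
           Conn C root v ⊎ Conn C (tgt e) v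
    only (inj₁ c)              = inj₁ c
    only (inj₂ (inj₁ (_ , c))) = inj₂ c
    only (inj₂ (inj₂ (c , _))) = ⊥-elim (false⇒not-true y c)
  ... | inj₂ x | inj₁ y = inj₁ record
    { outer = src e ; outside = false⇒not-true x
    ; reaches = conn-trans (conn-mono (add-⊇ C e) y) (conn-sym (conn-edge (add-∋ C e)))
    ; only = λ c → only (conn-add⁻ C e c)
    ; at-src = inj₂ refl ; at-tgt = inj₁ y }
    where
    only : ∀ {v} → Conn C root v ⊎ (Conn C root (src e) × Conn C (tgt e) v) ⊎ (Conn C root (tgt e) × Conn C (src e) v) →
           Conn C root v ⊎ Conn C (src e) v
    only (inj₁ c)              = inj₁ c
    only (inj₂ (inj₁ (c , _))) = ⊥-elim (false⇒not-true x c)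
    only (inj₂ (inj₂ (_ , c))) = inj₂ c

  find-crossing : ∀ C U → (∃ λ e → ∃ λ V → U ↭ e ∷ V × Crossing C e) ⊎
    (∀ {e} → e ∈ U → (Conn C root (src e) → Conn C root (tgt e)) × (Conn C root (tgt e) → Conn C root (src e)))
  find-crossing C []      = inj₂ λ ()
  find-crossing C (e ∷ U) with crossing? C e
  ... | inj₁ x = inj₁ (e , U , Perm.refl , x)
  ... | inj₂ no-e with find-crossing C U
  ... | inj₁ (f , V , p , x) = inj₁ (f , e ∷ V , Perm.trans (Perm.prep e p) (Perm.swap e f Perm.refl) , x)
  ... | inj₂ no-U            = inj₂ λ { (here refl) → no-e ; (there i) → no-U i }

  -- C is a tree containing the root together with isolated vertices.
  record RootedTree (C : StateE) : Set where
    field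
      isolated : ∀ {u v} → Conn C u v → u ≡ v ⊎ Conn C root u
      size     : count (conn C root) ℕ.≤ suc (countTrue C)

  -- `outer` is isolated in `C`, being outside the root component, so the component gains only this
  -- vertex while the state gains one edge.
  grow-tree : ∀ {C e} → RootedTree C → C ∌ e → Crossing C e → RootedTree (add C e)
  grow-tree {C} {e} tree new x = record
    { isolated = λ {u} c → isolated' (conn-add⁻ C e c)
    ; size = ℕ.≤-trans (count-insert {p = conn C root} outer (λ v c → inside v (only c)))
        (ℕ.≤-trans (s≤s (RootedTree.size tree)) (ℕ.≤-reflexive (cong suc (sym (countTrue-set C e new))))) }
    where
    open Crossing x
    ends' : Conn (add C e) root (src e) × Conn (add C e) root (tgt e)
    ends' = let p , q = near (λ {f} i → add-⊇ C e f i) (conn-sound (add C e) reaches) in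
      conn-complete (add C e) root p , conn-complete (add C e) root q
    old : ∀ {u v} → Conn C u v → Conn (add C e) u v
    old = conn-mono (add-⊇ C e)
    isolated' : ∀ {u v} → Conn C u v ⊎ (Conn C u (src e) × Conn C (tgt e) v) ⊎ (Conn C u (tgt e) × Conn C (src e) v) →
                u ≡ v ⊎ Conn (add C e) root u
    isolated' (inj₁ c)              = Sum.map₂ old (RootedTree.isolated tree c)
    isolated' (inj₂ (inj₁ (c , _))) = inj₂ (conn-trans (proj₁ ends') (old (conn-sym c)))
    isolated' (inj₂ (inj₂ (c , _))) = inj₂ (conn-trans (proj₂ ends') (old (conn-sym c)))
    inside : ∀ v → Conn C root v ⊎ Conn C outer v → Conn C root v ⊎ v ≡ outer
    inside v (inj₁ c) = inj₁ c
    inside v (inj₂ c) = Sum.[ inj₂ ∘ sym , (λ c' → ⊥-elim (outside c')) ] (RootedTree.isolated tree c)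

  no-crossing : ∀ C U → (∀ v → Path (Within C U) root v) →
    (∀ {e} → e ∈ U → (Conn C root (src e) → Conn C root (tgt e)) × (Conn C root (tgt e) → Conn C root (src e))) →
    ∀ v → Conn C root v
  no-crossing C U spans stuck v = go (spans v)
    where
    go : ∀ {v} → Path (Within C U) root v → Conn C root v
    go stop               = conn-refl
    go (fwd e (inj₁ i) p) = conn-trans (go p) (conn-edge i)
    go (fwd e (inj₂ i) p) = proj₁ (stuck i) (go p)
    go (bwd e (inj₁ i) p) = conn-trans (go p) (conn-sym (conn-edge i))
    go (bwd e (inj₂ i) p) = proj₂ (stuck i) (go p)

  -- The contracted and free edges together reach every vertex. If no free edge leaves the root
  -- component, that component is everything, so every state has at least n-1 edges, and the marked
  -- root adds one to the degree: no bidegree of `Q` is left. Induction is on the length of `U`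
  -- because the list is rearranged at each step.
  exact-below : ∀ k U C {Q} → length U ≡ k → (∀ i j → Q i j → i ℕ.+ j ℕ.< n) → Unique U → (∀ {e} → e ∈ U → C ∌ e) →
                (∀ v → Path (Within C U) root v) → RootedTree C → Exact U C Marked Q
  exact-below k U C {Q} len low uniq new spans tree with find-crossing C U
  ... | inj₂ stuck = exact-none λ {S} → none S
    where
    none : ∀ S → ¬ Reg U C Marked Q S
    none (s , ℓ) r = ℕ.<⇒≱ (low _ _ (Reg.degree r)) (begin
      n                                  ≡⟨ count-all (conn C root) (no-crossing C U spans stuck) ⟨
      count (conn C root)                ≤⟨ RootedTree.size tree ⟩
      suc (countTrue C)                  ≡⟨ ℕ.+-comm 1 (countTrue C) ⟩
      countTrue C ℕ.+ 1                  ≤⟨ ℕ.+-mono-≤ edges≤ label≥1 ⟩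
      countTrue s ℕ.+ countTrue ℓ ∎)
      where
      open ℕ.≤-Reasoning
      edges≤ : countTrue C ℕ.≤ countTrue s
      edges≤ = subst₂ ℕ._≤_ (sym (countTrue-count C)) (sym (countTrue-count s)) (count-mono (Reg.above r))
      label≥1 : 1 ℕ.≤ countTrue ℓ
      label≥1 = subst (1 ℕ.≤_) (countTrue-unset ℓ root (Reg.label r)) (s≤s z≤n)
  exact-below zero U C len low uniq new spans tree | inj₁ (e , V , p , x) with trans (sym (↭-length p)) len
  ... | ()
  exact-below (suc k) U C {Q} len low uniq new spans tree | inj₁ (e , V , p , x) =
    Exact-↭ p (decide (bool-cases (conn (union C V) root outer)))
    where
    open Crossing x
    lenV : length V ≡ k
    lenV = ℕ.suc-injective (trans (sym (↭-length p)) len)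
    uniq' : Unique (e ∷ V)
    uniq' = Unique-resp-↭ (↭⇒↭ₛ p) uniq
      where open import Data.List.Relation.Binary.Permutation.Setoid.Properties (setoid (Fin m)) using (Unique-resp-↭)
    e∉V : e ∉ V
    e∉V with e# ∷ _ ← uniq' = All-∉ e#
    uniqV : Unique V
    uniqV with _ ∷ u ← uniq' = u
    member : ∀ {f} → f ∈ e ∷ V → f ∈ U
    member = ∈-resp-↭ (↭-sym p)
    C∌e : C ∌ e
    C∌e = new (member (here refl))
    newV : ∀ {f} → f ∈ V → add C e ∌ f
    newV i = trans (add-other C (λ { refl → e∉V i })) (new (member (there i)))
    move : ∀ {f} → Within C U f → Within (add C e) V f
    move {f} (inj₁ i) = inj₁ (add-⊇ C e f i)
    move (inj₂ i) with ∈-resp-↭ p i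
    ... | here refl = inj₁ (add-∋ C e)
    ... | there j   = inj₂ j
    contracted : ∀ {Q} → (∀ i j → Q i j → i ℕ.+ j ℕ.< n) → Exact V (add C e) Marked Q
    contracted low = exact-below k V (add C e) lenV low uniqV newV
      (λ v → Path-mono (λ {f} → move {f}) (spans v)) (grow-tree tree C∌e x)
    -- If the far end stays reachable without `e`, the deletion is still connected and the induction
    -- covers both minors. Otherwise `e` is a bridge and the contraction alone is used.
    decide : Conn (union C V) root outer ⊎ conn (union C V) root outer ≡ false → Exact (e ∷ V) C Marked Q
    decide (inj₁ c) = exact-cone Marked-closed e∉V C∌e
      (exact-below k V C lenV low uniqV (new ∘ member ∘ there) (λ v → reroute (spans v)) tree) (contracted low)
      where
      ends' : Path (Within C V) root (src e) × Path (Within C V) root (tgt e)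
      ends' = near inj₁ (Path-mono (λ {f} → union⁻ C V f) (conn-sound (union C V) c))
      -- At a use of `e` the path so far is discarded and replaced by a path avoiding `e` to the end
      -- that is reached.
      reroute : ∀ {v} → Path (Within C U) root v → Path (Within C V) root v
      reroute stop               = stop
      reroute (fwd f (inj₁ i) p') = fwd f (inj₁ i) (reroute p')
      reroute (bwd f (inj₁ i) p') = bwd f (inj₁ i) (reroute p')
      reroute (fwd f (inj₂ i) p') with ∈-resp-↭ p i
      ... | here refl = proj₂ ends'
      ... | there j   = fwd f (inj₂ j) (reroute p')
      reroute (bwd f (inj₂ i) p') with ∈-resp-↭ p i
      ... | here refl = proj₁ ends'
      ... | there j   = bwd f (inj₂ j) (reroute p')
    decide (inj₂ c) = reduce Marked-closed e∉V C∌e (Bridge.bridge-solve e∉V C∌e outer reaches separated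
        (contracted λ { i j (i' , refl , q) → subst (ℕ._< n) (ℕ.+-suc i' j) (low i' (suc j) q) }))
      where
      separated : ∀ s → (∀ f → s ∋ f → C ∋ f ⊎ f ∈ V) → ¬ Conn s root outer
      separated s be h = false⇒not-true c (conn-mono (λ f i → union⁺ C V f (be f i)) h)

  ∅-tree : RootedTree ∅
  ∅-tree = record
    { isolated = λ c → inj₁ (equal (conn-sound ∅ c))
    ; size = ℕ.≤-trans (ℕ.≤-reflexive (count-one (conn ∅ root) root (λ v c → sym (equal (conn-sound ∅ c)))))
        (≤1 (conn ∅ root root)) }
    where
    equal : ∀ {u v} → Path (∅ ∋_) u v → u ≡ v
    equal stop        = refl
    equal (fwd e i p) = ⊥-elim (false⇒not-true (∅-∌ e) i)
    equal (bwd e i p) = ⊥-elim (false⇒not-true (∅-∌ e) i)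
    ≤1 : ∀ b → toNat b ℕ.≤ suc (countTrue ∅)
    ≤1 true  = s≤s z≤n
    ≤1 false = z≤n

  exact-marked : Connected → ∀ {Q} → (∀ i j → Q i j → i ℕ.+ j ℕ.< n) → Exact (allFin m) ∅ Marked Q
  exact-marked connected low = exact-below _ (allFin m) ∅ refl low (allFin⁺ m) (λ {e} _ → ∅-∌ e)
    (λ v → Path-mono (λ {f} _ → inj₂ (∈-allFin f)) (conn-sound allEdges (connected root v))) ∅-tree

  -- The marked cochains form a subcomplex, and multiplication by x at the root
  -- identifies the quotient by it with the subcomplex.
  exact-low : Connected → ∀ {Q} → (∀ i j → Q i j → suc (i ℕ.+ j) ℕ.< n) → Exact (allFin m) ∅ (λ _ → ⊤) Q
  exact-low connected {Q} low F supp cocycle = (G₁ ⊕ G₂) ,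
    Supp-⊕ suppG₁ (Supp-mono (λ r → record { Reg r ; label = tt }) (proj₁ (proj₂ solution₂))) , λ S → begin
      ∂s U (G₁ ⊕ G₂) S          ≡⟨ extend-⊕ (edges dGate U) G₁ G₂ S ⟩
      ∂s U G₁ S + ∂s U G₂ S     ≡⟨ cong (∂s U G₁ S +_) (proj₂ (proj₂ solution₂) S) ⟩
      ∂s U G₁ S + (F S - ∂s U G₁ S) ≡⟨ solve 2 (λ a b → a :+ (b :- a) := b) refl (∂s U G₁ S) (F S) ⟩
      F S ∎
    where
    open ≡-Reasoning
    U = allFin m
    Q⁺ : ℕ → ℕ → Set
    Q⁺ i j = ∃ λ j' → j ≡ suc j' × Q i j'
    X = extend up F
    suppX : Supp (Reg U ∅ Marked Q⁺) X
    suppX = Supp-extend up (λ { {s , ℓ} r → All-up s ℓ (λ x → reg (Valid-mark s ℓ true (Reg.valid r)) (Reg.above r) (Reg.below r)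
      (lookup-≔ ℓ root) (countTrue ℓ , countTrue-set ℓ root x , Reg.degree r)) }) supp
    -- Multiplication by x raises the degree by one; this accounts for the bound on `Q` being
    -- stricter by one than for marked cochains.
    solution₁ = exact-marked connected {Q⁺} (λ { i j (j' , refl , q) → subst (ℕ._< n) (sym (ℕ.+-suc i j')) (low i j' q) }) X suppX
      (λ S → trans (sym (up-∂s U (Supp-Valid supp) S)) (extend-zero up cocycle S))
    H = proj₁ solution₁
    suppH = proj₁ (proj₂ solution₁)
    G₁ = extend down H
    suppG₁ : Supp (Reg U ∅ (λ _ → ⊤) (↓ Q)) G₁
    suppG₁ = Supp-extend down (λ { {s , ℓ} r → All-down s ℓ (λ x → reg (Valid-mark s ℓ false (Reg.valid r)) (Reg.above r) (Reg.below r) tt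
      (lower s ℓ x (Reg.degree r))) }) suppH
      where
      lower : ∀ s ℓ → Marked ℓ → (↓ Q⁺) (countTrue s) (countTrue ℓ) → (↓ Q) (countTrue s) (countTrue (unmark ℓ))
      lower s ℓ x (j' , eq , q) = subst (Q (suc (countTrue s))) (sym (ℕ.suc-injective (trans (countTrue-unset ℓ root x) eq))) q
    -- Subtracting this coboundary makes the class of `F` modulo marked cochains zero, so the rest
    -- can be solved in the marked subcomplex.
    F₂ = F ⊖ ∂s U G₁
    upF₂ : extend up F₂ ≐ zeroC
    upF₂ S = begin
      extend up F₂ S                        ≡⟨ extend-⊖ up F (∂s U G₁) S ⟩
      X S - extend up (∂s U G₁) S           ≡⟨ cong (λ y → X S - y) (up-∂s U (Supp-Valid suppG₁) S) ⟩
      X S - ∂s U (extend up G₁) S           ≡⟨ cong (λ y → X S - y) (extend-cong (edges dGate U) (up-down (Supp-mono Reg.label suppH)) S) ⟩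
      X S - ∂s U H S                        ≡⟨ cong (λ y → X S - y) (proj₂ (proj₂ solution₁) S) ⟩
      X S - X S                             ≡⟨ ℚ.+-inverseʳ (X S) ⟩
      0ℚ ∎
    suppF₂ : Supp (Reg U ∅ Marked Q) F₂
    suppF₂ = Supp-mono (λ { (r , x) → record { Reg r ; label = x } })
      (Supp-∩ (Supp-⊖ supp (Supp-∂s (λ _ _ _ _ _ _ → tt) suppG₁)) (up-kernel {F₂} upF₂))
    solution₂ = exact-marked connected {Q} (λ i j q → ℕ.<-trans (ℕ.n<1+n _) (low i j q)) F₂ suppF₂
      (λ S → trans (extend-⊖ (edges dGate U) F (∂s U G₁) S) (cong₂ _-_ (cocycle S) (∂s² U (Supp-Valid suppG₁) S)))
    G₂ = proj₁ solution₂

-- The degree filtration of Φ + d and the isomorphism on leading terms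

module SpectralSequence (Γ : Graph) (connected : Chromatic.Connected Γ) where
  open Graph Γ
  open Chromatic Γ
  open Regions Γ
  open import Data.Integer using (+_; +≤+)

  data Outside (i j : ℤ) : Set where
    above : + suc n ℤ.≤ i ℤ.+ j → Outside i j
    below : + 2 ℤ.+ (i ℤ.+ j) ℤ.≤ + n → Outside i j

  record Inside (i j : ℤ) : Set where
    field
      upper : i ℤ.+ j ℤ.≤ + n
      lower : + suc n ℤ.≤ + 2 ℤ.+ (i ℤ.+ j)

  outside? : ∀ i j → Outside i j ⊎ Inside i j
  outside? i j with + suc n ℤ.≤? i ℤ.+ j | + 2 ℤ.+ (i ℤ.+ j) ℤ.≤? + n
  ... | yes a | _     = inj₁ (above a)
  ... | no _  | yes b = inj₁ (below b)
  ... | no ¬a | no ¬b = inj₂ record { upper = ℤ.i<j⇒i≤pred[j] (ℤ.≰⇒> ¬a) ; lower = ℤ.i<j⇒suc[i]≤j (ℤ.≰⇒> ¬b) }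

  suc⇒pred : ∀ {k i} → + suc k ≡ i → + k ≡ i ℤ.- ℤ.1ℤ
  suc⇒pred refl = refl

  least : ∀ k → k ≡ 0 ⊎ Σ (Fin k) λ r → ∀ (v : Fin k) → toℕ r ℕ.≤ toℕ v
  least zero    = inj₁ refl
  least (suc k) = inj₂ (zero , λ _ → z≤n)

  cancel-2 : ∀ {i j} → i ℤ.+ + 2 ≡ j ℤ.+ + 2 → i ≡ j
  cancel-2 {i} {j} eq = trans (sub i) (trans (cong (λ k → k ℤ.- + 2) eq) (sym (sub j)))
    where
    sub : ∀ i → i ≡ (i ℤ.+ + 2) ℤ.- + 2
    sub = solveℤ 1 (λ i → i ≔ℤ ((i +ℤ conℤ (+ 2)) -ℤ conℤ (+ 2))) refl

  exact-outside : ∀ i j → Outside i j → Exact (allFin m) ∅ (λ _ → ⊤) (λ i' j' → + i' ≡ i × + j' ≡ j)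
  exact-outside i j (above a) = exact-above (allFin m) ∅ high (allFin⁺ m) (λ {e} _ → ∅-∌ e)
    (ℕ.≤-trans (ℕ.≤-reflexive (cong (ℕ._+ rank ∅) countTrue-∅)) (count-≤ (isRep ∅)))
    where
    high : ∀ i' j' → + i' ≡ i × + j' ≡ j → n ℕ.< i' ℕ.+ j'
    high i' j' (refl , refl) = ℤ.drop‿+≤+ a
  exact-outside i j (below b) = go (least n)
    where
    low : ∀ i' j' → + i' ≡ i × + j' ≡ j → suc (i' ℕ.+ j') ℕ.< n
    low i' j' (refl , refl) = ℤ.drop‿+≤+ b
    go : n ≡ 0 ⊎ Σ (Fin n) (λ r → ∀ (v : Fin n) → toℕ r ℕ.≤ toℕ v) → _
    go (inj₂ (root , root-least)) = Vanishing.exact-low Γ root root-least connected low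
    -- Without vertices there is no root, but then the bound leaves no bidegree.
    go (inj₁ n≡0) = exact-none λ r → ℕ.<⇒≱ (low _ _ (Reg.degree r)) (ℕ.≤-trans (ℕ.≤-reflexive n≡0) z≤n)

  vanish : ∀ i j → Outside i j → ∀ f → InC i j f → d f ≐ zeroC →
           ∃ λ g → InC (i ℤ.- ℤ.1ℤ) j g × d g ≐ f
  vanish i j out f supp cocycle =
    let g , suppg , eq = exact-outside i j out f (Supp-mono to supp) (λ S → trans (sym (d-edges f S)) (cocycle S)) in
    g , Supp-mono from suppg , λ S → trans (d-edges g S) (eq S)
    where
    to : ∀ {S} → Valid S × (+ dimS S ≡ i) × (+ degS S ≡ j) → Reg (allFin m) ∅ (λ _ → ⊤) (λ i' j' → + i' ≡ i × + j' ≡ j) S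
    to (val , di , de) = reg val (λ e x → ⊥-elim (false⇒not-true (∅-∌ e) x)) (λ e _ → inj₂ (∈-allFin e)) tt (di , de)
    from : ∀ {S} → Reg (allFin m) ∅ (λ _ → ⊤) (λ i' j' → + suc i' ≡ i × + j' ≡ j) S →
           Valid S × (+ dimS S ≡ i ℤ.- ℤ.1ℤ) × (+ degS S ≡ j)
    from r = Reg.valid r , suc⇒pred (proj₁ (Reg.degree r)) , proj₂ (Reg.degree r)

  D-⊕ : ∀ f g → D (f ⊕ g) ≐ (D f ⊕ D g)
  D-⊕ f g S = trans (D-edges (f ⊕ g) S) (trans (extend-⊕ (edges DGate (allFin m)) f g S)
    (sym (cong₂ _+_ (D-edges f S) (D-edges g S))))

  D-⊖ : ∀ f g → D (f ⊖ g) ≐ (D f ⊖ D g)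
  D-⊖ f g S = trans (D-edges (f ⊖ g) S) (trans (extend-⊖ (edges DGate (allFin m)) f g S)
    (sym (cong₂ _-_ (D-edges f S) (D-edges g S))))

  D-⊙ : ∀ c f → D (c ⊙ f) ≐ (c ⊙ D f)
  D-⊙ c f S = trans (D-edges (c ⊙ f) S) (trans (extend-⊙ (edges DGate (allFin m)) c f S) (cong (c *_) (sym (D-edges f S))))

  D-zero : ∀ {f} → f ≐ zeroC → D f ≐ zeroC
  D-zero e S = cong₂ _+_ (extend-zero ΦImg e S) (extend-zero dImg e S)

  D² : ∀ {f} → Supp Valid f → D (D f) ≐ zeroC
  D² {f} v S = trans (D-edges (D f) S) (trans (extend-cong (edges DGate (allFin m)) (D-edges f) S)
    (edges² DGate DGate-symmetric (allFin m) v S))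

  Graded : ℤ → (ℤ → Set) → State → Set
  Graded i R S = Valid S × (+ dimS S ≡ i) × R (+ degS S)

  graded⇒valid : ∀ {i R f} → Supp (Graded i R) f → Supp Valid f
  graded⇒valid = Supp-mono proj₁

  dim-grow : ∀ S e {i} → proj₁ S ∌ e → + dimS S ≡ i → + dimS (grow S e) ≡ ℤ.1ℤ ℤ.+ i
  dim-grow S e ne eq = trans (cong (λ k → + k) (countTrue-set (proj₁ S) e ne)) (cong ℤ.suc eq)

  deg-d : ∀ S e → Valid S → dGate S e ≡ true → + degS (grow S e) ≡ + degS S
  deg-d (s , ℓ) e val ge = cong (λ k → + k) (degree-preserved s e ℓ val (not-joins (s , ℓ) e ge))

  deg-Φ : ∀ S e → Valid S → ΦGate S e ≡ true → + degS S ≡ + degS (grow S e) ℤ.+ + 2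
  deg-Φ (s , ℓ) e val ge = trans (cong (λ k → + k) (sym (degree-joins s e ℓ val ge)))
    (cong (λ k → + k) (ℕ.+-comm 2 (degS (grow (s , ℓ) e))))

  Supp-d : ∀ {i R f} → Supp (Graded i R) f → Supp (Graded (ℤ.1ℤ ℤ.+ i) R) (d f)
  Supp-d {i} {R} {f} supp = Supp-resp (≐-sym (d-edges f)) (Supp-edges dGate (allFin m)
    (λ S e _ (val , di , de) ne ge → Valid-grow S e , dim-grow S e ne di , subst R (sym (deg-d S e val ge)) de) supp)

  Supp-Φ : ∀ {i R f} → Supp (Graded i R) f → Supp (Graded (ℤ.1ℤ ℤ.+ i) (λ k → R (k ℤ.+ + 2))) (Φ f)
  Supp-Φ {i} {R} {f} = Supp-edges ΦGate (allFin m)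
    (λ S e _ (val , di , de) ne ge → Valid-grow S e , dim-grow S e ne di , subst R (deg-Φ S e val ge) de)

  at : ℤ → State → Bool
  at k S = ⌊ + degS S ℤ.≟ k ⌋

  part : ℤ → Cochain → Cochain
  part k = cut (at k)

  at⁻ : ∀ k S → at k S ≡ true → + degS S ≡ k
  at⁻ k S = dec-true⁻ (+ degS S ℤ.≟ k)

  at⁺ : ∀ k S → + degS S ≡ k → at k S ≡ true
  at⁺ k S = dec-true⁺ (+ degS S ℤ.≟ k)

  cut-edges : ∀ g U p q {f} → (∀ S e → Valid S → g S e ≡ true → q (grow S e) ≡ p S) → Supp Valid f →
              cut q (extend (edges g U) f) ≐ extend (edges g U) (cut p f)
  cut-edges g U p q {f} h v T = begin
    cut q (A f) T                       ≡⟨ cut-cong q (extend-cong (edges g U) (cut-split p f)) T ⟩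
    cut q (A (f₁ ⊕ f₀)) T               ≡⟨ cut-cong q (extend-⊕ (edges g U) f₁ f₀) T ⟩
    cut q (A f₁ ⊕ A f₀) T               ≡⟨ cut-⊕ q (A f₁) (A f₀) T ⟩
    cut q (A f₁) T + cut q (A f₀) T     ≡⟨ cong₂ _+_ (cut-id {λ S → q S ≡ true} q id keep T) (cut-zero {λ S → q S ≡ false} q id drop T) ⟩
    A f₁ T + 0ℚ                         ≡⟨ ℚ.+-identityʳ (A f₁ T) ⟩
    A f₁ T ∎
    where
    open ≡-Reasoning
    A = extend (edges g U)
    f₁ = cut p f
    f₀ = cut (not ∘ p) f
    keep : Supp (λ S → q S ≡ true) (A f₁)
    keep = Supp-edges g U (λ S e _ (val , x) _ ge → trans (h S e val ge) x) (Supp-cut p v)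
    drop : Supp (λ S → q S ≡ false) (A f₀)
    drop = Supp-edges g U (λ S e _ (val , x) _ ge → trans (h S e val ge) (not-true (p S) x)) (Supp-cut (not ∘ p) v)
      where
      not-true : ∀ b → not b ≡ true → b ≡ false
      not-true false _ = refl

  part-d : ∀ k {f} → Supp Valid f → part k (d f) ≐ d (part k f)
  part-d k {f} v T = trans (cut-cong (at k) (d-edges f) T) (trans
    (cut-edges dGate (allFin m) (at k) (at k) (λ S e val ge → cong (λ j → ⌊ j ℤ.≟ k ⌋) (deg-d S e val ge)) v T)
    (sym (d-edges (part k f) T)))

  part-Φ : ∀ k {f} → Supp Valid f → part k (Φ f) ≐ Φ (part (k ℤ.+ + 2) f)
  part-Φ k = cut-edges ΦGate (allFin m) (at (k ℤ.+ + 2)) (at k) λ S e val ge → ≡true-ext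
    (λ x → at⁺ (k ℤ.+ + 2) S (trans (deg-Φ S e val ge) (cong (λ j → j ℤ.+ + 2) (at⁻ k (grow S e) x))))
    (λ x → at⁺ k (grow S e) (cancel-2 (trans (sym (deg-Φ S e val ge)) (at⁻ (k ℤ.+ + 2) S x))))

  -- Two degrees feed into degree `k`: `k + 2` through Φ and `k` itself through d. Every later
  -- comparison of leading terms reads off this equation at a suitable `k`.
  part-D : ∀ k {f} → Supp Valid f → part k (D f) ≐ (Φ (part (k ℤ.+ + 2) f) ⊕ d (part k f))
  part-D k {f} v S = trans (cut-⊕ (at k) (Φ f) (d f) S) (cong₂ _+_ (part-Φ k v S) (part-d k v S))

  Supp-part : ∀ {i R} k {f} → Supp (Graded i R) f → InC i k (part k f)
  Supp-part k supp = Supp-mono (λ { {S} ((val , di , _) , x) → val , di , at⁻ k S x }) (Supp-cut (at k) supp)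

  part-⊖ : ∀ k f g → part k (f ⊖ g) ≐ (part k f ⊖ part k g)
  part-⊖ k = cut-⊖ (at k)

  part-self : ∀ {i k f} → InC i k f → part k f ≐ f
  part-self {k = k} = cut-id (at k) (λ {S} p → at⁺ k S (proj₂ (proj₂ p)))

  part-none : ∀ {i R} k {f} → ¬ R k → Supp (Graded i R) f → part k f ≐ zeroC
  part-none {R = R} k ¬R = cut-zero (at k) (λ {S} p → dec-false⁺ (+ degS S ℤ.≟ k)
    (λ eq → ¬R (subst R eq (proj₂ (proj₂ p)))))

  Supp-pred : ∀ {i k f} → InCle i k f → part k f ≐ zeroC → InCle i (k ℤ.- ℤ.1ℤ) f
  Supp-pred {i} {k} {f} supp e S with supp S
  ... | inj₁ z = inj₁ z
  ... | inj₂ (val , di , le) with + degS S ℤ.≟ k | e S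
  ... | yes _ | z = inj₁ z
  ... | no ne | _ = inj₂ (val , di , ≤∧≢⇒≤pred le ne)
    where
    ≤∧≢⇒≤pred : ∀ {i j} → i ℤ.≤ j → i ≢ j → i ℤ.≤ j ℤ.- ℤ.1ℤ
    ≤∧≢⇒≤pred {i} {j} le ne = subst (i ℤ.≤_) (ℤ.+-comm (ℤ.-1ℤ) j) (ℤ.i<j⇒i≤pred[j] (ℤ.≤∧≢⇒< le ne))

  InCle-tot : ∀ {i j f} → InCle i j f → InCtot i f
  InCle-tot = Supp-mono λ (val , di , _) → val , di

  InC-le : ∀ {i j f} → InC i j f → InCle i j f
  InC-le = Supp-mono λ (val , di , de) → val , di , ℤ.≤-reflexive de

  InCle-mono : ∀ {i j k f} → j ℤ.≤ k → InCle i j f → InCle i k f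
  InCle-mono le = Supp-mono λ (val , di , de) → val , di , ℤ.≤-trans de le

  InCtot-valid : ∀ {i f} → InCtot i f → Supp Valid f
  InCtot-valid = Supp-mono proj₁

  -- An inequality which follows from i ≤ j because b - a = (j - i) + k.
  ≤-linear : ∀ {i j a b} k → i ℤ.≤ j → b ℤ.+ i ≡ (a ℤ.+ j) ℤ.+ + k → a ℤ.≤ b
  ≤-linear {i} {j} {a} {b} k le eq = subst₂ ℤ._≤_ (cancel a) (cancel b) (ℤ.+-monoˡ-≤ (ℤ.- j) (ℤ.≤-trans (ℤ.i≤i+j (a ℤ.+ j) (+ k))
    (ℤ.≤-trans (ℤ.≤-reflexive (sym eq)) (ℤ.+-monoʳ-≤ b le))))
    where
    cancel : ∀ a → (a ℤ.+ j) ℤ.- j ≡ a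
    cancel a = solveℤ 2 (λ a j → ((a +ℤ j) -ℤ j) ≔ℤ a) refl a j

  absurd-≤ : ∀ {i j} k → i ℤ.≤ j → i ≡ (ℤ.1ℤ ℤ.+ j) ℤ.+ + k → ⊥
  absurd-≤ {i} k le eq with ≤-linear {a = ℤ.1ℤ} {b = + 0} k le (trans (ℤ.+-identityˡ i) eq)
  ... | +≤+ ()

  ≰+2 : ∀ k → ¬ (k ℤ.+ + 2 ℤ.≤ k)
  ≰+2 k le = absurd-≤ 1 le (solveℤ 1 (λ k → (k +ℤ conℤ (+ 2)) ≔ℤ ((conℤ ℤ.1ℤ +ℤ k) +ℤ conℤ ℤ.1ℤ)) refl k)

  bounded : ∀ i → ∃ λ N → i ℤ.≤ + N
  bounded (+ k)        = k , ℤ.≤-refl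
  bounded ℤ.-[1+ k ] = 0 , ℤ.-≤+

  suc-pred-ℤ : ∀ i → ℤ.1ℤ ℤ.+ (i ℤ.- ℤ.1ℤ) ≡ i
  suc-pred-ℤ = solveℤ 1 (λ i → (conℤ ℤ.1ℤ +ℤ (i -ℤ conℤ ℤ.1ℤ)) ≔ℤ i) refl

  Supp-D : ∀ {i k f} → InCle (i ℤ.- ℤ.1ℤ) k f → InCle i k (D f)
  Supp-D {i} {k} {f} supp = subst (λ i' → InCle i' k (D f)) (suc-pred-ℤ i)
    (Supp-⊕ (Supp-mono (λ {S} (val , di , de) → val , di , ℤ.≤-trans (ℤ.i≤i+j (+ degS S) (+ 2)) de) (Supp-Φ {R = ℤ._≤ k} supp))
      (Supp-d {R = ℤ._≤ k} supp))

  part-zero : ∀ k {f} → f ≐ zeroC → part k f ≐ zeroC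
  part-zero k e S = trans (cut-cong (at k) e S) (δ-zero (at k S))

  -- No component above degree `k` feeds into it through Φ, so the top component of `u` is a
  -- d-cocycle. Off the strip it equals `d t`, and subtracting `D t` cancels it while disturbing
  -- only lower degrees.
  peel : ∀ i k u → InCle i k u → part k (D u) ≐ zeroC → Outside i k →
         ∃ λ t → InC (i ℤ.- ℤ.1ℤ) k t × InCle i (k ℤ.- ℤ.1ℤ) (u ⊖ D t)
  peel i k u supp lower out = t , suppt , Supp-pred (Supp-⊖ supp (Supp-D (InC-le suppt))) gone
    where
    open ≡-Reasoning
    top-Φ : ∀ {i f} → InCle i k f → Φ (part (k ℤ.+ + 2) f) ≐ zeroC
    top-Φ {i} supp = extend-zero ΦImg (part-none {i} {ℤ._≤ k} (k ℤ.+ + 2) (≰+2 k) supp)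
    cocycle : d (part k u) ≐ zeroC
    cocycle S = begin
      d (part k u) S                                  ≡⟨ ℚ.+-identityˡ _ ⟨
      0ℚ + d (part k u) S                             ≡⟨ cong (_+ d (part k u) S) (top-Φ {i} supp S) ⟨
      Φ (part (k ℤ.+ + 2) u) S + d (part k u) S       ≡⟨ part-D k (graded⇒valid {i} {ℤ._≤ k} supp) S ⟨
      part k (D u) S                                  ≡⟨ lower S ⟩
      0ℚ ∎
    solution = vanish i k out (part k u) (Supp-part {i} {ℤ._≤ k} k supp) cocycle
    t = proj₁ solution
    suppt = proj₁ (proj₂ solution)
    gone : part k (u ⊖ D t) ≐ zeroC
    gone S = begin
      part k (u ⊖ D t) S                  ≡⟨ part-⊖ k u (D t) S ⟩
      part k u S - part k (D t) S         ≡⟨ cong (λ x → part k u S - x) (part-D k (graded⇒valid {i ℤ.- ℤ.1ℤ} {_≡ k} suppt) S) ⟩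
      part k u S - (Φ (part (k ℤ.+ + 2) t) S + d (part k t) S)
        ≡⟨ cong (λ x → part k u S - x) (cong₂ _+_ (top-Φ {i ℤ.- ℤ.1ℤ} (InC-le suppt) S)
             (trans (extend-cong dImg (part-self {i ℤ.- ℤ.1ℤ} suppt) S) (proj₂ (proj₂ solution) S))) ⟩
      part k u S - (0ℚ + part k u S)      ≡⟨ solve 1 (λ x → x :- (con 0ℚ :+ x) := con 0ℚ) refl (part k u S) ⟩
      0ℚ ∎

  D-peeled : ∀ {i k} u t → InC i k t → D (u ⊖ D t) ≐ D u
  D-peeled {i} {k} u t suppt S = trans (D-⊖ u (D t) S) (trans (cong (λ x → D u S - x) (D² (graded⇒valid {i} {_≡ k} suppt) S))
    (solve 1 (λ x → x :- con 0ℚ := x) refl (D u S)))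

  -- Changes a primitive without changing its coboundary: its components above degree `j` are peeled
  -- off from the top, each being a d-cocycle because `D u` has nothing there. `N` counts the
  -- degrees in excess of `j`.
  lower-degrees : ∀ N i j u → InCle i (j ℤ.+ + N) u → (∀ k → ℤ.1ℤ ℤ.+ j ℤ.≤ k → part k (D u) ≐ zeroC) →
                  (∀ k → ℤ.1ℤ ℤ.+ j ℤ.≤ k → Outside i k) → ∃ λ v → InCle i j v × D v ≐ D u
  lower-degrees zero    i j u supp low out = u , subst (λ k → InCle i k u) (ℤ.+-identityʳ j) supp , ≐-refl
  lower-degrees (suc N) i j u supp low out =
    let v , suppv , eq = lower-degrees N i j (u ⊖ D t) (subst (λ k' → InCle i k' (u ⊖ D t)) shift supp')
                           (λ k' le S → trans (cut-cong (at k') (D-peeled u t suppt) S) (low k' le S)) out in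
    v , suppv , λ S → trans (eq S) (D-peeled u t suppt S)
    where
    k = j ℤ.+ + suc N
    j<k : ℤ.1ℤ ℤ.+ j ℤ.≤ k
    j<k = ≤-linear {+ 0} {+ 0} N ℤ.≤-refl (solveℤ 2 (λ j N → ((j +ℤ (conℤ ℤ.1ℤ +ℤ N)) +ℤ conℤ (+ 0)) ≔ℤ (((conℤ ℤ.1ℤ +ℤ j) +ℤ conℤ (+ 0)) +ℤ N)) refl j (+ N))
    shift : k ℤ.- ℤ.1ℤ ≡ j ℤ.+ + N
    shift = solveℤ 2 (λ j N → ((j +ℤ (conℤ ℤ.1ℤ +ℤ N)) -ℤ conℤ ℤ.1ℤ) ≔ℤ (j +ℤ N)) refl j (+ N)
    peeled = peel i k u supp (low k j<k) (out k j<k)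
    t = proj₁ peeled
    suppt = proj₁ (proj₂ peeled)
    supp' = proj₂ (proj₂ peeled)

  -- Peels a D-cocycle from its top degree downwards and collects the corrections. This ends because
  -- degrees are not negative; `N` bounds the number of degrees left.
  solve-low : ∀ N i k r → ℤ.1ℤ ℤ.+ k ℤ.≤ + N → InCle i k r → D r ≐ zeroC → (∀ k' → k' ℤ.≤ k → Outside i k') →
              ∃ λ v → InCle (i ℤ.- ℤ.1ℤ) k v × D v ≐ r
  -- Here `k` is negative, so `r` has no state in its support.
  solve-low zero i k r neg supp cocycle out = zeroC , Supp-zero , λ S → trans (D-zero ≐-refl S) (sym (Supp-∅ (λ {S} → none S) supp S))
    where
    none : ∀ S → ¬ (Valid S × (+ dimS S ≡ i) × (+ degS S ℤ.≤ k))
    none S (_ , _ , le) = absurd-≤ (degS S) (ℤ.+-mono-≤ neg le)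
      (solveℤ 2 (λ k x → ((conℤ ℤ.1ℤ +ℤ k) +ℤ x) ≔ℤ ((conℤ ℤ.1ℤ +ℤ (conℤ (+ 0) +ℤ k)) +ℤ x)) refl k (+ degS S))
  solve-low (suc N) i k r le supp cocycle out =
    let v , suppv , eq = solve-low N i (k ℤ.- ℤ.1ℤ) (r ⊖ D t) lowered supp'
                           (λ S → trans (D-peeled r t suppt S) (cocycle S)) (λ k' le' → out k' (ℤ.≤-trans le' (ℤ.i-j≤i k (+ 1)))) in
    (v ⊕ t) , Supp-⊕ (InCle-mono {i ℤ.- ℤ.1ℤ} (ℤ.i-j≤i k (+ 1)) suppv) (InC-le suppt) , λ S → trans (D-⊕ v t S) (trans (cong (_+ D t S) (eq S))
      (solve 2 (λ a b → (a :- b) :+ b := a) refl (r S) (D t S)))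
    where
    peeled = peel i k r supp (part-zero k cocycle) (out k ℤ.≤-refl)
    t = proj₁ peeled
    suppt = proj₁ (proj₂ peeled)
    supp' = proj₂ (proj₂ peeled)
    lowered : ℤ.1ℤ ℤ.+ (k ℤ.- ℤ.1ℤ) ℤ.≤ + N
    lowered = ≤-linear 0 le (solveℤ 2 (λ k N → (N +ℤ (conℤ ℤ.1ℤ +ℤ k)) ≔ℤ (((conℤ ℤ.1ℤ +ℤ (k -ℤ conℤ ℤ.1ℤ)) +ℤ (conℤ ℤ.1ℤ +ℤ N)) +ℤ conℤ (+ 0))) refl k (+ N))

  InImΦ-resp : ∀ i j {z z'} → z ≐ z' → InImΦ i j z → InImΦ i j z'
  InImΦ-resp i j e (w , y , inw , dw , iny , eq) = w , y , inw , dw , iny ,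
    λ S → trans (cong (λ x → Φ w S - x) (sym (e S))) (eq S)

  exact⇒InImΦ : ∀ i j {z} t → InC (i ℤ.- ℤ.1ℤ) j t → d t ≐ z → InImΦ i j z
  exact⇒InImΦ i j {z} t suppt eq = zeroC , neg t , Supp-zero , extend-zero dImg ≐-refl , Supp-neg suppt , λ S →
    trans (cong (_- z S) (extend-zero ΦImg ≐-refl S)) (trans (ℚ.+-identityˡ (- z S))
      (trans (cong -_ (sym (eq S))) (sym (extend-neg dImg t S))))

  leading-cocycle : ∀ {i j z} → InCle i j z → D z ≐ zeroC → d (part j z) ≐ zeroC
  leading-cocycle {i} {j} {z} cle Dz S = begin
    d (part j z) S                                  ≡⟨ ℚ.+-identityˡ _ ⟨
    0ℚ + d (part j z) S                             ≡⟨ cong (_+ d (part j z) S) (extend-zero ΦImg (part-none {i} {ℤ._≤ j} (j ℤ.+ + 2) (≰+2 j) cle) S) ⟨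
    Φ (part (j ℤ.+ + 2) z) S + d (part j z) S       ≡⟨ part-D j (graded⇒valid {i} {ℤ._≤ j} cle) S ⟨
    part j (D z) S                                  ≡⟨ part-zero j Dz S ⟩
    0ℚ ∎
    where open ≡-Reasoning

  -- In the strip, components of `u` of degree above j+2 lie above the diagonal and can be peeled
  -- off. The remaining `u'` has its top part `w` in degree j+2, a d-cocycle, and degree `j` of the
  -- equation reads z_j = Φ w + d u'_j. Off the strip z_j is itself a d-coboundary.
  boundary⇒InImΦ : ∀ i j z v u → InCle i j z → D z ≐ zeroC → InCle i (j ℤ.- ℤ.1ℤ) v → InCtot (i ℤ.- ℤ.1ℤ) u →
                   (z ⊖ v) ≐ D u → InImΦ i j (part j z)
  boundary⇒InImΦ i j z v u cle Dz clev totu eq = go (outside? i j)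
    where
    open ≡-Reasoning
    go : Outside i j ⊎ Inside i j → InImΦ i j (part j z)
    go (inj₁ out) =
      let t , suppt , eqt = vanish i j out (part j z) (Supp-part {i} {ℤ._≤ j} j cle) (leading-cocycle {i} cle Dz) in
      exact⇒InImΦ i j t suppt eqt
    go (inj₂ ins) = w , neg (part j u') , Supp-part {i ℤ.- ℤ.1ℤ} {ℤ._≤ j ℤ.+ + 2} (j ℤ.+ + 2) suppu' , dw
                  , Supp-neg (Supp-part {i ℤ.- ℤ.1ℤ} {ℤ._≤ j ℤ.+ + 2} j suppu') , λ S → begin
        Φ w S - part j z S
          ≡⟨ cong (λ x → Φ w S - x) (at-j S) ⟩
        Φ w S - (Φ w S + d (part j u') S)
          ≡⟨ solve 2 (λ a b → a :- (a :+ b) := :- b) refl (Φ w S) (d (part j u') S) ⟩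
        - d (part j u') S
          ≡⟨ extend-neg dImg (part j u') S ⟨
        d (neg (part j u')) S ∎
      where
      bound = bounded (+ n ℤ.- (j ℤ.+ + 2))
      N = proj₁ bound
      -- No state has more than `n` labels `x`; `N` is chosen so that `(j + 2) + N` is at least `n`.
      suppu : InCle (i ℤ.- ℤ.1ℤ) ((j ℤ.+ + 2) ℤ.+ + N) u
      suppu = Supp-mono (λ { {S} (val , di) → val , di , ℤ.≤-trans (deg≤n S) n≤ }) totu
        where
        deg≤n : ∀ S → + degS S ℤ.≤ + n
        deg≤n (s , ℓ) = +≤+ (ℕ.≤-trans (ℕ.≤-reflexive (countTrue-count ℓ)) (count-≤ (lookup ℓ)))
        n≤ : + n ℤ.≤ (j ℤ.+ + 2) ℤ.+ + N
        n≤ = ≤-linear 0 (proj₂ bound) (solveℤ 3 (λ j n N → (((j +ℤ conℤ (+ 2)) +ℤ N) +ℤ (n -ℤ (j +ℤ conℤ (+ 2)))) ≔ℤ ((n +ℤ N) +ℤ conℤ (+ 0))) refl j (+ n) (+ N))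
      high : ∀ k → ℤ.1ℤ ℤ.+ j ℤ.≤ k → part k (D u) ≐ zeroC
      high k lt S = trans (cut-cong (at k) (λ S → sym (eq S)) S)
        (part-none {i} {ℤ._≤ j} k (λ le → absurd-≤ 0 (ℤ.≤-trans lt le) (sym (ℤ.+-identityʳ _)))
          (Supp-⊖ cle (InCle-mono {i} (ℤ.i-j≤i j (+ 1)) clev)) S)
      lowered = lower-degrees N (i ℤ.- ℤ.1ℤ) (j ℤ.+ + 2) u suppu
        (λ k lt → high k (≤-linear 2 lt (solveℤ 2 (λ j k → (k +ℤ (conℤ ℤ.1ℤ +ℤ (j +ℤ conℤ (+ 2)))) ≔ℤ (((conℤ ℤ.1ℤ +ℤ j) +ℤ k) +ℤ conℤ (+ 2))) refl j k)))
        (λ k lt → above (≤-linear 0 (ℤ.+-mono-≤ (Inside.lower ins) lt)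
          (solveℤ 4 (λ i j k n → (((i -ℤ conℤ ℤ.1ℤ) +ℤ k) +ℤ ((conℤ ℤ.1ℤ +ℤ n) +ℤ (conℤ ℤ.1ℤ +ℤ (j +ℤ conℤ (+ 2)))))
            ≔ℤ (((conℤ ℤ.1ℤ +ℤ n) +ℤ ((conℤ (+ 2) +ℤ (i +ℤ j)) +ℤ k)) +ℤ conℤ (+ 0))) refl i j k (+ n))))
      u' = proj₁ lowered
      suppu' = proj₁ (proj₂ lowered)
      Du' = proj₂ (proj₂ lowered)
      valu' : Supp Valid u'
      valu' = graded⇒valid {i ℤ.- ℤ.1ℤ} {ℤ._≤ j ℤ.+ + 2} suppu'
      w = part (j ℤ.+ + 2) u'
      dw : d w ≐ zeroC
      dw S = begin
        d w S                                             ≡⟨ ℚ.+-identityˡ _ ⟨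
        0ℚ + d w S                                        ≡⟨ cong (_+ d w S) (extend-zero ΦImg (part-none {i ℤ.- ℤ.1ℤ} {ℤ._≤ j ℤ.+ + 2} _ (≰+2 (j ℤ.+ + 2)) suppu') S) ⟨
        Φ (part ((j ℤ.+ + 2) ℤ.+ + 2) u') S + d w S       ≡⟨ part-D (j ℤ.+ + 2) valu' S ⟨
        part (j ℤ.+ + 2) (D u') S                         ≡⟨ cut-cong (at (j ℤ.+ + 2)) Du' S ⟩
        part (j ℤ.+ + 2) (D u) S                          ≡⟨ high (j ℤ.+ + 2) 1+j≤j+2 S ⟩
        0ℚ ∎
        where
        1+j≤j+2 : ℤ.1ℤ ℤ.+ j ℤ.≤ j ℤ.+ + 2
        1+j≤j+2 = ≤-linear {+ 0} {+ 0} 1 ℤ.≤-refl (solveℤ 1 (λ j → ((j +ℤ conℤ (+ 2)) +ℤ conℤ (+ 0)) ≔ℤ (((conℤ ℤ.1ℤ +ℤ j) +ℤ conℤ (+ 0)) +ℤ conℤ ℤ.1ℤ)) refl j)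
      at-j : part j z ≐ (Φ w ⊕ d (part j u'))
      at-j S = begin
        part j z S                    ≡⟨ solve 1 (λ x → x := x :- con 0ℚ) refl (part j z S) ⟩
        part j z S - 0ℚ               ≡⟨ cong (λ x → part j z S - x) (part-none {i} {ℤ._≤ j ℤ.- ℤ.1ℤ} j ≰-1 clev S) ⟨
        part j z S - part j v S       ≡⟨ part-⊖ j z v S ⟨
        part j (z ⊖ v) S              ≡⟨ cut-cong (at j) eq S ⟩
        part j (D u) S                ≡⟨ cut-cong (at j) Du' S ⟨
        part j (D u') S               ≡⟨ part-D j valu' S ⟩
        Φ w S + d (part j u') S ∎
        where
        ≰-1 : ¬ (j ℤ.≤ j ℤ.- ℤ.1ℤ)
        ≰-1 le = absurd-≤ 0 le (solveℤ 1 (λ j → j ≔ℤ ((conℤ ℤ.1ℤ +ℤ (j -ℤ conℤ ℤ.1ℤ)) +ℤ conℤ (+ 0))) refl j)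

  -- Degree j-2 of `D z = 0` reads Φ z_j = -d z_(j-2), which exhibits Φ z_j as a d-coboundary.
  leading-InKerΦ : ∀ i j z → InCle i j z → D z ≐ zeroC → InKerΦ i j (part j z)
  leading-InKerΦ i j z cle Dz = Supp-part {i} {ℤ._≤ j} j cle , leading-cocycle {i} cle Dz
    , neg (part (j ℤ.- + 2) z) , Supp-neg (Supp-part {i} {ℤ._≤ j} (j ℤ.- + 2) cle) , λ S → begin
      Φ (part j z) S
        ≡⟨ cong (λ k → Φ (part k z) S) (solveℤ 1 (λ j → ((j -ℤ conℤ (+ 2)) +ℤ conℤ (+ 2)) ≔ℤ j) refl j) ⟨
      Φ (part (j ℤ.- + 2 ℤ.+ + 2) z) S
        ≡⟨ solve 2 (λ a b → a := (a :+ b) :- b) refl (Φ (part (j ℤ.- + 2 ℤ.+ + 2) z) S) (d (part (j ℤ.- + 2) z) S) ⟩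
      (Φ (part (j ℤ.- + 2 ℤ.+ + 2) z) S + d (part (j ℤ.- + 2) z) S) - d (part (j ℤ.- + 2) z) S
        ≡⟨ cong (_- d (part (j ℤ.- + 2) z) S) (trans (sym (part-D (j ℤ.- + 2) (graded⇒valid {i} {ℤ._≤ j} cle) S)) (part-zero (j ℤ.- + 2) Dz S)) ⟩
      0ℚ - d (part (j ℤ.- + 2) z) S
        ≡⟨ ℚ.+-identityˡ _ ⟩
      - d (part (j ℤ.- + 2) z) S
        ≡⟨ extend-neg dImg (part (j ℤ.- + 2) z) S ⟨
      d (neg (part (j ℤ.- + 2) z)) S ∎
    where open ≡-Reasoning

  -- With Φ y = d y', the cochain y - y' fails to be a D-cocycle only by -Φ y', of dimension i+1 and
  -- degree j-4. From there downwards everything lies below the strip, so a correction `v` of degree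
  -- at most j-4 exists and leaves the leading part `y` alone.
  leading-lift : ∀ i j y → InKerΦ i j y → Inside i j → ∃ λ z → InCle i j z × D z ≐ zeroC × part j z ≐ y
  leading-lift i j y (iny , dy , y' , iny' , eq) ins = z , suppz , Dz , part-z
    where
    open ≡-Reasoning
    r = D (y ⊖ y')
    tot : Supp Valid (y ⊖ y')
    tot = Supp-⊖ (graded⇒valid {i} {_≡ j} iny) (graded⇒valid {i} {_≡ j ℤ.- + 2} iny')
    r≐ : neg (Φ y') ≐ r
    r≐ S = sym (begin
      r S
        ≡⟨ D-⊖ y y' S ⟩
      (Φ y S + d y S) - (Φ y' S + d y' S)
        ≡⟨ cong₂ (λ a b → (a + b) - (Φ y' S + d y' S)) (eq S) (dy S) ⟩
      (d y' S + 0ℚ) - (Φ y' S + d y' S)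
        ≡⟨ solve 2 (λ a b → (a :+ con 0ℚ) :- (b :+ a) := :- b) refl (d y' S) (Φ y' S) ⟩
      - Φ y' S ∎)
    suppr : InCle (ℤ.1ℤ ℤ.+ i) (j ℤ.- + 4) r
    suppr = Supp-resp r≐ (Supp-neg (Supp-mono (λ { {S} (val , di , de) → val , di , ≤-linear 0 (ℤ.≤-reflexive de)
      (solveℤ 2 (λ j x → ((j -ℤ conℤ (+ 4)) +ℤ (x +ℤ conℤ (+ 2))) ≔ℤ ((x +ℤ (j -ℤ conℤ (+ 2))) +ℤ conℤ (+ 0))) refl j (+ degS S)) })
      (Supp-Φ {i} {_≡ j ℤ.- + 2} iny')))
    bound = bounded (ℤ.1ℤ ℤ.+ (j ℤ.- + 4))
    correction = solve-low (proj₁ bound) (ℤ.1ℤ ℤ.+ i) (j ℤ.- + 4) r (proj₂ bound) suppr (D² tot)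
      (λ k le → below (≤-linear 1 (ℤ.+-mono-≤ (Inside.upper ins) le)
        (solveℤ 4 (λ i j k n → (n +ℤ ((i +ℤ j) +ℤ k)) ≔ℤ (((conℤ (+ 2) +ℤ ((conℤ ℤ.1ℤ +ℤ i) +ℤ k)) +ℤ (n +ℤ (j -ℤ conℤ (+ 4)))) +ℤ conℤ ℤ.1ℤ)) refl i j k (+ n))))
    v = proj₁ correction
    suppv : InCle i (j ℤ.- + 4) v
    suppv = subst (λ i' → InCle i' (j ℤ.- + 4) v) (solveℤ 1 (λ i → ((conℤ ℤ.1ℤ +ℤ i) -ℤ conℤ ℤ.1ℤ) ≔ℤ i) refl i) (proj₁ (proj₂ correction))
    z = (y ⊖ y') ⊖ v
    suppz : InCle i j z
    suppz = Supp-⊖ (Supp-⊖ (InC-le iny) (InCle-mono {i} (ℤ.i-j≤i j (+ 2)) (InC-le iny'))) (InCle-mono {i} (ℤ.i-j≤i j (+ 4)) suppv)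
    Dz : D z ≐ zeroC
    Dz S = trans (D-⊖ (y ⊖ y') v S) (trans (cong (λ x → r S - x) (proj₂ (proj₂ correction) S)) (ℚ.+-inverseʳ (r S)))
    part-z : part j z ≐ y
    part-z S = begin
      part j z S                                  ≡⟨ part-⊖ j (y ⊖ y') v S ⟩
      part j (y ⊖ y') S - part j v S              ≡⟨ cong (_- part j v S) (part-⊖ j y y' S) ⟩
      (part j y S - part j y' S) - part j v S     ≡⟨ cong₂ (λ a b → (part j y S - a) - b)
                                                       (part-none {i} {_≡ j ℤ.- + 2} j j≢ iny' S) (part-none {i} {ℤ._≤ j ℤ.- + 4} j j≰ suppv S) ⟩
      (part j y S - 0ℚ) - 0ℚ                      ≡⟨ cong (λ a → (a - 0ℚ) - 0ℚ) (part-self {i} iny S) ⟩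
      (y S - 0ℚ) - 0ℚ                             ≡⟨ solve 1 (λ x → (x :- con 0ℚ) :- con 0ℚ := x) refl (y S) ⟩
      y S ∎
      where
      j≢ : ¬ (j ≡ j ℤ.- + 2)
      j≢ e = absurd-≤ 1 (ℤ.≤-reflexive e) (solveℤ 1 (λ j → j ≔ℤ ((conℤ ℤ.1ℤ +ℤ (j -ℤ conℤ (+ 2))) +ℤ conℤ ℤ.1ℤ)) refl j)
      j≰ : ¬ (j ℤ.≤ j ℤ.- + 4)
      j≰ le = absurd-≤ 3 le (solveℤ 1 (λ j → j ≔ℤ ((conℤ ℤ.1ℤ +ℤ (j -ℤ conℤ (+ 4))) +ℤ conℤ (+ 3))) refl j)

  -- A class is sent to the degree `j` part of the representative of degree at most `j` stored in
  -- its membership proof. The choice is not linear, so `resp`, `add` and `scal` all compare two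
  -- choices: their difference is, up to lower degree, a D-coboundary, and `boundary⇒InImΦ` applies.
  leading-iso : ∀ i j → LHS i j ≅ RHS i j
  leading-iso i j = record
    { φ    = λ x p → part j (rep′ p)
    ; into = λ x p → leading-InKerΦ i j (rep′ p) (cle p) (D-rep p)
    ; resp = λ x y p q (_ , _ , v , u , clev , _ , totu , eq) → InImΦ-resp i j (part-⊖ j (rep′ p) (rep′ q))
        (boundary⇒InImΦ i j (rep′ p ⊖ rep′ q) v ((u ⊖ prim p) ⊕ prim q)
          (Supp-⊖ (cle p) (cle q)) (λ S → trans (D-⊖ (rep′ p) (rep′ q) S) (cong₂ _-_ (D-rep p S) (D-rep q S))) clev
          (Supp-⊕ (Supp-⊖ totu (tot p)) (tot q))
          (λ S → begin
            (rep′ p S - rep′ q S) - v S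
              ≡⟨ solve 5 (λ x y a b v → (a :- b) :- v := (((x :- y) :- v) :- (x :- a)) :+ (y :- b)) refl (x S) (y S) (rep′ p S) (rep′ q S) (v S) ⟩
            (((x S - y S) - v S) - (x S - rep′ p S)) + (y S - rep′ q S)
              ≡⟨ cong₂ _+_ (cong₂ _-_ (eq S) (diff p S)) (diff q S) ⟩
            (D u S - D (prim p) S) + D (prim q) S
              ≡⟨ cong (_+ D (prim q) S) (D-⊖ u (prim p) S) ⟨
            D (u ⊖ prim p) S + D (prim q) S
              ≡⟨ D-⊕ (u ⊖ prim p) (prim q) S ⟨
            D ((u ⊖ prim p) ⊕ prim q) S ∎))
    ; add  = λ x y p q r → InImΦ-resp i j
        (λ S → trans (part-⊖ j (rep′ r) (rep′ p ⊕ rep′ q) S) (cong (λ a → part j (rep′ r) S - a) (cut-⊕ (at j) (rep′ p) (rep′ q) S)))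
        (boundary⇒InImΦ i j (rep′ r ⊖ (rep′ p ⊕ rep′ q)) zeroC ((prim p ⊕ prim q) ⊖ prim r)
          (Supp-⊖ (cle r) (Supp-⊕ (cle p) (cle q)))
          (λ S → trans (D-⊖ (rep′ r) (rep′ p ⊕ rep′ q) S) (cong₂ _-_ (D-rep r S)
            (trans (D-⊕ (rep′ p) (rep′ q) S) (cong₂ _+_ (D-rep p S) (D-rep q S)))))
          Supp-zero (Supp-⊖ (Supp-⊕ (tot p) (tot q)) (tot r))
          (λ S → begin
            (rep′ r S - (rep′ p S + rep′ q S)) - 0ℚ
              ≡⟨ solve 5 (λ x y a b c → (c :- (a :+ b)) :- con 0ℚ := ((x :- a) :+ (y :- b)) :- ((x :+ y) :- c)) refl (x S) (y S) (rep′ p S) (rep′ q S) (rep′ r S) ⟩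
            ((x S - rep′ p S) + (y S - rep′ q S)) - ((x S + y S) - rep′ r S)
              ≡⟨ cong₂ _-_ (cong₂ _+_ (diff p S) (diff q S)) (diff r S) ⟩
            (D (prim p) S + D (prim q) S) - D (prim r) S
              ≡⟨ cong (_- D (prim r) S) (D-⊕ (prim p) (prim q) S) ⟨
            D (prim p ⊕ prim q) S - D (prim r) S
              ≡⟨ D-⊖ (prim p ⊕ prim q) (prim r) S ⟨
            D ((prim p ⊕ prim q) ⊖ prim r) S ∎))
    ; scal = λ c x p q → InImΦ-resp i j
        (λ S → trans (part-⊖ j (rep′ q) (c ⊙ rep′ p) S) (cong (λ a → part j (rep′ q) S - a) (cut-⊙ (at j) c (rep′ p) S)))
        (boundary⇒InImΦ i j (rep′ q ⊖ (c ⊙ rep′ p)) zeroC ((c ⊙ prim p) ⊖ prim q)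
          (Supp-⊖ (cle q) (Supp-⊙ c (cle p)))
          (λ S → trans (D-⊖ (rep′ q) (c ⊙ rep′ p) S) (cong₂ _-_ (D-rep q S)
            (trans (D-⊙ c (rep′ p) S) (trans (cong (c *_) (D-rep p S)) (ℚ.*-zeroʳ c)))))
          Supp-zero (Supp-⊖ (Supp-⊙ c (tot p)) (tot q))
          (λ S → begin
            (rep′ q S - c * rep′ p S) - 0ℚ
              ≡⟨ solve 4 (λ x c a b → (b :- c :* a) :- con 0ℚ := c :* (x :- a) :- (c :* x :- b)) refl (x S) c (rep′ p S) (rep′ q S) ⟩
            c * (x S - rep′ p S) - (c * x S - rep′ q S)
              ≡⟨ cong₂ (λ a b → c * a - b) (diff p S) (diff q S) ⟩
            c * D (prim p) S - D (prim q) S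
              ≡⟨ cong (_- D (prim q) S) (D-⊙ c (prim p) S) ⟨
            D (c ⊙ prim p) S - D (prim q) S
              ≡⟨ D-⊖ (c ⊙ prim p) (prim q) S ⟨
            D ((c ⊙ prim p) ⊖ prim q) S ∎))
    ; inj  = injective
    ; surj = surjective
    }
    where
    open ≡-Reasoning
    module _ {x} (p : InHle i j x) where
      rep′ prim : Cochain
      rep′ = proj₁ (proj₂ (proj₂ p))
      prim = proj₁ (proj₂ (proj₂ (proj₂ p)))
      cle : InCle i j rep′
      cle = proj₁ (proj₂ (proj₂ (proj₂ (proj₂ p))))
      D-rep : D rep′ ≐ zeroC
      D-rep = proj₁ (proj₂ (proj₂ (proj₂ (proj₂ (proj₂ p)))))
      tot : InCtot (i ℤ.- ℤ.1ℤ) prim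
      tot = proj₁ (proj₂ (proj₂ (proj₂ (proj₂ (proj₂ (proj₂ p))))))
      diff : (x ⊖ rep′) ≐ D prim
      diff = proj₂ (proj₂ (proj₂ (proj₂ (proj₂ (proj₂ (proj₂ p))))))

    -- If the difference `c` of the leading parts equals Φ w - d v with d w = 0, then D (w - v) = c
    -- - Φ v. It has leading part `c` and a remainder of degree j-2, so subtracting it leaves a
    -- representative of degree at most j-1.
    injective : ∀ x y (p : InHle i j x) (q : InHle i j y) → InImΦ i j (part j (rep′ p) ⊖ part j (rep′ q)) →
                InHle i (j ℤ.- ℤ.1ℤ) (x ⊖ y)
    injective x y p q (w , v , inw , dw , inv , eq) =
      Supp-⊖ (proj₁ p) (proj₁ q) , (λ S → trans (D-⊖ x y S) (cong₂ _-_ (proj₁ (proj₂ p) S) (proj₁ (proj₂ q) S))) ,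
      z , (prim p ⊖ prim q) ⊕ (w ⊖ v) , Supp-pred suppz gone , Dz ,
      Supp-⊕ (Supp-⊖ (tot p) (tot q)) totu , λ S → begin
        (x S - y S) - ((a S - b S) - D (w ⊖ v) S)
          ≡⟨ solve 5 (λ x y a b c → (x :- y) :- ((a :- b) :- c) := ((x :- a) :- (y :- b)) :+ c) refl (x S) (y S) (a S) (b S) (D (w ⊖ v) S) ⟩
        ((x S - a S) - (y S - b S)) + D (w ⊖ v) S
          ≡⟨ cong₂ (λ e e' → (e - e') + D (w ⊖ v) S) (diff p S) (diff q S) ⟩
        (D (prim p) S - D (prim q) S) + D (w ⊖ v) S
          ≡⟨ cong (_+ D (w ⊖ v) S) (D-⊖ (prim p) (prim q) S) ⟨
        D (prim p ⊖ prim q) S + D (w ⊖ v) S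
          ≡⟨ D-⊕ (prim p ⊖ prim q) (w ⊖ v) S ⟨
        D ((prim p ⊖ prim q) ⊕ (w ⊖ v)) S ∎
      where
      a = rep′ p
      b = rep′ q
      c = part j a ⊖ part j b
      z = (a ⊖ b) ⊖ D (w ⊖ v)
      totu : InCtot (i ℤ.- ℤ.1ℤ) (w ⊖ v)
      totu = Supp-⊖ (InCle-tot {i ℤ.- ℤ.1ℤ} (InC-le inw)) (InCle-tot {i ℤ.- ℤ.1ℤ} (InC-le inv))
      Dz : D z ≐ zeroC
      Dz S = begin
        D z S                                   ≡⟨ D-⊖ (a ⊖ b) (D (w ⊖ v)) S ⟩
        D (a ⊖ b) S - D (D (w ⊖ v)) S           ≡⟨ cong₂ _-_ (D-⊖ a b S) (D² (InCtot-valid {i ℤ.- ℤ.1ℤ} totu) S) ⟩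
        (D a S - D b S) - 0ℚ                    ≡⟨ cong₂ (λ e e' → (e - e') - 0ℚ) (D-rep p S) (D-rep q S) ⟩
        0ℚ ∎
      Dwv : (c ⊖ Φ v) ≐ D (w ⊖ v)
      Dwv S = sym (begin
        D (w ⊖ v) S                                  ≡⟨ D-⊖ w v S ⟩
        (Φ w S + d w S) - (Φ v S + d v S)            ≡⟨ cong₂ (λ e e' → (Φ w S + e) - (Φ v S + e')) (dw S) (sym (eq S)) ⟩
        (Φ w S + 0ℚ) - (Φ v S + (Φ w S - c S))       ≡⟨ solve 3 (λ a b c → (a :+ con 0ℚ) :- (b :+ (a :- c)) := c :- b) refl (Φ w S) (Φ v S) (c S) ⟩
        c S - Φ v S ∎)
      suppc : InC i j c
      suppc = Supp-⊖ (Supp-part {i} {ℤ._≤ j} j (cle p)) (Supp-part {i} {ℤ._≤ j} j (cle q))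
      suppΦv : Supp (Graded i (λ k → k ℤ.+ + 2 ≡ j)) (Φ v)
      suppΦv = subst (λ i' → Supp (Graded i' (λ k → k ℤ.+ + 2 ≡ j)) (Φ v)) (suc-pred-ℤ i) (Supp-Φ {i ℤ.- ℤ.1ℤ} {_≡ j} inv)
      suppz : InCle i j z
      suppz = Supp-⊖ (Supp-⊖ (cle p) (cle q)) (Supp-resp Dwv (Supp-⊖ (InC-le suppc)
        (Supp-mono (λ { {S} (val , di , de) → val , di , ℤ.≤-trans (ℤ.i≤i+j (+ degS S) (+ 2)) (ℤ.≤-reflexive de) }) suppΦv)))
      gone : part j z ≐ zeroC
      gone S = begin
        part j z S
          ≡⟨ part-⊖ j (a ⊖ b) (D (w ⊖ v)) S ⟩
        part j (a ⊖ b) S - part j (D (w ⊖ v)) S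
          ≡⟨ cong₂ _-_ (part-⊖ j a b S) (cut-cong (at j) (≐-sym Dwv) S) ⟩
        c S - part j (c ⊖ Φ v) S
          ≡⟨ cong (λ e → c S - e) (part-⊖ j c (Φ v) S) ⟩
        c S - (part j c S - part j (Φ v) S)
          ≡⟨ cong₂ (λ e e' → c S - (e - e')) (part-self {i} suppc S)
               (part-none {i} {λ k → k ℤ.+ + 2 ≡ j} j (λ e → ≰+2 j (ℤ.≤-reflexive e)) suppΦv S) ⟩
        c S - (c S - 0ℚ)
          ≡⟨ solve 1 (λ c → c :- (c :- con 0ℚ) := con 0ℚ) refl (c S) ⟩
        0ℚ ∎

    lift : ∀ z → InCle i j z → D z ≐ zeroC → InHle i j z
    lift z clez Dz = InCle-tot clez , Dz , z , zeroC , clez , Dz , Supp-zero ,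
      λ S → trans (ℚ.+-inverseʳ (z S)) (sym (D-zero ≐-refl S))

    surjective : ∀ y → InKerΦ i j y → Σ Cochain λ x → Σ (InHle i j x) λ p → InImΦ i j (part j (rep′ p) ⊖ y)
    surjective y ker@(iny , dy , _) = go (outside? i j)
      where
      go : Outside i j ⊎ Inside i j → Σ Cochain λ x → Σ (InHle i j x) λ p → InImΦ i j (part j (rep′ p) ⊖ y)
      go (inj₂ ins) =
        let z , clez , Dz , eq = leading-lift i j y ker ins in
        z , lift z clez Dz , exact⇒InImΦ i j zeroC Supp-zero (λ S → trans (extend-zero dImg ≐-refl S) (sym (⊖-self {part j z} {y} eq S)))
      -- Off the strip `y` is a d-coboundary, so its class is zero and is hit by the zero cochain.
      go (inj₁ out) =
        let t , suppt , eq = vanish i j out y iny dy in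
        zeroC , lift zeroC Supp-zero (D-zero ≐-refl) , exact⇒InImΦ i j (neg t) (Supp-neg suppt) (λ S → begin
          d (neg t) S             ≡⟨ extend-neg dImg t S ⟩
          - d t S                 ≡⟨ cong -_ (eq S) ⟩
          - y S                   ≡⟨ ℚ.+-identityˡ (- y S) ⟨
          0ℚ - y S                ≡⟨ cong (_- y S) (part-zero j {zeroC} ≐-refl S) ⟨
          part j zeroC S - y S ∎)

mainTheorem7 : (Γ : Graph) → Chromatic.Connected Γ → (i j : ℤ) →
    Chromatic._≅_ Γ (Chromatic.LHS Γ i j) (Chromatic.RHS Γ i j)
mainTheorem7 Γ connected = SpectralSequence.leading-iso Γ connected
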